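{- Let $n,l,g$ be positive integers with $g\ge 3$ and let $p=\lfloor\frac{n-g-gl+l}{l+1}\rfloor$. Then the poset $(\mathcal{U}_{n,l}^{g,1},\preceq)$ has exactly $p+1$ minimal elements, namely $U_{n,l}^{g,0},U_{n,l}^{g,1},\dots,U_{n,l}^{g,p}$.
   Context: For a graph $G$ on $n$ vertices with Laplacian matrix $L(G)=D(G)-A(G)$ (degree matrix minus adjacency matrix), write $\det(\lambda I_n-L(G))=\sum_{k=0}^n(-1)^k c_k(G)\lambda^{n-k}$; the $c_k(G)$ are the Laplacian coefficients. For graphs $G,H$ of order $n$, write $G\preceq H$ if $c_k(G)\le c_k(H)$ for all $0\le k\le n$, and $G\prec H$ if $G\preceq H$ and $c_k(G)<c_k(H)$ for some $k$. A minimal element of a set of graphs (up to isomorphism) is a graph $G$ in the set such that no $H$ in the set satisfies $H\prec G$. A leaf is a vertex of degree $1$. $\mathcal{U}_{n,l}^g$ denotes the set of connected unicyclic graphs with $n$ vertices, exactly $l$ leaves and girth $g$. Every $G\in\mathcal{U}_{n,l}^g$ can be written as $C_{T_1,\dots,T_g}$: it is obtained from the cycle $C_g=u_1u_2\cdots u_g$ by attaching trees $T_1,\dots,T_g$ rooted at $u_1,\dots,u_g$ respectively. $\mathcal{U}_{n,l}^{g,1}$ is the set of $C_{T_1,\dots,T_g}\in\mathcal{U}_{n,l}^g$ with $|V(T_i)|=1$ for $i=2,\dots,g$ (all vertices off the cycle hang from the single cycle vertex $u_1$). The balanced starlike tree $BST_{m,l}$ is the tree of order $m$ with $l$ leaves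 obtained by identifying one end of each of $l$ paths, each of order $\lfloor\frac{m-1}{l}\rfloor+1$ or $\lceil\frac{m-1}{l}\rceil+1$, into a single vertex, called its center. $U_{n,l}^{g,q}$ ($q\ge 0$) is the graph of order $n$ obtained from the cycle $C_g$ and a path $P_{q+1}=w_0w_1\cdots w_q$ by identifying $w_0$ with a vertex $u_1$ of the cycle, and identifying $w_q$ with the center of $BST_{n-q-g+1,l}$ (for $q=0$ the center is identified with $u_1$).
   Formalization: Proved for l ≥ 2 and n−g−gl+l ≥ 0: for l = 1 all U_{n,l}^{g,q} coincide, so "exactly p+1" fails (n=8, g=3, p=1), and if n−g−gl+l < 0 then p is negative although the poset can be nonempty (n=5, l=2, g=3). -}

module Defs where

open import Data.Bool using (Bool; true; false; if_then_else_; _∧_; _∨_; not)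
open import Data.Nat using (ℕ; zero; suc; _+_; _*_; _∸_; _≤_; _<_; _≡ᵇ_; _<ᵇ_)
open import Data.Nat.DivMod using (_/_; _%_)
open import Data.Integer using (ℤ; +_; -_) renaming (_+_ to _+ℤ_; _*_ to _*ℤ_; _≤_ to _≤ℤ_; _<_ to _<ℤ_)
open import Data.Fin using (Fin; toℕ; punchIn) renaming (zero to fzero; suc to fsuc)
import Data.Fin as Fin
open import Data.List using (List; []; _∷_; _++_; map; upTo)
open import Data.Bool.ListAction using (any)
open import Data.Product using (Σ; _×_; _,_; ∃)
open import Data.Sum using (_⊎_)
open import Function.Bundles using (_↔_; Inverse)
open import Function.Definitions using (Injective)
open import Relation.Binary.PropositionalEquality using (_≡_; _≢_)
open import Relation.Nullary using (¬_)
open import Relation.Nullary.Decidable using (⌊_⌋)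

Graph : ℕ → Set
Graph n = Fin n → Fin n → Bool

IsSimple : ∀ {n} → Graph n → Set
IsSimple {n} G = (∀ (i j : Fin n) → G i j ≡ G j i) × (∀ (i : Fin n) → G i i ≡ false)

_≅_ : ∀ {n} → Graph n → Graph n → Set
_≅_ {n} G H = Σ (Fin n ↔ Fin n) λ σ →
  ∀ (i j : Fin n) → G i j ≡ H (Inverse.to σ i) (Inverse.to σ j)

sumFin : ∀ {n} → (Fin n → ℕ) → ℕ
sumFin {zero} f = 0
sumFin {suc n} f = f fzero + sumFin (λ i → f (fsuc i))

countFin : ∀ {n} → (Fin n → Bool) → ℕ
countFin f = sumFin (λ i → if f i then 1 else 0)

degree : ∀ {n} → Graph n → Fin n → ℕ
degree G i = countFin (G i)

edgeCount : ∀ {n} → Graph n → ℕ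
edgeCount G = sumFin (λ i → countFin (λ j → (toℕ i <ᵇ toℕ j) ∧ G i j))

leafCount : ∀ {n} → Graph n → ℕ
leafCount G = countFin (λ i → degree G i ≡ᵇ 1)

data Reachable {n} (G : Graph n) : Fin n → Fin n → Set where
  here : ∀ {u} → Reachable G u u
  step : ∀ {u v w} → G u v ≡ true → Reachable G v w → Reachable G u w

Connected : ∀ {n} → Graph n → Set
Connected {n} G = ∀ (u v : Fin n) → Reachable G u v

IsCycle : ∀ {n} → Graph n → (k : ℕ) → (Fin k → Fin n) → Set
IsCycle G k f =
  3 ≤ k × Injective _≡_ _≡_ f ×
  (∀ (i j : Fin k) → (suc (toℕ i) ≡ toℕ j) ⊎ (suc (toℕ i) ≡ k × toℕ j ≡ 0) →
     G (f i) (f j) ≡ true)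

HasCycleOfLength : ∀ {n} → Graph n → ℕ → Set
HasCycleOfLength {n} G k = Σ (Fin k → Fin n) (IsCycle G k)

HasGirth : ∀ {n} → Graph n → ℕ → Set
HasGirth G g = HasCycleOfLength G g × (∀ k → k < g → ¬ HasCycleOfLength G k)

Unicyclic : ∀ {n} → Graph n → Set
Unicyclic {n} G = IsSimple G × Connected G × edgeCount G ≡ n

InU : (n l g : ℕ) → Graph n → Set
InU n l g G = Unicyclic G × leafCount G ≡ l × HasGirth G g

-- 𝒰^{g,1}_{n,l}: G = C_{T_1,…,T_g} with |V(T_i)| = 1 for i ≥ 2, i.e. the
-- cycle u_1 … u_g can be chosen so that u_2, …, u_g carry no tree
-- (have degree exactly 2; all further vertices hang from u_1).
InU1 : (n l g : ℕ) → Graph n → Set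
InU1 n l g G = InU n l g G ×
  Σ (Fin g → Fin _) λ u → IsCycle G g u ×
    (∀ (i : Fin g) → toℕ i ≢ 0 → degree G (u i) ≡ 2)

-- Polynomials over ℤ (coefficient lists, lowest degree first),
-- determinants by Laplace expansion along the first row,
-- characteristic polynomial of the Laplacian.

Poly : Set
Poly = List ℤ

infixl 6 _+P_
infixl 7 _*P_

_+P_ : Poly → Poly → Poly
[] +P q = q
(a ∷ p) +P [] = a ∷ p
(a ∷ p) +P (b ∷ q) = (a +ℤ b) ∷ (p +P q)

_*P_ : Poly → Poly → Poly
[] *P q = []
(a ∷ p) *P q = map (a *ℤ_) q +P ((+ 0) ∷ (p *P q))

constP : ℤ → Poly
constP a = a ∷ []

varP : Poly
varP = (+ 0) ∷ (+ 1) ∷ []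

coeff : Poly → ℕ → ℤ
coeff [] k = + 0
coeff (a ∷ p) zero = a
coeff (a ∷ p) (suc k) = coeff p k

sumFinP : ∀ {n} → (Fin n → Poly) → Poly
sumFinP {zero} f = []
sumFinP {suc n} f = f fzero +P sumFinP (λ i → f (fsuc i))

signP : ℕ → Poly
signP zero = constP (+ 1)
signP (suc zero) = constP (- (+ 1))
signP (suc (suc k)) = signP k

det : ∀ {n} → (Fin n → Fin n → Poly) → Poly
det {zero} M = constP (+ 1)
det {suc n} M =
  sumFinP (λ j → signP (toℕ j) *P M fzero j *P det (λ i k → M (fsuc i) (punchIn j k)))

laplacian : ∀ {n} → Graph n → Fin n → Fin n → ℤ
laplacian G i j =
  if ⌊ i Fin.≟ j ⌋ then + (degree G i)
  else (if G i j then - (+ 1) else + 0)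

charPolyL : ∀ {n} → Graph n → Poly
charPolyL G = det (λ i j →
  (if ⌊ i Fin.≟ j ⌋ then varP else []) +P constP (- (laplacian G i j)))

signℤ : ℕ → ℤ
signℤ zero = + 1
signℤ (suc zero) = - (+ 1)
signℤ (suc (suc k)) = signℤ k

-- Laplacian coefficient c_k(G):  det(λI - L) = Σ_k (-1)^k c_k λ^{n-k}
lapCoeff : ∀ {n} → Graph n → ℕ → ℤ
lapCoeff {n} G k = signℤ k *ℤ coeff (charPolyL G) (n ∸ k)

_⪯_ : ∀ {n} → Graph n → Graph n → Set
_⪯_ {n} G H = ∀ k → k ≤ n → lapCoeff G k ≤ℤ lapCoeff H k

_≺_ : ∀ {n} → Graph n → Graph n → Set
_≺_ {n} G H = G ⪯ H × Σ ℕ λ k → k ≤ n × lapCoeff G k <ℤ lapCoeff H k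

IsMinimal : ∀ {n} → (Graph n → Set) → Graph n → Set
IsMinimal {n} S G = S G × (∀ (H : Graph n) → S H → ¬ (H ≺ G))

-- The graphs U^{g,q}_{n,l}, built from an edge list on labels 0 … n-1:
--   cycle u_1 … u_g      = 0, 1, …, g-1
--   path  w_0 w_1 … w_q  = 0, g, g+1, …, g+q-1     (w_0 = u_1)
--   center of BST        = w_q  (= 0 = u_1 if q = 0)
--   the remaining r = n-g-q vertices g+q, …, n-1 form l paths hanging
--   from the center, of orders ⌊r/l⌋ or ⌈r/l⌉  (so BST_{r+1,l}).

chainEdges : ℕ → ℕ → List (ℕ × ℕ)
chainEdges s zero = []
chainEdges s (suc zero) = []
chainEdges s (suc (suc t)) = (s , suc s) ∷ chainEdges (suc s) (suc t)

branchEdges : ℕ → ℕ → List ℕ → List (ℕ × ℕ)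
branchEdges c s [] = []
branchEdges c s (zero ∷ ls) = branchEdges c s ls
branchEdges c s (suc m ∷ ls) =
  ((c , s) ∷ chainEdges s (suc m)) ++ branchEdges c (s + suc m) ls

branchOrders : ℕ → ℕ → List ℕ
branchOrders r zero = []
branchOrders r (suc l') =
  map (λ i → if i <ᵇ (r % suc l') then suc (r / suc l') else r / suc l')
      (upTo (suc l'))

cycleEdges : ℕ → List (ℕ × ℕ)
cycleEdges g = (g ∸ 1 , 0) ∷ map (λ i → (i , suc i)) (upTo (g ∸ 1))

pathEdges : ℕ → ℕ → List (ℕ × ℕ)
pathEdges g zero = []
pathEdges g (suc q) = (0 , g) ∷ chainEdges g (suc q)

centerLabel : ℕ → ℕ → ℕ
centerLabel g zero = 0
centerLabel g (suc q) = g + q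

UEdges : (n l g q : ℕ) → List (ℕ × ℕ)
UEdges n l g q =
  cycleEdges g ++ pathEdges g q ++
  branchEdges (centerLabel g q) (g + q) (branchOrders (n ∸ g ∸ q) l)

hasEdge : List (ℕ × ℕ) → ℕ → ℕ → Bool
hasEdge es a b = any (λ { (x , y) → ((x ≡ᵇ a) ∧ (y ≡ᵇ b)) ∨ ((x ≡ᵇ b) ∧ (y ≡ᵇ a)) }) es

U : (n l g q : ℕ) → Graph n
U n l g q i j = not (toℕ i ≡ᵇ toℕ j) ∧ hasEdge (UEdges n l g q) (toℕ i) (toℕ j)

-- Let Φ_G(x) = det (xI + L(G)) = Σ c_k(G) x^{n−k}, so that ⪯ compares the coefficients of Φ. For a graph with
-- root r let B be the minor of xI + L at r and A = xB + D the full determinant; hanging one rooted graph from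
-- another acts on the pairs (D, B) by polynomials with nonnegative coefficients. If two vertices u, v are joined
-- by a bare path and carry rooted graphs X and Y, then moving a third graph W from v to u changes Φ by a
-- nonnegative multiple of D_W (A_Y B_X − A_X B_Y): W should sit at the heavier of X and Y, and any rooted graph
-- containing a path that descends k steps is at least as heavy as the path on k + 1 vertices. Such moves merge
-- the branching vertices of the tree hanging from u_1 into a single center, balance its branches, and pull this
-- center towards the cycle as long as some branch has at most g + q − 2 vertices; what remains are the graphs
-- U^{g,q} with q ≤ p. For q + 1 ≤ p the difference Φ(U^{g,q+1}) − Φ(U^{g,q}) is D_W times a polynomial whose
-- lowest coefficient is negative and whose value at x = 4 is positive, so these graphs are pairwise
-- incomparable.
module Submission where

-- The ratio A/B of a rooted graph is x + D/B, and every child T adds A_T/(A_T + B_T) to D/B.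
-- "Heavier" means that this ratio is larger, with fractions cleared and coefficients compared; so
-- attaching something at the root, or making a child heavier, makes a graph heavier. Prolonging a
-- graph by an edge at its root acts on (D, B) by a matrix of determinant 1, hence A_Y B_X - A_X B_Y
-- is unchanged when both sides are prolonged. The path identities and the comparison of consecutive
-- U^{g,q} rest on this invariance. Two obstacles shape the rest. Strictness must survive products:
-- it is certified by a positive value at x = 4, which is multiplicative and forces some coefficient
-- to be positive. And the class is defined by degrees, girth and an edge count, while the moves
-- need inductive trees: a member is taken apart leaf by leaf until only the cycle is left, and
-- isomorphisms are kept as such, so that a minimal graph is found up to isomorphism. The weight
-- calculus avoids subtraction: negative terms stand on the other side of an equation and are
-- cancelled at the end.

-- Polynomials as a commutative ring, alternating signs, evaluation.

module PolyRing where

  open import Defs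
  open import Level using (0ℓ)
  open import Data.Nat using (ℕ; zero; suc)
  import Data.Nat as ℕ
  import Data.Nat.Properties as ℕₚ
  open import Data.Integer using (ℤ; +_; -_; _+_; _*_; _≤_; _<_; +≤+; +<+; _<?_)
  open import Data.Integer.Properties
  open import Data.Integer.Tactic.RingSolver using (solve-∀)
  open import Data.List using ([]; _∷_; map)
  open import Data.Product using (Σ; _,_)
  open import Data.Empty using (⊥-elim)
  open import Algebra.Bundles using (CommutativeRing)
  open import Relation.Binary.PropositionalEquality hiding ([_])
  open import Relation.Nullary using (yes; no)

  infix 4 _≈P_
  -- Coefficient lists may end in zeros, so equality of polynomials is not equality of lists. The
  -- record wrapper lets `p` and `q` be inferred from a proof, which a bare family of coefficient
  -- equations would not.
  record _≈P_ (p q : Poly) : Set where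
    constructor mk≈
    field at : ∀ k → coeff p k ≡ coeff q k
  open _≈P_ public

  negP : Poly → Poly
  negP = map (-_)

  scale : ℤ → Poly → Poly
  scale a = map (a *_)

  shift : Poly → Poly
  shift p = + 0 ∷ p

  coeff-+ : ∀ p q k → coeff (p +P q) k ≡ coeff p k + coeff q k
  coeff-+ [] q k = sym (+-identityˡ _)
  coeff-+ (a ∷ p) [] k = sym (+-identityʳ _)
  coeff-+ (a ∷ p) (b ∷ q) zero = refl
  coeff-+ (a ∷ p) (b ∷ q) (suc k) = coeff-+ p q k

  coeff-scale : ∀ a p k → coeff (scale a p) k ≡ a * coeff p k
  coeff-scale a [] k = sym (*-zeroʳ a)
  coeff-scale a (b ∷ p) zero = refl
  coeff-scale a (b ∷ p) (suc k) = coeff-scale a p k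

  coeff-neg : ∀ p k → coeff (negP p) k ≡ - coeff p k
  coeff-neg [] k = refl
  coeff-neg (b ∷ p) zero = refl
  coeff-neg (b ∷ p) (suc k) = coeff-neg p k

  coeff-* : ∀ a p q k → coeff ((a ∷ p) *P q) k ≡ a * coeff q k + coeff (shift (p *P q)) k
  coeff-* a p q k = trans (coeff-+ (scale a q) _ k) (cong (_+ _) (coeff-scale a q k))

  ≈refl : ∀ {p} → p ≈P p
  ≈refl = mk≈ λ k → refl

  ≈sym : ∀ {p q} → p ≈P q → q ≈P p
  ≈sym e = mk≈ λ k → sym (at e k)

  ≈trans : ∀ {p q r} → p ≈P q → q ≈P r → p ≈P r
  ≈trans e f = mk≈ λ k → trans (at e k) (at f k)

  shift-cong : ∀ {p q} → p ≈P q → shift p ≈P shift q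
  shift-cong e = mk≈ λ { zero → refl ; (suc k) → at e k }

  shift-+ : ∀ p q k → coeff (shift (p +P q)) k ≡ coeff (shift p) k + coeff (shift q) k
  shift-+ p q zero = refl
  shift-+ p q (suc k) = coeff-+ p q k

  +P-cong : ∀ {p p′ q q′} → p ≈P p′ → q ≈P q′ → p +P q ≈P p′ +P q′
  +P-cong {p} {p′} {q} {q′} e f = mk≈ λ k →
    trans (coeff-+ p q k) (trans (cong₂ _+_ (at e k) (at f k)) (sym (coeff-+ p′ q′ k)))

  +P-assoc : ∀ p q r → (p +P q) +P r ≈P p +P (q +P r)
  +P-assoc p q r = mk≈ λ k →
    trans (coeff-+ (p +P q) r k) (trans (cong (_+ coeff r k) (coeff-+ p q k))
    (trans (+-assoc (coeff p k) (coeff q k) (coeff r k))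
    (trans (cong (λ z → coeff p k + z) (sym (coeff-+ q r k))) (sym (coeff-+ p (q +P r) k)))))

  +P-comm : ∀ p q → p +P q ≈P q +P p
  +P-comm p q = mk≈ λ k →
    trans (coeff-+ p q k) (trans (+-comm (coeff p k) (coeff q k)) (sym (coeff-+ q p k)))

  +P-identityʳ : ∀ p → p +P [] ≈P p
  +P-identityʳ p = mk≈ λ k → trans (coeff-+ p [] k) (+-identityʳ _)

  +P-inverseʳ : ∀ p → p +P negP p ≈P []
  +P-inverseʳ p = mk≈ λ k →
    trans (coeff-+ p (negP p) k) (trans (cong (λ z → coeff p k + z) (coeff-neg p k)) (+-inverseʳ (coeff p k)))

  negP-cong : ∀ {p q} → p ≈P q → negP p ≈P negP q
  negP-cong {p} {q} e = mk≈ λ k → trans (coeff-neg p k) (trans (cong -_ (at e k)) (sym (coeff-neg q k)))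

  *P-congʳ : ∀ p {q q′} → q ≈P q′ → p *P q ≈P p *P q′
  *P-congʳ [] e = ≈refl
  *P-congʳ (a ∷ p) {q} {q′} e = mk≈ λ k →
    trans (coeff-* a p q k)
    (trans (cong₂ (λ u v → a * u + v) (at e k) (at (shift-cong (*P-congʳ p e)) k))
    (sym (coeff-* a p q′ k)))

  -- `_*P_` recurses on its left factor only; this mirror image of `coeff-*` for the right factor is
  -- what commutativity needs.
  *P-∷ʳ : ∀ q a p k → coeff (q *P (a ∷ p)) k ≡ a * coeff q k + coeff (shift (q *P p)) k
  *P-∷ʳ [] a p zero = sym (trans (+-identityʳ _) (*-zeroʳ a))
  *P-∷ʳ [] a p (suc k) = sym (trans (+-identityʳ _) (*-zeroʳ a))
  *P-∷ʳ (b ∷ q) a p zero = trans (coeff-* b q (a ∷ p) 0) (cong (_+ + 0) (*-comm b a))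
  *P-∷ʳ (b ∷ q) a p (suc k) =
    trans (coeff-* b q (a ∷ p) (suc k))
    (trans (cong (λ z → b * coeff p k + z) (*P-∷ʳ q a p k))
    (trans (lemma (b * coeff p k) (a * coeff q k) (coeff (shift (q *P p)) k))
    (cong (λ z → a * coeff q k + z) (sym (coeff-* b q p k)))))
    where
    lemma : ∀ u v w → u + (v + w) ≡ v + (u + w)
    lemma = solve-∀

  *P-zeroʳ : ∀ p → p *P [] ≈P []
  *P-zeroʳ [] = ≈refl
  *P-zeroʳ (a ∷ p) = mk≈ λ k → trans (coeff-* a p [] k)
    (trans (cong (_+ coeff (shift (p *P [])) k) (*-zeroʳ a)) (trans (+-identityˡ _) (shift-zero k)))
    where
    shift-zero : ∀ k → coeff (shift (p *P [])) k ≡ + 0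
    shift-zero zero = refl
    shift-zero (suc k) = at (*P-zeroʳ p) k

  *P-comm : ∀ p q → p *P q ≈P q *P p
  *P-comm [] q = ≈sym (*P-zeroʳ q)
  *P-comm (a ∷ p) q = mk≈ λ k → trans (coeff-* a p q k)
    (trans (cong (λ z → a * coeff q k + z) (at (shift-cong (*P-comm p q)) k)) (sym (*P-∷ʳ q a p k)))

  *P-cong : ∀ {p p′ q q′} → p ≈P p′ → q ≈P q′ → p *P q ≈P p′ *P q′
  *P-cong {p} {p′} {q} {q′} e f =
    ≈trans (*P-congʳ p f) (≈trans (*P-comm p q′) (≈trans (*P-congʳ q′ e) (*P-comm q′ p′)))

  *P-distribˡ : ∀ r p q → r *P (p +P q) ≈P (r *P p) +P (r *P q)
  *P-distribˡ [] p q = ≈refl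
  *P-distribˡ (a ∷ r) p q = mk≈ λ k → begin
    coeff ((a ∷ r) *P (p +P q)) k
      ≡⟨ coeff-* a r (p +P q) k ⟩
    a * coeff (p +P q) k + coeff (shift (r *P (p +P q))) k
      ≡⟨ cong₂ (λ u v → a * u + v) (coeff-+ p q k)
           (trans (at (shift-cong (*P-distribˡ r p q)) k) (shift-+ (r *P p) (r *P q) k)) ⟩
    a * (coeff p k + coeff q k) + (coeff (shift (r *P p)) k + coeff (shift (r *P q)) k)
      ≡⟨ lemma a (coeff p k) (coeff q k) _ _ ⟩
    (a * coeff p k + coeff (shift (r *P p)) k) + (a * coeff q k + coeff (shift (r *P q)) k)
      ≡⟨ sym (cong₂ _+_ (coeff-* a r p k) (coeff-* a r q k)) ⟩
    coeff ((a ∷ r) *P p) k + coeff ((a ∷ r) *P q) k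
      ≡⟨ sym (coeff-+ ((a ∷ r) *P p) ((a ∷ r) *P q) k) ⟩
    coeff (((a ∷ r) *P p) +P ((a ∷ r) *P q)) k ∎
    where
    open ≡-Reasoning
    lemma : ∀ a u v s t → a * (u + v) + (s + t) ≡ (a * u + s) + (a * v + t)
    lemma = solve-∀

  *P-distribʳ : ∀ r p q → (p +P q) *P r ≈P (p *P r) +P (q *P r)
  *P-distribʳ r p q = ≈trans (*P-comm (p +P q) r)
    (≈trans (*P-distribˡ r p q) (+P-cong (*P-comm r p) (*P-comm r q)))

  scale-* : ∀ a q r → scale a q *P r ≈P scale a (q *P r)
  scale-* a [] r = ≈refl
  scale-* a (b ∷ q) r = mk≈ λ k → trans (coeff-* (a * b) (scale a q) r k)
    (trans (cong (λ z → a * b * coeff r k + z) (at (shift-cong (scale-* a q r)) k))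
    (trans (lemma k) (sym (trans (coeff-scale a ((b ∷ q) *P r) k) (cong (a *_) (coeff-* b q r k))))))
    where
    shift-scale : ∀ k → coeff (shift (scale a (q *P r))) k ≡ a * coeff (shift (q *P r)) k
    shift-scale zero = sym (*-zeroʳ a)
    shift-scale (suc k) = coeff-scale a (q *P r) k
    ring : ∀ a b u v → a * b * u + a * v ≡ a * (b * u + v)
    ring = solve-∀
    lemma : ∀ k → a * b * coeff r k + coeff (shift (scale a (q *P r))) k
                ≡ a * (b * coeff r k + coeff (shift (q *P r)) k)
    lemma k = trans (cong (λ z → a * b * coeff r k + z) (shift-scale k)) (ring a b _ _)

  shift-* : ∀ p q → shift p *P q ≈P shift (p *P q)
  shift-* p q = mk≈ λ k → trans (coeff-* (+ 0) p q k) (+-identityˡ _)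

  *P-assoc : ∀ p q r → (p *P q) *P r ≈P p *P (q *P r)
  *P-assoc [] q r = ≈refl
  *P-assoc (a ∷ p) q r = ≈trans (*P-distribʳ r (scale a q) (shift (p *P q)))
    (+P-cong (scale-* a q r) (≈trans (shift-* (p *P q) r) (shift-cong (*P-assoc p q r))))

  *P-identityˡ : ∀ p → constP (+ 1) *P p ≈P p
  *P-identityˡ p = mk≈ λ k → trans (coeff-* (+ 1) [] p k)
    (trans (cong₂ _+_ (*-identityˡ (coeff p k)) (shift-[] k)) (+-identityʳ _))
    where
    shift-[] : ∀ k → coeff (shift []) k ≡ + 0
    shift-[] zero = refl
    shift-[] (suc k) = refl

  polyRing : CommutativeRing 0ℓ 0ℓ
  polyRing = record
    { Carrier = Poly ; _≈_ = _≈P_ ; _+_ = _+P_ ; _*_ = _*P_ ; -_ = negP ; 0# = [] ; 1# = constP (+ 1)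
    ; isCommutativeRing = record
      { isRing = record
        { +-isAbelianGroup = record
          { isGroup = record
            { isMonoid = record
              { isSemigroup = record
                { isMagma = record
                  { isEquivalence = record { refl = ≈refl ; sym = ≈sym ; trans = ≈trans }
                  ; ∙-cong = +P-cong }
                ; assoc = +P-assoc }
              ; identity = (λ p → ≈refl) , +P-identityʳ }
            ; inverse = (λ p → ≈trans (+P-comm (negP p) p) (+P-inverseʳ p)) , +P-inverseʳ
            ; ⁻¹-cong = negP-cong }
          ; comm = +P-comm }
        ; *-cong = *P-cong
        ; *-assoc = *P-assoc
        ; *-identity = *P-identityˡ , λ p → ≈trans (*P-comm p (constP (+ 1))) (*P-identityˡ p)
        ; distrib = *P-distribˡ , *P-distribʳ }
      ; *-comm = *P-comm } }

  signℤ-suc : ∀ k → signℤ (suc k) ≡ - signℤ k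
  signℤ-suc zero = refl
  signℤ-suc (suc zero) = refl
  signℤ-suc (suc (suc k)) = signℤ-suc k

  signℤ-+ : ∀ m n → signℤ (m ℕ.+ n) ≡ signℤ m * signℤ n
  signℤ-+ zero n = sym (*-identityˡ _)
  signℤ-+ (suc m) n = trans (signℤ-suc (m ℕ.+ n)) (trans (cong -_ (signℤ-+ m n))
    (trans (neg-distribˡ-* (signℤ m) (signℤ n)) (cong (_* signℤ n) (sym (signℤ-suc m)))))

  signℤ-sq : ∀ k → signℤ k * signℤ k ≡ + 1
  signℤ-sq zero = refl
  signℤ-sq (suc zero) = refl
  signℤ-sq (suc (suc k)) = signℤ-sq k

  -- Alternating j p: the coefficients of p are nonnegative in powers of −λ, up to the global sign (−1)^j.
  Alternating : ℕ → Poly → Set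
  Alternating j p = ∀ k → + 0 ≤ signℤ (j ℕ.+ k) * coeff p k

  0≤* : ∀ {a b} → + 0 ≤ a → + 0 ≤ b → + 0 ≤ a * b
  0≤* {+ m} {+ n} _ _ = subst (+ 0 ≤_) (pos-* m n) (+≤+ ℕ.z≤n)

  0<* : ∀ {a b} → + 0 < a → + 0 < b → + 0 < a * b
  0<* {+ suc m} {+ suc n} _ _ = +<+ (ℕ.s≤s ℕ.z≤n)
  0<* {+ zero} (+<+ ()) _
  0<* {+ suc m} {+ zero} _ (+<+ ())

  alternating-+ : ∀ {j p q} → Alternating j p → Alternating j q → Alternating j (p +P q)
  alternating-+ {j} {p} {q} f g k =
    subst (+ 0 ≤_)
      (sym (trans (cong (signℤ (j ℕ.+ k) *_) (coeff-+ p q k)) (*-distribˡ-+ (signℤ (j ℕ.+ k)) _ _)))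
      (+-mono-≤ (f k) (g k))

  -- The tail of a list starts one power later, which flips the starting sign. The recursion
  -- therefore needs every starting index, although the cone below uses index 0 only.
  alternating-* : ∀ i j p q → Alternating i p → Alternating j q → Alternating (i ℕ.+ j) (p *P q)
  alternating-* i j [] q f g k = subst (+ 0 ≤_) (sym (*-zeroʳ (signℤ (i ℕ.+ j ℕ.+ k)))) ≤-refl
  alternating-* i j (a ∷ p) q f g k =
    subst (+ 0 ≤_)
      (sym (trans (cong (signℤ (i ℕ.+ j ℕ.+ k) *_) (coeff-* a p q k)) (*-distribˡ-+ (signℤ (i ℕ.+ j ℕ.+ k)) _ _)))
      (+-mono-≤ head-term (tail-term k))
    where
    ring : ∀ s t a c → (s * a) * (t * c) ≡ (s * t) * (a * c)
    ring = solve-∀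
    head-term : + 0 ≤ signℤ (i ℕ.+ j ℕ.+ k) * (a * coeff q k)
    head-term = subst (+ 0 ≤_)
      (trans (ring (signℤ i) (signℤ (j ℕ.+ k)) a (coeff q k))
        (cong (_* (a * coeff q k)) (trans (sym (signℤ-+ i (j ℕ.+ k))) (cong signℤ (sym (ℕₚ.+-assoc i j k))))))
      (0≤* (subst (λ m → + 0 ≤ signℤ m * a) (ℕₚ.+-identityʳ i) (f 0)) (g k))
    tail-term : ∀ k → + 0 ≤ signℤ (i ℕ.+ j ℕ.+ k) * coeff (shift (p *P q)) k
    tail-term zero = subst (+ 0 ≤_) (sym (*-zeroʳ (signℤ (i ℕ.+ j ℕ.+ 0)))) ≤-refl
    tail-term (suc k) = subst (λ m → + 0 ≤ signℤ m * coeff (p *P q) k) (sym (ℕₚ.+-suc (i ℕ.+ j) k))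
      (alternating-* (suc i) j p q
        (λ k → subst (λ m → + 0 ≤ signℤ m * coeff p k) (ℕₚ.+-suc i k) (f (suc k))) g k)

  -- Evaluation at x = −λ = 4, which is large enough to tell U^{g,q} and U^{g,q+1} apart.
  ev : Poly → ℤ
  ev [] = + 0
  ev (a ∷ p) = a + - + 4 * ev p

  ev-+ : ∀ p q → ev (p +P q) ≡ ev p + ev q
  ev-+ [] q = sym (+-identityˡ _)
  ev-+ (a ∷ p) [] = sym (+-identityʳ _)
  ev-+ (a ∷ p) (b ∷ q) = trans (cong (λ u → a + b + - + 4 * u) (ev-+ p q)) (ring a b (- + 4) (ev p) (ev q))
    where
    ring : ∀ a b c u v → a + b + c * (u + v) ≡ (a + c * u) + (b + c * v)
    ring = solve-∀

  ev-scale : ∀ a p → ev (scale a p) ≡ a * ev p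
  ev-scale a [] = sym (*-zeroʳ a)
  ev-scale a (b ∷ p) = trans (cong (λ u → a * b + - + 4 * u) (ev-scale a p)) (ring a b (- + 4) (ev p))
    where
    ring : ∀ a b c u → a * b + c * (a * u) ≡ a * (b + c * u)
    ring = solve-∀

  ev-* : ∀ p q → ev (p *P q) ≡ ev p * ev q
  ev-* [] q = refl
  ev-* (a ∷ p) q = trans (ev-+ (scale a q) (shift (p *P q)))
    (trans (cong₂ (λ u v → u + (+ 0 + - + 4 * v)) (ev-scale a q) (ev-* p q)) (ring a (- + 4) (ev p) (ev q)))
    where
    ring : ∀ a c u v → a * v + (+ 0 + c * (u * v)) ≡ (a + c * u) * v
    ring = solve-∀

  ev-zero : ∀ p → (∀ k → coeff p k ≡ + 0) → ev p ≡ + 0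
  ev-zero [] e = refl
  ev-zero (a ∷ p) e rewrite e 0 | ev-zero p (λ k → e (suc k)) = refl

  ev-cong : ∀ {p q} → p ≈P q → ev p ≡ ev q
  ev-cong {[]} {q} e = sym (ev-zero q (λ k → sym (at e k)))
  ev-cong {a ∷ p} {[]} e = ev-zero (a ∷ p) (at e)
  ev-cong {a ∷ p} {b ∷ q} e = cong₂ (λ u v → u + - + 4 * v) (at e 0) (ev-cong {p} {q} (mk≈ λ k → at e (suc k)))

  private
    ev-step : ∀ j a p → signℤ j * ev (a ∷ p) ≡ signℤ j * a + + 4 * (signℤ (suc j) * ev p)
    ev-step j a p rewrite signℤ-suc j = ring (signℤ j) a (+ 4) (ev p)
      where
      ring : ∀ s a c u → s * (a + - c * u) ≡ s * a + c * (- s * u)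
      ring = solve-∀

    alternating-head : ∀ j {a p} → Alternating j (a ∷ p) → + 0 ≤ signℤ j * a
    alternating-head j {a} f = subst (λ m → + 0 ≤ signℤ m * a) (ℕₚ.+-identityʳ j) (f 0)

    alternating-tail : ∀ j {a p} → Alternating j (a ∷ p) → Alternating (suc j) p
    alternating-tail j {a} {p} f k = subst (λ m → + 0 ≤ signℤ m * coeff p k) (ℕₚ.+-suc j k) (f (suc k))

  ev-nonneg : ∀ j p → Alternating j p → + 0 ≤ signℤ j * ev p
  ev-nonneg j [] f = subst (+ 0 ≤_) (sym (*-zeroʳ (signℤ j))) ≤-refl
  ev-nonneg j (a ∷ p) f = subst (+ 0 ≤_) (sym (ev-step j a p))
    (+-mono-≤ (alternating-head j {a} {p} f)
      (0≤* {+ 4} (+≤+ ℕ.z≤n) (ev-nonneg (suc j) p (alternating-tail j f))))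

  -- At λ = -4 every term has the sign prescribed by `Alternating`, so a positive value cannot come
  -- from zero coefficients alone. This turns the numerical certificate of strictness into one
  -- strictly larger Laplacian coefficient.
  ev-positive : ∀ j p → Alternating j p → + 0 < signℤ j * ev p →
    Σ ℕ λ k → + 0 < signℤ (j ℕ.+ k) * coeff p k
  ev-positive j [] f h = ⊥-elim (<-irrefl (sym (*-zeroʳ (signℤ j))) h)
  ev-positive j (a ∷ p) f h with + 0 <? signℤ j * a
  ... | yes h₀ = 0 , subst (λ m → + 0 < signℤ m * a) (sym (ℕₚ.+-identityʳ j)) h₀
  ... | no ¬h₀ with ev-positive (suc j) p (alternating-tail j f) tail-pos
    where
    head≡0 : signℤ j * a ≡ + 0
    head≡0 = ≤-antisym (≮⇒≥ ¬h₀) (alternating-head j {a} {p} f)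
    tail-pos : + 0 < signℤ (suc j) * ev p
    tail-pos = *-cancelˡ-<-nonNeg {+ 0} {signℤ (suc j) * ev p} (+ 4)
      (subst (+ 0 <_) (trans (ev-step j a p) (trans (cong (_+ + 4 * (signℤ (suc j) * ev p)) head≡0) (+-identityˡ _))) h)
  ... | k , h′ = suc k , subst (λ m → + 0 < signℤ m * coeff p k) (sym (ℕₚ.+-suc j k)) h′

-- Permutations of a finite set as words in generators.

module FinPerm where

  open import Data.Nat using (ℕ; zero; suc)
  open import Data.Fin using (Fin; zero; suc; punchIn; punchOut)
  open import Data.Fin.Properties using (punchIn-punchOut; punchOut-injective; suc-injective; 0≢1+n)
  open import Data.Product using (Σ; _,_)
  open import Function.Definitions using (Injective)
  open import Relation.Binary.PropositionalEquality
  open import Relation.Nullary using (contradiction)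

  infixr 9 _∙_
  -- Words in generators of the symmetric group, so that invariance is checked on generators only.
  data Code : ℕ → Set where
    idle : ∀ {n} → Code n
    swp  : ∀ {n} → Code (suc (suc n))
    lft  : ∀ {n} → Code n → Code (suc n)
    _∙_  : ∀ {n} → Code n → Code n → Code n

  act : ∀ {n} → Code n → Fin n → Fin n
  act idle i = i
  act swp zero = suc zero
  act swp (suc zero) = zero
  act swp (suc (suc i)) = suc (suc i)
  act (lft π) zero = zero
  act (lft π) (suc i) = suc (act π i)
  act (π ∙ ρ) i = act π (act ρ i)

  -- Sends 0 to k and agrees with `punchIn k` on the rest. Composing with it reduces a permutation
  -- to one that fixes 0.
  rotate : ∀ {n} → Fin (suc n) → Code (suc n)
  rotate zero = idle
  rotate {suc n} (suc k) = lft (rotate k) ∙ swp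

  rotate-zero : ∀ {n} (k : Fin (suc n)) → act (rotate k) zero ≡ k
  rotate-zero zero = refl
  rotate-zero {suc n} (suc k) = cong suc (rotate-zero k)

  rotate-suc : ∀ {n} (k : Fin (suc n)) j → act (rotate k) (suc j) ≡ punchIn k j
  rotate-suc zero j = refl
  rotate-suc {suc n} (suc k) zero = refl
  rotate-suc {suc n} (suc k) (suc j) = cong suc (rotate-suc k j)

  -- `rotate` takes care of the image of 0, and punching this image out leaves an injection of a
  -- smaller set.
  encode : ∀ {n} (f : Fin n → Fin n) → Injective _≡_ _≡_ f → Σ (Code n) λ π → ∀ i → act π i ≡ f i
  encode {zero} f inj = idle , λ ()
  encode {suc n} f inj = rotate (f zero) ∙ lft π , agree
    where
    f0≢ : ∀ j → f zero ≢ f (suc j)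
    f0≢ j e = contradiction (inj e) 0≢1+n
    f′ : Fin n → Fin n
    f′ j = punchOut (f0≢ j)
    ih = encode f′ λ {i} {j} e → suc-injective (inj (punchOut-injective (f0≢ i) (f0≢ j) e))
    π = Σ.proj₁ ih
    agree : ∀ i → act (rotate (f zero) ∙ lft π) i ≡ f i
    agree zero = rotate-zero (f zero)
    agree (suc j) = trans (rotate-suc (f zero) (act π j))
      (trans (cong (punchIn (f zero)) (Σ.proj₂ ih j)) (punchIn-punchOut (f0≢ j)))

-- Determinants over a commutative ring: transposition and permutations.

module Determinant where

  open import Level using (0ℓ)
  open import Algebra.Bundles using (CommutativeRing)

  -- The same Laplace expansion as in the statement, but over an abstract ring: there the list
  -- operations cannot unfold, and the semiring solver applies.
  module Determinants (R : CommutativeRing 0ℓ 0ℓ) where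

    open CommutativeRing R hiding (zero)
    open import Algebra.Solver.Ring.NaturalCoefficients.Default commutativeSemiring
    open import Algebra.Properties.Ring ring using (-‿involutive; -1*x≈-x)
    open import Relation.Binary.Reasoning.Setoid setoid
    open import Data.Nat using (ℕ; zero; suc)
    open import Data.Fin using (Fin; zero; suc; toℕ; punchIn)
    open FinPerm

    -1# : Carrier
    -1# = - 1#

    ∑ : ∀ {n} → (Fin n → Carrier) → Carrier
    ∑ {zero} f = 0#
    ∑ {suc n} f = f zero + ∑ (λ i → f (suc i))

    ∑-cong : ∀ {n} {f g : Fin n → Carrier} → (∀ i → f i ≈ g i) → ∑ f ≈ ∑ g
    ∑-cong {zero} e = refl
    ∑-cong {suc n} e = +-cong (e zero) (∑-cong λ i → e (suc i))

    ∑-scale : ∀ {n} c (f g : Fin n → Carrier) → (∀ i → f i ≈ c * g i) → ∑ f ≈ c * ∑ g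
    ∑-scale {zero} c f g e = sym (zeroʳ c)
    ∑-scale {suc n} c f g e = trans (+-cong (e zero) (∑-scale c (λ i → f (suc i)) (λ i → g (suc i)) (λ i → e (suc i))))
      (sym (distribˡ c _ _))

    ∑-zero : ∀ {n} {f : Fin n → Carrier} → (∀ i → f i ≈ 0#) → ∑ f ≈ 0#
    ∑-zero {zero} e = refl
    ∑-zero {suc n} e = trans (+-cong (e zero) (∑-zero λ i → e (suc i))) (+-identityˡ 0#)

    ∑-+ : ∀ {n} (f g : Fin n → Carrier) → ∑ (λ i → f i + g i) ≈ ∑ f + ∑ g
    ∑-+ {zero} f g = sym (+-identityˡ 0#)
    ∑-+ {suc n} f g = trans (+-congˡ (∑-+ (λ i → f (suc i)) (λ i → g (suc i))))
      (solve 4 (λ a b c d → (a :+ b) :+ (c :+ d) := (a :+ c) :+ (b :+ d)) refl _ _ _ _)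

    ∑-*ˡ : ∀ {n} c (f : Fin n → Carrier) → c * ∑ f ≈ ∑ (λ i → c * f i)
    ∑-*ˡ {zero} c f = zeroʳ c
    ∑-*ˡ {suc n} c f = trans (distribˡ c _ _) (+-congˡ (∑-*ˡ c (λ i → f (suc i))))

    ∑-swap : ∀ {m n} (f : Fin m → Fin n → Carrier) → ∑ (λ i → ∑ (f i)) ≈ ∑ (λ j → ∑ (λ i → f i j))
    ∑-swap {zero} {n} f = sym (∑-zero {n} λ j → refl)
    ∑-swap {suc m} f = trans (+-congˡ (∑-swap (λ i → f (suc i)))) (sym (∑-+ (f zero) _))

    sgn : ℕ → Carrier
    sgn zero = 1#
    sgn (suc zero) = -1#
    sgn (suc (suc k)) = sgn k

    -1*-1 : -1# * -1# ≈ 1#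
    -1*-1 = trans (-1*x≈-x -1#) (-‿involutive 1#)

    sgn-suc : ∀ k → sgn (suc k) ≈ -1# * sgn k
    sgn-suc zero = sym (*-identityʳ -1#)
    sgn-suc (suc zero) = sym -1*-1
    sgn-suc (suc (suc k)) = sgn-suc k

    Matrix : ℕ → Set
    Matrix n = Fin n → Fin n → Carrier

    det : ∀ {n} → Matrix n → Carrier
    det {zero} M = 1#
    det {suc n} M = ∑ (λ j → sgn (toℕ j) * M zero j * det (λ i k → M (suc i) (punchIn j k)))

    det-cong : ∀ {n} {M N : Matrix n} → (∀ i j → M i j ≈ N i j) → det M ≈ det N
    det-cong {zero} e = refl
    det-cong {suc n} {M} {N} e = ∑-cong λ j →
      *-cong (*-congˡ {sgn (toℕ j)} (e zero j)) (det-cong λ i k → e (suc i) (punchIn j k))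

    -- Expand along the first row and, by induction, each minor along its first column. The entries
    -- (0, j+1) and (i+1, 0) meet with the same doubly reduced minor, so the two sums can be
    -- exchanged; `exchange` moves the factor -1 of one sign to the other.
    det-column : ∀ {n} (M : Matrix (suc n)) →
      det M ≈ ∑ (λ i → sgn (toℕ i) * M i zero * det (λ a b → M (punchIn i a) (suc b)))
    det-column {zero} M = refl
    det-column {suc n} M = +-congˡ (begin
      ∑ (λ j → r j * det (λ a b → M (suc a) (punchIn (suc j) b)))
        ≈⟨ ∑-cong (λ j → trans (*-congˡ (det-column (λ a b → M (suc a) (punchIn (suc j) b)))) (∑-*ˡ (r j) (λ i → c i * d i j))) ⟩
      ∑ (λ j → ∑ (λ i → r j * (c i * d i j)))
        ≈⟨ ∑-swap (λ j i → r j * (c i * d i j)) ⟩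
      ∑ (λ i → ∑ (λ j → r j * (c i * d i j)))
        ≈⟨ ∑-cong (λ i → ∑-cong (λ j → exchange i j)) ⟩
      ∑ (λ i → ∑ (λ j → c′ i * (r′ j * d i j)))
        ≈⟨ ∑-cong (λ i → sym (∑-*ˡ (c′ i) (λ j → r′ j * d i j))) ⟩
      ∑ (λ i → c′ i * det (λ a b → M (punchIn (suc i) a) (suc b))) ∎)
      where
      d : Fin (suc n) → Fin (suc n) → Carrier
      d i j = det (λ a b → M (suc (punchIn i a)) (suc (punchIn j b)))
      r r′ c c′ : Fin (suc n) → Carrier
      r j = sgn (suc (toℕ j)) * M zero (suc j)
      r′ j = sgn (toℕ j) * M zero (suc j)
      c i = sgn (toℕ i) * M (suc i) zero
      c′ i = sgn (suc (toℕ i)) * M (suc i) zero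
      exchange : ∀ i j → r j * (c i * d i j) ≈ c′ i * (r′ j * d i j)
      exchange i j = begin
        r j * (c i * d i j)
          ≈⟨ *-congʳ (*-congʳ (sgn-suc (toℕ j))) ⟩
        (-1# * sgn (toℕ j) * M zero (suc j)) * (c i * d i j)
          ≈⟨ solve 6 (λ e s m t u v → (e :* s :* m) :* ((t :* u) :* v) := (e :* t :* u) :* ((s :* m) :* v)) refl
               -1# (sgn (toℕ j)) (M zero (suc j)) (sgn (toℕ i)) (M (suc i) zero) (d i j) ⟩
        (-1# * sgn (toℕ i) * M (suc i) zero) * (r′ j * d i j)
          ≈⟨ *-congʳ (*-congʳ (sym (sgn-suc (toℕ i)))) ⟩
        c′ i * (r′ j * d i j) ∎

    det-transpose : ∀ {n} (M : Matrix n) → det (λ i j → M j i) ≈ det M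
    det-transpose {zero} M = refl
    det-transpose {suc n} M = trans
      (∑-cong λ j → *-congˡ {sgn (toℕ j) * M j zero} (det-transpose (λ a b → M (punchIn j a) (suc b))))
      (sym (det-column M))

    parity : ∀ {n} → Code n → Carrier
    parity idle = 1#
    parity swp = -1#
    parity (lft π) = parity π
    parity (π ∙ ρ) = parity π * parity ρ

    parity-sq : ∀ {n} (π : Code n) → parity π * parity π ≈ 1#
    parity-sq idle = *-identityˡ 1#
    parity-sq swp = -1*-1
    parity-sq (lft π) = parity-sq π
    parity-sq (π ∙ ρ) = trans (solve 2 (λ a b → (a :* b) :* (a :* b) := (a :* a) :* (b :* b)) refl _ _)
      (trans (*-cong (parity-sq π) (parity-sq ρ)) (*-identityˡ 1#))

    -- In the expansion along the first column the terms of rows 0 and 1 trade places with opposite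
    -- signs; in every other term the swap acts on the first two rows of the minor, where induction
    -- applies.
    det-swap : ∀ {n} (M : Matrix (suc (suc n))) → det (λ i j → M (act swp i) j) ≈ -1# * det M
    det-swap {n} M = begin
      det M′
        ≈⟨ det-column M′ ⟩
      1# * M (suc zero) zero * det (λ a b → M′ (suc a) (suc b))
        + (-1# * M zero zero * det (λ a b → M′ (punchIn (suc zero) a) (suc b)) + ∑ (term M′))
        ≈⟨ +-cong (*-congˡ (minor-cong {λ a → act swp (suc a)} {punchIn (suc zero)} λ { zero b → refl ; (suc a) b → refl }))
             (+-cong (*-congˡ (minor-cong {λ a → act swp (punchIn (suc zero) a)} {suc} λ { zero b → refl ; (suc a) b → refl })) (∑-cong rest)) ⟩
      1# * M (suc zero) zero * D₁ + (-1# * M zero zero * D₀ + ∑ (λ k → -1# * term M k))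
        ≈⟨ +-cong (*-congʳ (*-congʳ (sym -1*-1))) (+-congˡ (sym (∑-*ˡ -1# (term M)))) ⟩
      -1# * -1# * M (suc zero) zero * D₁ + (-1# * M zero zero * D₀ + -1# * ∑ (term M))
        ≈⟨ solve 6 (λ e a b c d s → e :* e :* a :* b :+ (e :* c :* d :+ e :* s)
                      := e :* (con 1 :* c :* d :+ (e :* a :* b :+ s))) refl
             -1# (M (suc zero) zero) D₁ (M zero zero) D₀ (∑ (term M)) ⟩
      -1# * (1# * M zero zero * D₀ + (-1# * M (suc zero) zero * D₁ + ∑ (term M)))
        ≈⟨ *-congˡ (sym (det-column M)) ⟩
      -1# * det M ∎
      where
      M′ : Matrix (suc (suc n))
      M′ i j = M (act swp i) j
      minor-cong : ∀ {f g : Fin (suc n) → Fin (suc (suc n))} →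
        (∀ a b → M (f a) (suc b) ≈ M (g a) (suc b)) → det (λ a b → M (f a) (suc b)) ≈ det (λ a b → M (g a) (suc b))
      minor-cong {f} {g} e = det-cong {suc n} {λ a b → M (f a) (suc b)} {λ a b → M (g a) (suc b)} e
      D₀ D₁ : Carrier
      D₀ = det (λ a b → M (suc a) (suc b))
      D₁ = det (λ a b → M (punchIn (suc zero) a) (suc b))
      term : Matrix (suc (suc n)) → Fin n → Carrier
      term N k = sgn (toℕ k) * N (suc (suc k)) zero * det (λ a b → N (punchIn (suc (suc k)) a) (suc b))
      minor-swap : ∀ {n} (M : Matrix (suc (suc n))) (k : Fin n) →
        det (λ a b → M (act swp (punchIn (suc (suc k)) a)) (suc b))
          ≈ -1# * det (λ a b → M (punchIn (suc (suc k)) a) (suc b))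
      minor-swap {suc n} M k = trans
        (det-cong {suc (suc n)} {λ a b → M (act swp (punchIn (suc (suc k)) a)) (suc b)}
          {λ a b → M (punchIn (suc (suc k)) (act swp a)) (suc b)}
          λ { zero b → refl ; (suc zero) b → refl ; (suc (suc a)) b → refl })
        (det-swap (λ a b → M (punchIn (suc (suc k)) a) (suc b)))
      rest : ∀ k → term M′ k ≈ -1# * term M k
      rest k = trans (*-congˡ (minor-swap M k))
        (solve 3 (λ a e d → a :* (e :* d) := e :* (a :* d)) refl _ -1# _)

    det-rows : ∀ {n} (π : Code n) (M : Matrix n) → det (λ i j → M (act π i) j) ≈ parity π * det M
    det-rows idle M = sym (*-identityˡ _)
    det-rows swp M = det-swap M
    det-rows (lft {n} π) M = ∑-scale (parity π) _ _ λ j →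
      trans (*-congˡ {sgn (toℕ j) * M zero j} (det-rows π (λ a b → M (suc a) (punchIn j b))))
        (solve 3 (λ a e d → a :* (e :* d) := e :* (a :* d)) refl _ _ _)
    det-rows (π ∙ ρ) M = trans (det-rows ρ (λ i j → M (act π i) j))
      (trans (*-congˡ (det-rows π M)) (solve 3 (λ a e d → a :* (e :* d) := e :* a :* d) refl _ _ _))

    -- Rows and columns contribute the same parity, and its square is 1. This is the invariance of
    -- the characteristic polynomial under renaming of vertices.
    det-permute : ∀ {n} (π : Code n) (M : Matrix n) → det (λ i j → M (act π i) (act π j)) ≈ det M
    det-permute π M = begin
      det (λ i j → M (act π i) (act π j))
        ≈⟨ det-rows π (λ i j → M i (act π j)) ⟩
      parity π * det (λ i j → M i (act π j))
        ≈⟨ *-congˡ (trans (sym (det-transpose (λ i j → M i (act π j)))) (det-rows π (λ i j → M j i))) ⟩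
      parity π * (parity π * det (λ i j → M j i))
        ≈⟨ sym (*-assoc _ _ _) ⟩
      parity π * parity π * det (λ i j → M j i)
        ≈⟨ *-cong (parity-sq π) (det-transpose M) ⟩
      1# * det M
        ≈⟨ *-identityˡ _ ⟩
      det M ∎

    det-neg : ∀ {n} (M : Matrix n) → det (λ i j → -1# * M i j) ≈ sgn n * det M
    det-neg {zero} M = sym (*-identityˡ _)
    det-neg {suc n} M = ∑-scale (sgn (suc n)) _ _ λ j →
      trans (*-congˡ {sgn (toℕ j) * (-1# * M zero j)} (det-neg (λ i k → M (suc i) (punchIn j k))))
        (trans (solve 5 (λ s e m t d → s :* (e :* m) :* (t :* d) := (e :* t) :* (s :* m :* d)) refl
            (sgn (toℕ j)) -1# (M zero j) (sgn n) _)
          (*-congʳ (sym (sgn-suc n))))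

-- Determinants of block matrices, indexed by natural numbers.

module BlockDeterminant where

  open import Level using (0ℓ)
  open import Algebra.Bundles using (CommutativeRing)

  module BlockDeterminants (R : CommutativeRing 0ℓ 0ℓ) where

    open CommutativeRing R hiding (zero)
    open import Algebra.Solver.Ring.NaturalCoefficients.Default commutativeSemiring
    open import Relation.Binary.Reasoning.Setoid setoid
    open import Data.Nat as ℕ using (ℕ; zero; suc; _≤_; _<_; z≤n; s≤s; s≤s⁻¹)
    open import Data.Nat.Properties as ℕₚ using (≤-refl; ≤-trans; m≤m+n; +-suc)
    open import Data.Fin using (Fin; zero; suc; toℕ; punchIn)
    open import Data.Sum using (inj₁; inj₂)
    import Relation.Binary.PropositionalEquality as ≡
    open ≡ using (_≡_)
    open Determinant
    open Determinants R

    pun : ℕ → ℕ → ℕ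
    pun zero k = suc k
    pun (suc j) zero = zero
    pun (suc j) (suc k) = suc (pun j k)

    pun-punchIn : ∀ {n} (j : Fin (suc n)) k → toℕ (punchIn j k) ≡ pun (toℕ j) (toℕ k)
    pun-punchIn zero k = ≡.refl
    pun-punchIn (suc j) zero = ≡.refl
    pun-punchIn (suc j) (suc k) = ≡.cong suc (pun-punchIn j k)

    pun-above : ∀ {j k} → j ≤ k → pun j k ≡ suc k
    pun-above {zero} h = ≡.refl
    pun-above {suc j} {suc k} (s≤s h) = ≡.cong suc (pun-above h)

    pun-below : ∀ {j k} → k < j → pun j k ≡ k
    pun-below {suc j} {zero} h = ≡.refl
    pun-below {suc j} {suc k} (s≤s h) = ≡.cong suc (pun-below h)

    pun-≤ : ∀ j k → pun j k ≤ suc k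
    pun-≤ zero k = ≤-refl
    pun-≤ (suc j) zero = z≤n
    pun-≤ (suc j) (suc k) = s≤s (pun-≤ j k)

    pun-< : ∀ j {k n} → k < n → pun j k < suc n
    pun-< j {k} h = s≤s (≤-trans (pun-≤ j k) h)

    ∑< : ℕ → (ℕ → Carrier) → Carrier
    ∑< zero f = 0#
    ∑< (suc n) f = f zero + ∑< n (λ i → f (suc i))

    ∑<-cong : ∀ n {f g : ℕ → Carrier} → (∀ i → i < n → f i ≈ g i) → ∑< n f ≈ ∑< n g
    ∑<-cong zero e = refl
    ∑<-cong (suc n) e = +-cong (e 0 (s≤s z≤n)) (∑<-cong n λ i h → e (suc i) (s≤s h))

    ∑<-zero : ∀ n {f : ℕ → Carrier} → (∀ i → i < n → f i ≈ 0#) → ∑< n f ≈ 0#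
    ∑<-zero zero e = refl
    ∑<-zero (suc n) e = trans (+-cong (e 0 (s≤s z≤n)) (∑<-zero n λ i h → e (suc i) (s≤s h))) (+-identityˡ 0#)

    ∑<-scale : ∀ n c {f g : ℕ → Carrier} → (∀ i → i < n → f i ≈ c * g i) → ∑< n f ≈ c * ∑< n g
    ∑<-scale zero c e = sym (zeroʳ c)
    ∑<-scale (suc n) c e = trans (+-cong (e 0 (s≤s z≤n)) (∑<-scale n c λ i h → e (suc i) (s≤s h)))
      (sym (distribˡ c _ _))

    ∑<-split : ∀ m n f → ∑< (m ℕ.+ n) f ≈ ∑< m f + ∑< n (λ i → f (m ℕ.+ i))
    ∑<-split zero n f = sym (+-identityˡ _)
    ∑<-split (suc m) n f = trans (+-congˡ (∑<-split m n (λ i → f (suc i)))) (sym (+-assoc _ _ _))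

    ∑<-toℕ : ∀ n (f : ℕ → Carrier) → ∑ {n} (λ i → f (toℕ i)) ≈ ∑< n f
    ∑<-toℕ zero f = refl
    ∑<-toℕ (suc n) f = +-congˡ (∑<-toℕ n (λ i → f (suc i)))

    -- Only the entries with both indices below n matter; indexing by ℕ avoids casts between sizes.
    Δ : ℕ → (ℕ → ℕ → Carrier) → Carrier
    Δ zero m = 1#
    Δ (suc n) m = ∑< (suc n) (λ j → sgn j * m 0 j * Δ n (λ i k → m (suc i) (pun j k)))

    Δ-cong : ∀ n {m m′ : ℕ → ℕ → Carrier} → (∀ i j → i < n → j < n → m i j ≈ m′ i j) → Δ n m ≈ Δ n m′
    Δ-cong zero e = refl
    Δ-cong (suc n) e = ∑<-cong (suc n) λ j h →
      *-cong (*-congˡ {sgn j} (e 0 j (s≤s z≤n) h)) (Δ-cong n λ i k hi hk → e (suc i) (pun j k) (s≤s hi) (pun-< j hk))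

    det-Δ : ∀ {n} (M : Matrix n) m → (∀ i j → M i j ≈ m (toℕ i) (toℕ j)) → det M ≈ Δ n m
    det-Δ {zero} M m e = refl
    det-Δ {suc n} M m e = trans
      (∑-cong λ j → *-cong (*-congˡ {sgn (toℕ j)} (e zero j))
        (det-Δ (λ i k → M (suc i) (punchIn j k)) (λ i k → m (suc i) (pun (toℕ j) k))
          λ i k → trans (e (suc i) (punchIn j k)) (reflexive (≡.cong (m (suc (toℕ i))) (pun-punchIn j k)))))
      (∑<-toℕ (suc n) (λ j → sgn j * m 0 j * Δ n (λ i k → m (suc i) (pun j k))))

    x*0*y : ∀ s {z} d → z ≈ 0# → s * z * d ≈ 0#
    x*0*y s d e = trans (*-congʳ (trans (*-congˡ e) (zeroʳ s))) (zeroˡ d)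

    x*y*0 : ∀ s z {d} → d ≈ 0# → s * z * d ≈ 0#
    x*y*0 s z e = trans (*-congˡ e) (zeroʳ _)

    -- The zero block has n - a rows and a + 1 columns. Its sides add up to n + 1, so every
    -- permutation hits it: the easy half of the Frobenius-König theorem.
    Δ-singular : ∀ n a m → a < n → (∀ i j → i < n → a ≤ i → j ≤ a → m i j ≈ 0#) → Δ n m ≈ 0#
    Δ-singular (suc n) a m (s≤s a≤n) z = ∑<-zero (suc n) λ j j<n → term a j a≤n j<n z
      where
      term : ∀ a j → a ≤ n → j < suc n → (∀ i k → i < suc n → a ≤ i → k ≤ a → m i k ≈ 0#) →
        sgn j * m 0 j * Δ n (λ i k → m (suc i) (pun j k)) ≈ 0#
      term zero zero a≤n j<n z = x*0*y _ _ (z 0 0 (s≤s z≤n) z≤n z≤n)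
      term zero (suc j) a≤n (s≤s j<n) z = x*y*0 _ _ (Δ-singular n 0 _ (≤-trans (s≤s z≤n) j<n)
        λ { i .0 hi _ z≤n → z (suc i) 0 (s≤s hi) z≤n z≤n })
      term (suc a) j a≤n j<n z = x*y*0 _ _ (Δ-singular n a _ a≤n
        λ i k hi ai ka → z (suc i) (pun j k) (s≤s hi) (s≤s ai) (≤-trans (pun-≤ j k) (s≤s ka)))

    Δ-block : ∀ a b m → (∀ i j → i < a → a ≤ j → m i j ≈ 0#) →
      Δ (a ℕ.+ b) m ≈ Δ a m * Δ b (λ i j → m (a ℕ.+ i) (a ℕ.+ j))
    Δ-block zero b m z = sym (*-identityˡ _)
    Δ-block (suc a) b m z = begin
      Δ (suc a ℕ.+ b) m
        ≈⟨ ∑<-split (suc a) b (term (a ℕ.+ b)) ⟩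
      ∑< (suc a) (term (a ℕ.+ b)) + ∑< b (λ j → term (a ℕ.+ b) (suc a ℕ.+ j))
        ≈⟨ +-cong (∑<-scale (suc a) Y (λ j h → left j (s≤s⁻¹ h)))
             (∑<-zero b (λ j _ → x*0*y _ _ (z 0 _ (s≤s z≤n) (m≤m+n (suc a) j)))) ⟩
      Y * Δ (suc a) m + 0#
        ≈⟨ solve 2 (λ x y → y :* x :+ con 0 := x :* y) refl _ _ ⟩
      Δ (suc a) m * Y ∎
      where
      Y : Carrier
      Y = Δ b (λ i j → m (suc (a ℕ.+ i)) (suc (a ℕ.+ j)))
      term : ℕ → ℕ → Carrier
      term n j = sgn j * m 0 j * Δ n (λ i k → m (suc i) (pun j k))
      left : ∀ j → j ≤ a → term (a ℕ.+ b) j ≈ Y * term a j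
      left j h = trans (*-congˡ (trans
          (Δ-block a b (λ i k → m (suc i) (pun j k))
            λ i k hi hk → trans (reflexive (≡.cong (m (suc i)) (pun-above (≤-trans h hk)))) (z (suc i) (suc k) (s≤s hi) (s≤s hk)))
          (*-congˡ (Δ-cong b λ i k _ _ → reflexive (≡.cong (m (suc (a ℕ.+ i))) (pun-above (≤-trans h (m≤m+n a k))))))))
        (solve 4 (λ s c x y → s :* c :* (x :* y) := y :* (s :* c :* x)) refl _ _ _ _)

    -- Expanding along row 0 leaves minors whose first column again has only its last entry, at the
    -- price of one sign per row; hence `sgn a`.
    Δ-lastRow : ∀ a m → (∀ i → i < a → m i 0 ≈ 0#) →
      Δ (suc a) m ≈ sgn a * m a 0 * Δ a (λ i j → m i (suc j))
    Δ-lastRow zero m z = +-identityʳ _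
    Δ-lastRow (suc a) m z = begin
      Δ (suc (suc a)) m
        ≈⟨ +-cong (x*0*y _ _ (z 0 (s≤s z≤n))) (∑<-scale (suc a) (sgn (suc a) * m (suc a) 0) λ j _ → right j) ⟩
      0# + sgn (suc a) * m (suc a) 0 * Δ (suc a) (λ i j → m i (suc j))
        ≈⟨ +-identityˡ _ ⟩
      sgn (suc a) * m (suc a) 0 * Δ (suc a) (λ i j → m i (suc j)) ∎
      where
      right : ∀ j → sgn (suc j) * m 0 (suc j) * Δ (suc a) (λ i k → m (suc i) (pun (suc j) k))
        ≈ sgn (suc a) * m (suc a) 0 * (sgn j * m 0 (suc j) * Δ a (λ i k → m (suc i) (suc (pun j k))))
      right j = begin
        sgn (suc j) * m 0 (suc j) * Δ (suc a) (λ i k → m (suc i) (pun (suc j) k))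
          ≈⟨ *-cong (*-congʳ (sgn-suc j)) (Δ-lastRow a (λ i k → m (suc i) (pun (suc j) k)) (λ i h → z (suc i) (s≤s h))) ⟩
        -1# * sgn j * m 0 (suc j) * (sgn a * m (suc a) 0 * D)
          ≈⟨ solve 6 (λ e s c t d D → e :* s :* c :* (t :* d :* D) := e :* t :* d :* (s :* c :* D)) refl
               -1# (sgn j) (m 0 (suc j)) (sgn a) (m (suc a) 0) D ⟩
        -1# * sgn a * m (suc a) 0 * (sgn j * m 0 (suc j) * D)
          ≈⟨ *-congʳ (*-congʳ (sym (sgn-suc a))) ⟩
        sgn (suc a) * m (suc a) 0 * (sgn j * m 0 (suc j) * D) ∎
        where
        D : Carrier
        D = Δ a (λ i k → m (suc i) (suc (pun j k)))

    private
      -- The minor met when the coupling entry of row 0 is expanded: column 0 is left over from the first block.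
      Δ-corner : ∀ a b m → (∀ i j → i < a → a < j → m i j ≈ 0#) →
        (∀ i j → a < i → j ≤ a → m i j ≈ 0#) → (∀ j → j < a → m a (suc j) ≈ 0#) →
        Δ (a ℕ.+ suc b) m
          ≈ sgn a * m a 0 * Δ a (λ i j → m i (suc j)) * Δ b (λ i j → m (a ℕ.+ suc i) (suc a ℕ.+ j))
      Δ-corner zero b m z₁ z₂ z₃ = begin
        Δ (suc b) m
          ≈⟨ +-congˡ (∑<-zero b λ j h → x*y*0 _ _ (Δ-singular b 0 _ (≤-trans (s≤s z≤n) h)
               λ { i .0 _ _ z≤n → z₂ (suc i) 0 (s≤s z≤n) z≤n })) ⟩
        1# * m 0 0 * Δ b (λ i j → m (suc i) (suc j)) + 0#
          ≈⟨ solve 3 (λ s c x → s :* c :* x :+ con 0 := s :* c :* con 1 :* x) refl _ _ _ ⟩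
        1# * m 0 0 * 1# * Δ b (λ i j → m (suc i) (suc j)) ∎
      Δ-corner (suc a) b m z₁ z₂ z₃ = begin
        Δ (suc (a ℕ.+ suc b)) m
          ≈⟨ +-cong (x*y*0 _ _ (Δ-singular (a ℕ.+ suc b) a _ a<n singular)) (∑<-split′ (λ j → term (suc j))) ⟩
        0# + (∑< (suc a) (λ j → term (suc j)) + ∑< b (λ j → term (suc (suc a ℕ.+ j))))
          ≈⟨ +-congˡ (+-cong (∑<-scale (suc a) (sgn (suc a) * m (suc a) 0 * Y) λ j h → left j (s≤s⁻¹ h))
               (∑<-zero b λ j _ → x*0*y _ _ (z₁ 0 _ (s≤s z≤n) (s≤s (m≤m+n (suc a) j))))) ⟩
        0# + (sgn (suc a) * m (suc a) 0 * Y * X + 0#)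
          ≈⟨ solve 4 (λ s d y x → con 0 :+ (s :* d :* y :* x :+ con 0) := s :* d :* x :* y) refl _ _ _ _ ⟩
        sgn (suc a) * m (suc a) 0 * X * Y ∎
        where
        X Y : Carrier
        X = Δ (suc a) (λ i j → m i (suc j))
        Y = Δ b (λ i j → m (suc (a ℕ.+ suc i)) (suc (suc (a ℕ.+ j))))
        term : ℕ → Carrier
        term j = sgn j * m 0 j * Δ (a ℕ.+ suc b) (λ i k → m (suc i) (pun j k))
        ∑<-split′ : ∀ f → ∑< (a ℕ.+ suc b) f ≈ ∑< (suc a) f + ∑< b (λ j → f (suc a ℕ.+ j))
        ∑<-split′ f = trans (reflexive (≡.cong (λ n → ∑< n f) (+-suc a b))) (∑<-split (suc a) b f)
        a<n : a < a ℕ.+ suc b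
        a<n = ≡.subst (a <_) (≡.sym (+-suc a b)) (s≤s (m≤m+n a b))
        singular : ∀ i j → i < a ℕ.+ suc b → a ≤ i → j ≤ a → m (suc i) (suc j) ≈ 0#
        singular i j _ ai ja with ℕₚ.m≤n⇒m<n∨m≡n ai
        ... | inj₁ a<i = z₂ (suc i) (suc j) (s≤s a<i) (s≤s ja)
        ... | inj₂ ≡.refl = z₃ j (s≤s ja)
        left : ∀ j → j ≤ a → term (suc j)
          ≈ sgn (suc a) * m (suc a) 0 * Y * (sgn j * m 0 (suc j) * Δ a (λ i k → m (suc i) (suc (pun j k))))
        left j h = begin
          term (suc j)
            ≈⟨ *-cong (*-congʳ (sgn-suc j)) (Δ-corner a b (λ i k → m (suc i) (pun (suc j) k))
                 (λ i k hi hk → trans (reflexive (≡.cong (m (suc i)) (pun-above (≤-trans (s≤s h) hk)))) (z₁ (suc i) (suc k) (s≤s hi) (s≤s hk)))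
                 (λ i k hi hk → z₂ (suc i) _ (s≤s hi) (≤-trans (pun-≤ (suc j) k) (s≤s hk)))
                 (λ k hk → z₃ _ (≤-trans (s≤s (pun-≤ j k)) (s≤s hk)))) ⟩
          -1# * sgn j * m 0 (suc j) * (sgn a * m (suc a) 0 * D * Δ b (λ i k → m (suc (a ℕ.+ suc i)) (suc (pun j (a ℕ.+ k)))))
            ≈⟨ *-congˡ (*-congˡ (Δ-cong b λ i k _ _ →
                 reflexive (≡.cong (λ l → m (suc (a ℕ.+ suc i)) (suc l)) (pun-above (≤-trans h (m≤m+n a k)))))) ⟩
          -1# * sgn j * m 0 (suc j) * (sgn a * m (suc a) 0 * D * Y)
            ≈⟨ solve 7 (λ e s c t d D y → e :* s :* c :* (t :* d :* D :* y) := e :* t :* d :* y :* (s :* c :* D)) refl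
                 -1# (sgn j) (m 0 (suc j)) (sgn a) (m (suc a) 0) D Y ⟩
          -1# * sgn a * m (suc a) 0 * Y * (sgn j * m 0 (suc j) * D)
            ≈⟨ *-congʳ (*-congʳ (*-congʳ (sym (sgn-suc a)))) ⟩
          sgn (suc a) * m (suc a) 0 * Y * (sgn j * m 0 (suc j) * D) ∎
          where
          D : Carrier
          D = Δ a (λ i k → m (suc i) (suc (pun j k)))

    sgn-sq : ∀ k → sgn k * sgn k ≈ 1#
    sgn-sq zero = *-identityˡ 1#
    sgn-sq (suc zero) = -1*-1
    sgn-sq (suc (suc k)) = sgn-sq k

    -- Two diagonal blocks that see each other only through the entries (0, a) and (a, 0): the
    -- matrix of two graphs linked by a bridge between their first vertices.
    record Coupled (a : ℕ) (m : ℕ → ℕ → Carrier) : Set where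
      field
        upper : ∀ i j → i < a → a < j → m i j ≈ 0#
        upperCol : ∀ i → suc i < a → m (suc i) a ≈ 0#
        lower : ∀ i j → a < i → j < a → m i j ≈ 0#
        lowerRow : ∀ j → suc j < a → m a (suc j) ≈ 0#

    -- A permutation uses both coupling entries or neither. Using both costs the sign of a
    -- transposition and leaves the two blocks without their first vertices; this negative term is
    -- written on the left.
    Δ-coupled : ∀ a b m → Coupled (suc a) m →
      Δ (suc a ℕ.+ suc b) m
        + m 0 (suc a) * m (suc a) 0 * (Δ a (λ i j → m (suc i) (suc j)) * Δ b (λ i j → m (suc a ℕ.+ suc i) (suc a ℕ.+ suc j)))
        ≈ Δ (suc a) m * Δ (suc b) (λ i j → m (suc a ℕ.+ i) (suc a ℕ.+ j))
    Δ-coupled a b m H = begin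
      Δ (suc a ℕ.+ suc b) m + c * d * (X₀ * Y₀)
        ≈⟨ +-congʳ (∑<-split (suc a) (suc b) term) ⟩
      (∑< (suc a) term + (term (suc a ℕ.+ 0) + ∑< b (λ j → term (suc a ℕ.+ suc j)))) + c * d * (X₀ * Y₀)
        ≈⟨ +-congʳ (+-cong (∑<-scale (suc a) Y (λ j h → left j (s≤s⁻¹ h)))
             (+-cong middle (∑<-zero b λ j _ → x*0*y _ _ (upper 0 _ (s≤s z≤n)
               (≡.subst (suc a <_) (≡.sym (+-suc (suc a) j)) (s≤s (m≤m+n (suc a) j))))))) ⟩
      (Y * Δ (suc a) m + (-1# * (c * d * (X₀ * Y₀)) + 0#)) + c * d * (X₀ * Y₀)
        ≈⟨ solve 4 (λ y x e t → (y :* x :+ (e :* t :+ con 0)) :+ t := x :* y :+ (e :+ con 1) :* t) refl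
             Y (Δ (suc a) m) -1# (c * d * (X₀ * Y₀)) ⟩
      Δ (suc a) m * Y + (-1# + 1#) * (c * d * (X₀ * Y₀))
        ≈⟨ +-congˡ (trans (*-congʳ (-‿inverseˡ 1#)) (zeroˡ _)) ⟩
      Δ (suc a) m * Y + 0#
        ≈⟨ +-identityʳ _ ⟩
      Δ (suc a) m * Y ∎
      where
      open Coupled H
      c d X₀ Y₀ Y : Carrier
      c = m 0 (suc a)
      d = m (suc a) 0
      X₀ = Δ a (λ i j → m (suc i) (suc j))
      Y₀ = Δ b (λ i j → m (suc a ℕ.+ suc i) (suc a ℕ.+ suc j))
      Y = Δ (suc b) (λ i j → m (suc a ℕ.+ i) (suc a ℕ.+ j))
      term : ℕ → Carrier
      term j = sgn j * m 0 j * Δ (a ℕ.+ suc b) (λ i k → m (suc i) (pun j k))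
      left : ∀ j → j ≤ a → term j ≈ Y * (sgn j * m 0 j * Δ a (λ i k → m (suc i) (pun j k)))
      left j h = trans (*-congˡ (trans
          (Δ-block a (suc b) (λ i k → m (suc i) (pun j k)) zeros)
          (*-congˡ (Δ-cong (suc b) λ i k _ _ → reflexive (≡.cong (m (suc (a ℕ.+ i))) (pun-above (≤-trans h (m≤m+n a k))))))))
        (solve 4 (λ s c x y → s :* c :* (x :* y) := y :* (s :* c :* x)) refl _ _ _ _)
        where
        zeros : ∀ i k → i < a → a ≤ k → m (suc i) (pun j k) ≈ 0#
        zeros i k hi hk with ℕₚ.m≤n⇒m<n∨m≡n hk
        ... | inj₁ a<k = trans (reflexive (≡.cong (m (suc i)) (pun-above (≤-trans h hk)))) (upper (suc i) (suc k) (s≤s hi) (s≤s a<k))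
        ... | inj₂ ≡.refl = trans (reflexive (≡.cong (m (suc i)) (pun-above (≤-trans h hk)))) (upperCol i (s≤s hi))
      -- Row 0 takes the coupling column, so column 0 is left without a partner in its own block and
      -- must be matched with row `suc a`, the situation of `Δ-corner`. The two factors `sgn a`
      -- cancel, and -1 remains.
      middle : term (suc a ℕ.+ 0) ≈ -1# * (c * d * (X₀ * Y₀))
      middle = begin
        term (suc a ℕ.+ 0)
          ≈⟨ reflexive (≡.cong term (ℕₚ.+-identityʳ (suc a))) ⟩
        sgn (suc a) * c * Δ (a ℕ.+ suc b) (λ i k → m (suc i) (pun (suc a) k))
          ≈⟨ *-cong (*-congʳ (sgn-suc a)) (trans (Δ-corner a b (λ i k → m (suc i) (pun (suc a) k))
               (λ i j hi hj → trans (reflexive (≡.cong (m (suc i)) (pun-above hj))) (upper (suc i) (suc j) (s≤s hi) (s≤s hj)))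
               (λ i j hi hj → trans (reflexive (≡.cong (m (suc i)) (pun-below (s≤s hj)))) (lower (suc i) j (s≤s hi) (s≤s hj)))
               (λ j hj → trans (reflexive (≡.cong (m (suc a)) (pun-below (s≤s hj)))) (lowerRow j (s≤s hj))))
             (*-cong (*-congˡ (Δ-cong a λ i j _ hj → reflexive (≡.cong (m (suc i)) (pun-below (s≤s hj)))))
               (Δ-cong b λ i j _ _ → reflexive (≡.cong (m (suc (a ℕ.+ suc i)))
                 (≡.trans (pun-above {suc a} (m≤m+n (suc a) j)) (≡.cong suc (≡.sym (+-suc a j)))))))) ⟩
        -1# * sgn a * c * (sgn a * d * X₀ * Y₀)
          ≈⟨ solve 6 (λ e s c d x y → e :* s :* c :* (s :* d :* x :* y) := (s :* s) :* (e :* (c :* d :* (x :* y)))) refl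
               -1# (sgn a) c d X₀ Y₀ ⟩
        (sgn a * sgn a) * (-1# * (c * d * (X₀ * Y₀)))
          ≈⟨ trans (*-congʳ (sgn-sq a)) (*-identityˡ _) ⟩
        -1# * (c * d * (X₀ * Y₀)) ∎

-- Rooted trees, possibly with the cycle at the root.

module Trees where

  open import Data.Nat
  open import Data.Nat.Properties
  open import Data.Bool using (Bool; true; false)
  open import Data.List using (List; []; _∷_)
  open import Relation.Binary.PropositionalEquality

  infixl 6 _◁_
  -- S ◁ T makes the root of T a new child of the root of S; cyc is the cycle itself, rooted at u_1.
  data Tree : Bool → Set where
    leaf : Tree false
    cyc  : Tree true
    _◁_  : ∀ {b} → Tree b → Tree false → Tree b

  path : ℕ → Tree false
  path zero = leaf
  path (suc k) = leaf ◁ path k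

  infixl 6 _◁◁_
  _◁◁_ : ∀ {b} → Tree b → List ℕ → Tree b
  S ◁◁ [] = S
  S ◁◁ (k ∷ ks) = S ◁ path k ◁◁ ks

  broom : ℕ → List ℕ → Tree false
  broom zero ks = leaf ◁◁ ks
  broom (suc d) ks = leaf ◁ broom d ks

  -- All branches hang from the far end of a path of length q starting at u_1.
  kite : ℕ → List ℕ → Tree true
  kite zero ks = cyc ◁◁ ks
  kite (suc q) ks = cyc ◁ broom q ks

  infix 4 _~_
  -- Reordering of children, given by generators so that it can be interpreted twice: as equality of
  -- weights and as isomorphism of graphs.
  data _~_ : ∀ {b} → Tree b → Tree b → Set where
    ~refl  : ∀ {b} {S : Tree b} → S ~ S
    ~sym   : ∀ {b} {S T : Tree b} → S ~ T → T ~ S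
    ~trans : ∀ {b} {S T U : Tree b} → S ~ T → T ~ U → S ~ U
    ~cong  : ∀ {b} {S S′ : Tree b} {T T′} → S ~ S′ → T ~ T′ → S ◁ T ~ S′ ◁ T′
    ~swap  : ∀ {b} {S : Tree b} {T U} → S ◁ T ◁ U ~ S ◁ U ◁ T

  -- A path that descends k steps from the root through children; it never runs along the cycle.
  data Deep : ∀ {b} → Tree b → ℕ → Set where
    deep-root  : ∀ {b} {S : Tree b} → Deep S 0
    deep-child : ∀ {b} {S : Tree b} {T k} → Deep T k → Deep (S ◁ T) (suc k)
    deep-left  : ∀ {b} {S : Tree b} {T k} → Deep S k → Deep (S ◁ T) k

  deep-≤ : ∀ {b} {S : Tree b} {j k} → j ≤ k → Deep S k → Deep S j
  deep-≤ z≤n _ = deep-root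
  deep-≤ (s≤s h) (deep-child d) = deep-child (deep-≤ h d)
  deep-≤ h@(s≤s _) (deep-left d) = deep-left (deep-≤ h d)

  deep-path : ∀ k → Deep (path k) k
  deep-path zero = deep-root
  deep-path (suc k) = deep-child (deep-path k)

  deep-◁◁ : ∀ {b} {S : Tree b} {k} ks → Deep S k → Deep (S ◁◁ ks) k
  deep-◁◁ [] d = d
  deep-◁◁ (_ ∷ ks) d = deep-◁◁ ks (deep-left d)

  -- For T hanging as a child, leaves T ⊔ 1 counts the leaves of T; the root itself is never counted in leaves T.
  leaves : ∀ {b} → Tree b → ℕ
  leaves leaf = 0
  leaves cyc = 0
  leaves (S ◁ T) = leaves S + (leaves T ⊔ 1)

  module Sizes (h : ℕ) where

    -- Counting the vertices other than the root makes `size` a successor by computation, so that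
    -- determinants unfold at the root.
    extra : ∀ {b} → Tree b → ℕ
    extra leaf = 0
    extra cyc = suc (suc h)
    extra (S ◁ T) = extra S + suc (extra T)

    size : ∀ {b} → Tree b → ℕ
    size T = suc (extra T)

-- Balanced lists of branch lengths.

module Balanced where

  open import Data.Nat
  open import Data.Nat.Properties
  open import Data.Nat.DivMod
  open import Data.Nat.Tactic.RingSolver using (solve-∀)
  open import Data.Bool using (if_then_else_)
  open import Data.List using (List; []; _∷_; _++_; map; replicate; length; applyUpTo)
  open import Data.List.Properties using (++-identityʳ; length-++; length-replicate; map-++; map-replicate; map-applyUpTo; map-∘; map-id)
  open import Data.List.Relation.Binary.Permutation.Propositional hiding (trans; refl)
  import Data.List.Relation.Binary.Permutation.Propositional as ↭
  open import Data.List.Relation.Binary.Permutation.Propositional.Properties using (↭-length; shift)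
  open import Data.Product using (∃; _×_; _,_)
  open import Relation.Binary.PropositionalEquality
  open import Relation.Nullary using (yes; no)
  open import Relation.Nullary.Negation using (contradiction)
  open import Defs using (branchOrders)

  -- A list entry k stands for a branch with k + 1 vertices.
  total : List ℕ → ℕ
  total [] = 0
  total (k ∷ ks) = suc k + total ks

  squares : List ℕ → ℕ
  squares [] = 0
  squares (k ∷ ks) = k * k + squares ks

  exchange : ∀ a b c → a + (b + c) ≡ b + (a + c)
  exchange = solve-∀

  total-↭ : ∀ {xs ys} → xs ↭ ys → total xs ≡ total ys
  total-↭ ↭.refl = refl
  total-↭ (prep x e) = cong (suc x +_) (total-↭ e)
  total-↭ (swap x y e) = trans (cong (λ n → suc x + (suc y + n)) (total-↭ e)) (exchange (suc x) (suc y) _)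
  total-↭ (↭.trans e f) = trans (total-↭ e) (total-↭ f)

  squares-↭ : ∀ {xs ys} → xs ↭ ys → squares xs ≡ squares ys
  squares-↭ ↭.refl = refl
  squares-↭ (prep x e) = cong (x * x +_) (squares-↭ e)
  squares-↭ (swap x y e) = trans (cong (λ n → x * x + (y * y + n)) (squares-↭ e)) (exchange (x * x) (y * y) _)
  squares-↭ (↭.trans e f) = trans (squares-↭ e) (squares-↭ f)

  total-++ : ∀ xs ys → total (xs ++ ys) ≡ total xs + total ys
  total-++ [] ys = refl
  total-++ (x ∷ xs) ys = trans (cong (suc x +_) (total-++ xs ys)) (sym (+-assoc (suc x) (total xs) (total ys)))

  total-replicate : ∀ m c → total (replicate m c) ≡ m * suc c
  total-replicate zero c = refl
  total-replicate (suc m) c = cong (suc c +_) (total-replicate m c)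

  -- Up to order, every nonempty list whose entries differ by at most one has this form. Writing
  -- `suc j` keeps the smaller value present, which makes c, m and j unique.
  level : ℕ → ℕ → ℕ → List ℕ
  level c m j = replicate m (suc c) ++ replicate (suc j) c

  data Shape (ks : List ℕ) : Set where
    balanced   : ∀ c m j → ks ↭ level c m j → Shape ks
    unbalanced : ∀ j k rest → ks ↭ suc (suc (j + k)) ∷ k ∷ rest → Shape ks

  private
    level-suc : ∀ c m j → c ∷ level c m j ↭ level c m (suc j)
    level-suc c m j = ↭-sym (shift c (replicate m (suc c)) (replicate (suc j) c))

    level-low : ∀ c m j → ∃ λ rest → level c m j ↭ c ∷ rest
    level-low c m j = _ , shift c (replicate m (suc c)) (replicate j c)

  -- If the tail is a level, only the position of the new entry relative to its two values matters:
  -- at distance two or more from some entry the list is unbalanced, otherwise it is a level again.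
  shape : ∀ k ks → Shape (k ∷ ks)
  shape k [] = balanced k 0 0 ↭-refl
  shape k (k′ ∷ ks) with shape k′ ks
  ... | unbalanced j i rest e = unbalanced j i (k ∷ rest)
        (↭-trans (prep k e) (↭-trans (swap k _ ↭-refl) (prep _ (swap k i ↭-refl))))
  ... | balanced c m j e with compare k c
  ... | equal .k = balanced k m (suc j) (↭-trans (prep k e) (level-suc k m j))
  -- Here c = k + 1. If c + 1 does not occur, the new entry is the minimum of a level; otherwise, in
  -- the next clause, k + 2 and k form an unbalanced pair.
  shape k (k′ ∷ ks) | balanced c zero j e | less .k zero rewrite +-identityʳ k =
    balanced k (suc j) 0 (↭-trans (prep k e) (↭-sym (↭-trans (shift k (replicate (suc j) (suc k)) [])
      (↭-reflexive (cong (k ∷_) (++-identityʳ (replicate (suc j) (suc k))))))))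
  shape k (k′ ∷ ks) | balanced c (suc m) j e | less .k zero rewrite +-identityʳ k =
    unbalanced 0 k _ (↭-trans (prep k e) (swap k _ ↭-refl))
  shape k (k′ ∷ ks) | balanced c m j e | less .k (suc i) rewrite +-suc k i | +-comm k i with level-low (suc (suc (i + k))) m j
  ... | rest , low = unbalanced i k rest (↭-trans (prep k (↭-trans e low)) (swap k _ ↭-refl))
  shape k (k′ ∷ ks) | balanced c m j e | greater .c zero rewrite +-identityʳ c =
    balanced c (suc m) j (prep (suc c) e)
  shape k (k′ ∷ ks) | balanced c m j e | greater .c (suc i) rewrite +-suc c i | +-comm c i with level-low c m j
  ... | rest , low = unbalanced i c rest (prep _ (↭-trans e low))

  -- The drop is 2(j + 1). The sum of squares is the termination measure of balancing.
  squares-decrease : ∀ j k rest → squares (suc (j + k) ∷ suc k ∷ rest) < squares (suc (suc (j + k)) ∷ k ∷ rest)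
  squares-decrease j k rest = subst (_≤ squares (suc (suc (j + k)) ∷ k ∷ rest)) (+-comm _ 1)
    (≤-trans (+-monoʳ-≤ (squares (suc (j + k) ∷ suc k ∷ rest)) {1} {suc j + suc j} (s≤s z≤n)) (≤-reflexive (lemma j k (squares rest))))
    where
    lemma : ∀ j k r → suc (j + k) * suc (j + k) + (suc k * suc k + r) + (suc j + suc j)
      ≡ suc (suc (j + k)) * suc (suc (j + k)) + (k * k + r)
    lemma = solve-∀

  total-balance : ∀ j k rest → total (suc (j + k) ∷ suc k ∷ rest) ≡ total (suc (suc (j + k)) ∷ k ∷ rest)
  total-balance j k rest = lemma j k (total rest)
    where
    lemma : ∀ j k r → suc (suc (j + k)) + (suc (suc k) + r) ≡ suc (suc (suc (j + k))) + (suc k + r)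
    lemma = solve-∀

  -- BST_{r+1,l} in this encoding; junk (pred 0) unless l ≤ r.
  bal : ℕ → ℕ → List ℕ
  bal r l = map pred (branchOrders r l)

  private
    if-replicate : ∀ (a b : ℕ) m j → applyUpTo (λ i → if i <ᵇ m then a else b) (m + j) ≡ replicate m a ++ replicate j b
    if-replicate a b zero zero = refl
    if-replicate a b zero (suc j) = cong (b ∷_) (if-replicate a b zero j)
    if-replicate a b (suc m) j = cong (a ∷_) (if-replicate a b m j)

  branchOrders-replicate : ∀ c m j → branchOrders (m + (m + suc j) * c) (m + suc j) ≡ replicate m (suc c) ++ replicate (suc j) c
  branchOrders-replicate c m j = helper (m + suc j) refl
    where
    -- `branchOrders` computes only on a successor, which `m + suc j` is not by computation; so l is
    -- abstracted together with its equation.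
    helper : ∀ l → l ≡ m + suc j → branchOrders (m + l * c) l ≡ replicate m (suc c) ++ replicate (suc j) c
    helper zero e = contradiction (trans e (+-suc m j)) 0≢1+n
    helper (suc l) e = trans (map-applyUpTo (λ i → i) _ (suc l)) (trans
      (cong₂ (λ u v → applyUpTo (λ i → if i <ᵇ u then suc v else v) (suc l)) rem quo)
      (trans (cong (applyUpTo _) e) (if-replicate (suc c) c m (suc j))))
      where
      m<l : m < suc l
      m<l = subst (m <_) (sym e) (subst (m <_) (sym (+-suc m j)) (s≤s (m≤m+n m j)))
      rem : (m + suc l * c) % suc l ≡ m
      rem = trans (cong (λ n → (m + n) % suc l) (*-comm (suc l) c)) (trans ([m+kn]%n≡m%n m c (suc l)) (m<n⇒m%n≡m m<l))
      quo : (m + suc l * c) / suc l ≡ c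
      quo = trans (cong (λ n → (m + n) / suc l) (*-comm (suc l) c))
        (trans (+-distrib-/ m (c * suc l) small) (cong₂ _+_ (m<n⇒m/n≡0 m<l) (m*n/n≡m c (suc l))))
        where
        small : m % suc l + c * suc l % suc l < suc l
        small = subst (_< suc l) (sym (trans (cong₂ _+_ (m<n⇒m%n≡m m<l) (m*n%n≡0 c (suc l))) (+-identityʳ m))) m<l

  length-level : ∀ c m j → length (level c m j) ≡ m + suc j
  length-level c m j = trans (length-++ (replicate m (suc c))) (cong₂ _+_ (length-replicate m) (length-replicate (suc j)))

  total-level : ∀ c m j → total (level c m j) ≡ m + (m + suc j) * suc c
  total-level c m j = trans (total-++ (replicate m (suc c)) (replicate (suc j) c))
    (trans (cong₂ _+_ (total-replicate m (suc c)) (total-replicate (suc j) c)) (lemma m c j))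
    where
    lemma : ∀ m c j → m * suc (suc c) + suc j * suc c ≡ m + (m + suc j) * suc c
    lemma = solve-∀

  branchOrders-level : ∀ c m j → branchOrders (total (level c m j)) (length (level c m j)) ≡ map suc (level c m j)
  branchOrders-level c m j = trans (cong₂ branchOrders (total-level c m j) (length-level c m j))
    (trans (branchOrders-replicate (suc c) m j)
      (sym (trans (map-++ suc (replicate m (suc c)) _) (cong₂ _++_ (map-replicate suc m (suc c)) (map-replicate suc (suc j) c)))))

  bal-level : ∀ c m j → bal (total (level c m j)) (length (level c m j)) ≡ level c m j
  bal-level c m j = trans (cong (map pred) (branchOrders-level c m j))
    (trans (sym (map-∘ (level c m j))) (map-id (level c m j)))

  -- A level is determined by its total and its length through division with remainder.
  bal-unique : ∀ {ks c m j} → ks ↭ level c m j → ks ↭ bal (total ks) (length ks)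
  bal-unique {ks} {c} {m} {j} e = ↭-trans e (↭-reflexive (sym
    (trans (cong₂ bal (total-↭ e) (↭-length e)) (bal-level c m j))))

  bal-is-level : ∀ r l → 1 ≤ l → l ≤ r → ∃ λ c → ∃ λ m → ∃ λ j → total (level c m j) ≡ r × length (level c m j) ≡ l
  bal-is-level r l@(suc l′) _ l≤r = pred (r / l) , r % l , l ∸ suc (r % l) , tot , len
    where
    quo-pos : suc (pred (r / l)) ≡ r / l
    quo-pos = suc-pred (r / l) {{>-nonZero (m≥n⇒m/n>0 l≤r)}}
    split : r % l + suc (l ∸ suc (r % l)) ≡ l
    split = trans (+-suc (r % l) _) (m+[n∸m]≡n (m%n<n r l))
    tot : total (level (pred (r / l)) (r % l) (l ∸ suc (r % l))) ≡ r
    tot = trans (total-level (pred (r / l)) (r % l) (l ∸ suc (r % l)))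
      (trans (cong₂ (λ u v → r % l + u * v) split quo-pos) (trans (cong (r % l +_) (*-comm l (r / l))) (sym (m≡m%n+[m/n]*n r l))))
    len : length (level (pred (r / l)) (r % l) (l ∸ suc (r % l))) ≡ l
    len = trans (length-level (pred (r / l)) (r % l) (l ∸ suc (r % l))) split

  total-bal : ∀ r l → 1 ≤ l → l ≤ r → total (bal r l) ≡ r
  total-bal r l 1≤l l≤r with bal-is-level r l 1≤l l≤r
  ... | c , m , j , refl , refl = cong total (bal-level c m j)

  length-bal : ∀ r l → 1 ≤ l → l ≤ r → length (bal r l) ≡ l
  length-bal r l 1≤l l≤r with bal-is-level r l 1≤l l≤r
  ... | c , m , j , refl , refl = cong length (bal-level c m j)

  branchOrders-bal : ∀ r l → 1 ≤ l → l ≤ r → branchOrders r l ≡ map suc (bal r l)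
  branchOrders-bal r l 1≤l l≤r with bal-is-level r l 1≤l l≤r
  ... | c , m , j , refl , refl = trans (branchOrders-level c m j) (cong (map suc) (sym (bal-level c m j)))

  -- Pigeonhole: if every entry were at least b, each branch would have at least b + 1 vertices.
  smallEntry : ∀ b ks → total ks < length ks * suc b → ∃ λ k → ∃ λ rest → k < b × ks ↭ k ∷ rest
  smallEntry b (k ∷ ks) h with k <? b
  ... | yes k<b = k , ks , k<b , ↭-refl
  ... | no k≮b with smallEntry b ks (+-cancelˡ-< (suc b) _ _ (≤-<-trans (+-monoˡ-≤ (total ks) (s≤s (≮⇒≥ k≮b))) h))
  ... | i , rest , i<b , e = i , k ∷ rest , i<b , ↭-trans (prep k e) (swap k i ↭-refl)

-- The algebra of weights and the effect of the moves.

module Weights where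

  open import Level using (0ℓ)
  open import Algebra.Bundles using (CommutativeRing)
  open import Data.Product using (∃; _×_; _,_)

  -- N plays the role of "all coefficients nonnegative", P of "moreover nonzero".
  record Cone : Set₁ where
    field
      R : CommutativeRing 0ℓ 0ℓ
    open CommutativeRing R
    field
      N P : Carrier → Set
      N-resp : ∀ {a b} → a ≈ b → N a → N b
      P-resp : ∀ {a b} → a ≈ b → P a → P b
      N-0 : N 0#
      N-+ : ∀ {a b} → N a → N b → N (a + b)
      N-* : ∀ {a b} → N a → N b → N (a * b)
      P⇒N : ∀ {a} → P a → N a
      P-1 : P 1#
      P-+ : ∀ {a b} → P a → N b → P (a + b)
      P-* : ∀ {a b} → P a → P b → P (a * b)
      x : Carrier
      P-x : P x

  module WeightAlgebra (C : Cone) where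
    open Cone C public
    open CommutativeRing R hiding (zero) public
    open import Algebra.Solver.Ring.NaturalCoefficients.Default commutativeSemiring
      using (solve; _:=_; con; _:+_; _:*_)
    open import Algebra.Properties.Group +-group using () renaming (∙-cancelʳ to +-cancelʳ) public
    open import Relation.Binary.Reasoning.Setoid setoid
    open import Data.Nat as ℕ using (ℕ; zero; suc)
    import Data.Nat.Properties as ℕₚ
    import Relation.Binary.PropositionalEquality as ≡
    open import Data.Bool using (Bool; true; false)
    open import Data.List using (List; []; _∷_)

    N-x : N x
    N-x = P⇒N P-x

    -- A graph with the cycle at its root always has D nonzero, while a single vertex has D = 0. The
    -- Boolean index of a tree thus also says how much strictness is available.
    Q : Bool → Carrier → Set
    Q true = P
    Q false = N

    Q⇒N : ∀ b {a} → Q b a → N a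
    Q⇒N true = P⇒N
    Q⇒N false h = h

    P⇒Q : ∀ b {a} → P a → Q b a
    P⇒Q true h = h
    P⇒Q false = P⇒N

    Q-+ : ∀ b {a c} → Q b a → N c → Q b (a + c)
    Q-+ true = P-+
    Q-+ false = N-+

    Q-* : ∀ b {a c} → Q b a → P c → Q b (a * c)
    Q-* true = P-*
    Q-* false p q = N-* p (P⇒N q)

    -- The Morgan-Voyce polynomials. `x * s m` belongs to the path on m vertices, `p m` to the same
    -- path with one end grounded, and `s (suc m)` to it with both ends grounded.
    s p : ℕ → Carrier
    s zero = 0#
    s (suc m) = s m + p m
    p zero = 1#
    p (suc m) = p m + x * (s m + p m)

    -- Equals (`p m` - 1)/x. It is needed to write the determinant of the cycle, which contains a
    -- -2, with nonnegative coefficients.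
    t : ℕ → Carrier
    t zero = 0#
    t (suc m) = t m + s (suc m)

    p-t : ∀ m → p m ≈ 1# + x * t m
    p-t zero = solve 1 (λ x → con 1 := con 1 :+ x :* con 0) refl x
    p-t (suc m) = trans (+-congʳ (p-t m)) (solve 3 (λ x t s → con 1 :+ x :* t :+ x :* s := con 1 :+ x :* (t :+ s)) refl x (t m) (s m + p m))

    N-s : ∀ m → N (s m)
    P-p : ∀ m → P (p m)
    N-s zero = N-0
    N-s (suc m) = N-+ (N-s m) (P⇒N (P-p m))
    P-p zero = P-1
    P-p (suc m) = P-+ (P-p m) (N-* N-x (N-+ (N-s m) (P⇒N (P-p m))))

    P-s : ∀ m → P (s (suc m))
    P-s m = P-resp (+-comm _ _) (P-+ (P-p m) (N-s m))

    N-t : ∀ m → N (t m)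
    N-t zero = N-0
    N-t (suc m) = N-+ (N-t m) (N-s (suc m))

    P-t : ∀ m → P (t (suc m))
    P-t m = P-resp (+-comm _ _) (P-+ (P-s m) (N-t m))

    -- An identity of Cassini type: the pairs (`s (suc n)`, `p n`) evolve under a fixed matrix of
    -- determinant 1, so the difference of the cross products does not depend on k and can be read
    -- off at k = 0.
    sp-shift : ∀ j k → s (suc (j ℕ.+ k)) * p k ≈ s (suc k) * p (j ℕ.+ k) + s j
    sp-shift j zero rewrite ℕₚ.+-identityʳ j =
      solve 2 (λ s p → (s :+ p) :* con 1 := (con 0 :+ con 1) :* p :+ s) refl (s j) (p j)
    sp-shift j (suc k) rewrite ℕₚ.+-suc j k = begin
      (s₁ + (pₙ + x * s₁)) * (pₖ + x * r₁)
        ≈⟨ solve 5 (λ x s₁ pₙ pₖ r₁ → (s₁ :+ (pₙ :+ x :* s₁)) :* (pₖ :+ x :* r₁)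
             := s₁ :* pₖ :+ (s₁ :* x :* r₁ :+ (pₙ :+ x :* s₁) :* (pₖ :+ x :* r₁))) refl x s₁ pₙ pₖ r₁ ⟩
      s₁ * pₖ + (s₁ * x * r₁ + (pₙ + x * s₁) * (pₖ + x * r₁))
        ≈⟨ +-congʳ (sp-shift j k) ⟩
      r₁ * pₙ + s j + (s₁ * x * r₁ + (pₙ + x * s₁) * (pₖ + x * r₁))
        ≈⟨ solve 6 (λ x s₁ pₙ pₖ r₁ sⱼ → r₁ :* pₙ :+ sⱼ :+ (s₁ :* x :* r₁ :+ (pₙ :+ x :* s₁) :* (pₖ :+ x :* r₁))
             := (r₁ :+ (pₖ :+ x :* r₁)) :* (pₙ :+ x :* s₁) :+ sⱼ) refl x s₁ pₙ pₖ r₁ (s j) ⟩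
      (r₁ + (pₖ + x * r₁)) * (pₙ + x * s₁) + s j ∎
      where
      s₁ pₙ pₖ r₁ : Carrier
      s₁ = s (suc (j ℕ.+ k))
      pₙ = p (j ℕ.+ k)
      pₖ = p k
      r₁ = s (suc k)

    -- The same principle for p(n+2) + p(n) = (x+2) p(n+1); the step adds a common product to both
    -- sides and cancels it.
    pp-shift : ∀ j b → p (suc (suc (j ℕ.+ b))) * p b ≈ p (suc (j ℕ.+ b)) * p (suc b) + x * s (suc j)
    pp-shift j zero rewrite ℕₚ.+-identityʳ j =
      solve 3 (λ x s p → (p :+ x :* (s :+ p) :+ x :* (s :+ p :+ (p :+ x :* (s :+ p)))) :* con 1
        := (p :+ x :* (s :+ p)) :* (con 1 :+ x :* (con 0 :+ con 1)) :+ x :* (s :+ p)) refl x (s j) (p j)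
    pp-shift j (suc b) rewrite ℕₚ.+-suc j b = +-cancelʳ (pₙ * (q + x * r)) _ _ (begin
      (pₙ + x * v + x * (v + (pₙ + x * v))) * (q + x * r) + pₙ * (q + x * r)
        ≈⟨ solve 5 (λ x pₙ v q r → (pₙ :+ x :* v :+ x :* (v :+ (pₙ :+ x :* v))) :* (q :+ x :* r) :+ pₙ :* (q :+ x :* r)
             := (pₙ :+ x :* v) :* q :+ (pₙ :+ x :* v) :* (q :+ x :* r :+ x :* (r :+ (q :+ x :* r)))) refl x pₙ v q r ⟩
      (pₙ + x * v) * q + (pₙ + x * v) * (q + x * r + x * (r + (q + x * r)))
        ≈⟨ +-congʳ (pp-shift j b) ⟩
      pₙ * (q + x * r) + x * s (suc j) + (pₙ + x * v) * (q + x * r + x * (r + (q + x * r)))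
        ≈⟨ solve 3 (λ a b c → a :+ b :+ c := c :+ b :+ a) refl _ _ _ ⟩
      (pₙ + x * v) * (q + x * r + x * (r + (q + x * r))) + x * s (suc j) + pₙ * (q + x * r) ∎)
      where
      pₙ v q r : Carrier
      pₙ = p (suc (j ℕ.+ b))
      v = s (suc (suc (j ℕ.+ b)))
      q = p b
      r = s (suc b)

    ps-shift : ∀ j m → p m * p (j ℕ.+ m) ≈ x * s m * s (suc (j ℕ.+ m)) + p j
    ps-shift j zero rewrite ℕₚ.+-identityʳ j =
      solve 3 (λ x s p → con 1 :* p := x :* con 0 :* s :+ p) refl x (s (suc j)) (p j)
    ps-shift j (suc m) rewrite ℕₚ.+-suc j m = begin
      (pₘ + x * (sₘ + pₘ)) * (pₙ + x * v)
        ≈⟨ solve 5 (λ x pₘ sₘ pₙ v → (pₘ :+ x :* (sₘ :+ pₘ)) :* (pₙ :+ x :* v)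
             := pₘ :* pₙ :+ (pₘ :* x :* v :+ x :* (sₘ :+ pₘ) :* (pₙ :+ x :* v))) refl x pₘ sₘ pₙ v ⟩
      pₘ * pₙ + (pₘ * x * v + x * (sₘ + pₘ) * (pₙ + x * v))
        ≈⟨ +-congʳ (ps-shift j m) ⟩
      x * sₘ * v + p j + (pₘ * x * v + x * (sₘ + pₘ) * (pₙ + x * v))
        ≈⟨ solve 6 (λ x pₘ sₘ pₙ v pⱼ → x :* sₘ :* v :+ pⱼ :+ (pₘ :* x :* v :+ x :* (sₘ :+ pₘ) :* (pₙ :+ x :* v))
             := x :* (sₘ :+ pₘ) :* (v :+ (pₙ :+ x :* v)) :+ pⱼ) refl x pₘ sₘ pₙ v (p j) ⟩
      x * (sₘ + pₘ) * (v + (pₙ + x * v)) + p j ∎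
      where
      pₘ sₘ pₙ v : Carrier
      pₘ = p m
      sₘ = s m
      pₙ = p (j ℕ.+ m)
      v = s (suc (j ℕ.+ m))

    t-mono : ∀ j m → ∃ λ r → N r × t (j ℕ.+ m) ≈ t m + r
    t-mono zero m = 0# , N-0 , sym (+-identityʳ _)
    t-mono (suc j) m with t-mono j m
    ... | r , nr , e = r + s (suc (j ℕ.+ m)) , N-+ nr (N-s (suc (j ℕ.+ m))) , trans (+-congʳ e) (+-assoc _ _ _)

    -- For a graph with root r: B is det(xI+L) with row and column r removed, and x B + D is the full determinant.
    record Weight : Set where
      constructor _,ʷ_
      field D B : Carrier
    open Weight public

    -- `Π` is the full determinant after adding 1 to the diagonal entry of the root, which is the
    -- effect of one more edge leaving the graph there.
    A Π : Weight → Carrier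
    A w = x * B w + D w
    Π w = A w + B w

    infix 4 _≈ʷ_
    record _≈ʷ_ (v w : Weight) : Set where
      constructor _,≈_
      field
        D≈ : D v ≈ D w
        B≈ : B v ≈ B w
    open _≈ʷ_ public

    ≈ʷ-refl : ∀ {w} → w ≈ʷ w
    ≈ʷ-refl = refl ,≈ refl

    ≈ʷ-sym : ∀ {v w} → v ≈ʷ w → w ≈ʷ v
    ≈ʷ-sym (d ,≈ b) = sym d ,≈ sym b

    ≈ʷ-trans : ∀ {u v w} → u ≈ʷ v → v ≈ʷ w → u ≈ʷ w
    ≈ʷ-trans (d ,≈ b) (d′ ,≈ b′) = trans d d′ ,≈ trans b b′

    A-cong : ∀ {v w} → v ≈ʷ w → A v ≈ A w
    A-cong (d ,≈ b) = +-cong (*-congˡ b) d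

    Π-cong : ∀ {v w} → v ≈ʷ w → Π v ≈ Π w
    Π-cong e = +-cong (A-cong e) (B≈ e)

    infixl 6 _⊙_ _◂_
    -- Identification of the two roots. Apart from x, the diagonal entry and the edges at the root
    -- contribute additively to D/B, while the rest multiplies; hence the product rule for D.
    _⊙_ : Weight → Weight → Weight
    v ⊙ w = (D v * B w + B v * D w) ,ʷ (B v * B w)

    -- A fresh root joined by an edge to the old one; the matrix acting on (D, B) is
    -- [1, x; 1, 1 + x], of determinant 1.
    lift : Weight → Weight
    lift w = A w ,ʷ Π w

    _◂_ : Weight → Weight → Weight
    v ◂ w = v ⊙ lift w

    ε : Weight
    ε = 0# ,ʷ 1#

    ⊙-cong : ∀ {v v′ w w′} → v ≈ʷ v′ → w ≈ʷ w′ → v ⊙ w ≈ʷ v′ ⊙ w′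
    ⊙-cong (d ,≈ b) (d′ ,≈ b′) = +-cong (*-cong d b′) (*-cong b d′) ,≈ *-cong b b′

    lift-cong : ∀ {v w} → v ≈ʷ w → lift v ≈ʷ lift w
    lift-cong e = A-cong e ,≈ Π-cong e

    ⊙-assoc : ∀ u v w → (u ⊙ v) ⊙ w ≈ʷ u ⊙ (v ⊙ w)
    ⊙-assoc u v w =
      solve 6 (λ d b d′ b′ d″ b″ → (d :* b′ :+ b :* d′) :* b″ :+ (b :* b′) :* d″ := d :* (b′ :* b″) :+ b :* (d′ :* b″ :+ b′ :* d″))
        refl (D u) (B u) (D v) (B v) (D w) (B w)
      ,≈ *-assoc _ _ _

    ⊙-comm : ∀ v w → v ⊙ w ≈ʷ w ⊙ v
    ⊙-comm v w = solve 4 (λ d b d′ b′ → d :* b′ :+ b :* d′ := d′ :* b :+ b′ :* d) refl (D v) (B v) (D w) (B w) ,≈ *-comm _ _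

    ⊙-identityʳ : ∀ w → w ⊙ ε ≈ʷ w
    ⊙-identityʳ w = solve 2 (λ d b → d :* con 1 :+ b :* con 0 := d) refl (D w) (B w) ,≈ *-identityʳ _

    ⊙-identityˡ : ∀ w → ε ⊙ w ≈ʷ w
    ⊙-identityˡ w = ≈ʷ-trans (⊙-comm ε w) (⊙-identityʳ w)

    ⊙-exchange : ∀ u v w → (u ⊙ v) ⊙ w ≈ʷ (u ⊙ w) ⊙ v
    ⊙-exchange u v w = ≈ʷ-trans (⊙-assoc u v w) (≈ʷ-trans (⊙-cong ≈ʷ-refl (⊙-comm v w)) (≈ʷ-sym (⊙-assoc u w v)))

    record Good (b : Bool) (w : Weight) : Set where
      constructor good
      field
        goodD : Q b (D w)
        goodB : P (B w)
    open Good public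

    P-A : ∀ b {w} → Good b w → P (A w)
    P-A b (good d e) = P-+ (P-* P-x e) (Q⇒N b d)

    P-Π : ∀ b {w} → Good b w → P (Π w)
    P-Π b h = P-+ (P-A b h) (P⇒N (goodB h))

    good-lift : ∀ b {w} → Good b w → Good true (lift w)
    good-lift b h = good (P-A b h) (P-Π b h)

    good-⊙ : ∀ b b′ {v w} → Good b v → Good b′ w → Good b (v ⊙ w)
    good-⊙ b b′ (good d e) (good d′ e′) = good (Q-+ b (Q-* b d e′) (N-* (P⇒N e) (Q⇒N b′ d′))) (P-* e e′)

    good-◂ : ∀ b {v w} → Good b v → Good false w → Good b (v ◂ w)
    good-◂ b h h′ = good-⊙ b true h (good-lift false h′)

    -- Gluing u to v gives A_v B_u + B_v D_u and B_v B_u, so gaps in A and B survive every context;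
    -- D itself need not be compared. The gap in B is always strict, since it is the source of
    -- strictness higher up.
    record Less (b : Bool) (v w : Weight) : Set where
      field
        {α β} : Carrier
        Qα : Q b α
        Pβ : P β
        A-diff : A w ≈ A v + α
        B-diff : B w ≈ B v + β
    open Less public

    Less-resp : ∀ {b v v′ w w′} → v ≈ʷ v′ → w ≈ʷ w′ → Less b v w → Less b v′ w′
    Less-resp e e′ h = record { Qα = Qα h ; Pβ = Pβ h
      ; A-diff = trans (sym (A-cong e′)) (trans (A-diff h) (+-congʳ (A-cong e)))
      ; B-diff = trans (sym (B≈ e′)) (trans (B-diff h) (+-congʳ (B≈ e))) }

    Less-trans : ∀ {b u v w} → Less b u v → Less b v w → Less b u w
    Less-trans {b} h h′ = record
      { Qα = Q-+ b (Qα h) (Q⇒N b (Qα h′)) ; Pβ = P-+ (Pβ h) (P⇒N (Pβ h′))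
      ; A-diff = trans (A-diff h′) (trans (+-congʳ (A-diff h)) (+-assoc _ _ _))
      ; B-diff = trans (B-diff h′) (trans (+-congʳ (B-diff h)) (+-assoc _ _ _)) }

    -- The strict gap in B of the subtree reappears in A as x B_u (α + β). Strictness thus reaches
    -- the cycle even when the subtree shows none in A.
    Less-◂ʳ : ∀ b {u v w} → Good b u → Less false v w → Less b (u ◂ v) (u ◂ w)
    Less-◂ʳ b {u} {v} {w} (good d e) h = record
      { Qα = P⇒Q b (P-resp (+-comm _ _)
          (P-+ (P-* P-x (P-* e dP)) (N-+ (N-* (Q⇒N b d) (P⇒N dP)) (N-* (P⇒N e) (Qα h)))))
      ; Pβ = P-* e dP
      ; A-diff = trans (+-cong (*-congˡ (*-congˡ Πw)) (+-cong (*-congˡ Πw) (*-congˡ (A-diff h))))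
          (solve 7 (λ x D B a π α β → x :* (B :* (π :+ (β :+ α))) :+ (D :* (π :+ (β :+ α)) :+ B :* (a :+ α))
              := x :* (B :* π) :+ (D :* π :+ B :* a) :+ ((D :* (β :+ α) :+ B :* α) :+ x :* (B :* (β :+ α)))) refl
            x (D u) (B u) (A v) (Π v) (α h) (β h))
      ; B-diff = trans (*-congˡ Πw) (distribˡ _ _ _) }
      where
      dP : P (β h + α h)
      dP = P-+ (Pβ h) (Qα h)
      Πw : Π w ≈ Π v + (β h + α h)
      Πw = trans (+-cong (A-diff h) (B-diff h))
        (solve 4 (λ a α b β → (a :+ α) :+ (b :+ β) := (a :+ b) :+ (β :+ α)) refl _ _ _ _)

    Less-⊙ˡ : ∀ b b′ {u v w} → Less b v w → Good b′ u → Less b (v ⊙ u) (w ⊙ u)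
    Less-⊙ˡ b b′ {u} {v} {w} h (good d e) = record
      { Qα = Q-+ b (Q-* b (Qα h) e) (N-* (P⇒N (Pβ h)) (Q⇒N b′ d))
      ; Pβ = P-* (Pβ h) e
      ; A-diff = begin
          x * (B w * B u) + (D w * B u + B w * D u)
            ≈⟨ solve 5 (λ x B D b d → x :* (B :* b) :+ (D :* b :+ B :* d) := (x :* B :+ D) :* b :+ B :* d) refl x (B w) (D w) (B u) (D u) ⟩
          A w * B u + B w * D u
            ≈⟨ +-cong (*-congʳ (A-diff h)) (*-congʳ (B-diff h)) ⟩
          (x * B v + D v + α h) * B u + (B v + β h) * D u
            ≈⟨ solve 7 (λ x B D b d α β → (x :* B :+ D :+ α) :* b :+ (B :+ β) :* d
                 := x :* (B :* b) :+ (D :* b :+ B :* d) :+ (α :* b :+ β :* d)) refl x (B v) (D v) (B u) (D u) (α h) (β h) ⟩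
          A (v ⊙ u) + (α h * B u + β h * D u) ∎
      ; B-diff = trans (*-congʳ (B-diff h)) (distribʳ _ _ _) }

    -- A branch with k + 1 vertices together with the vertex that carries it: the path on k + 2
    -- vertices rooted at an end.
    leg : ℕ → Weight
    leg k = (x * s (suc k)) ,ʷ p (suc k)

    good-leg : ∀ k → Good true (leg k)
    good-leg k = good (P-* P-x (P-s k)) (P-p (suc k))

    legs : List ℕ → Weight
    legs [] = ε
    legs (k ∷ ks) = leg k ⊙ legs ks

    good-legs : ∀ ks → Good false (legs ks)
    good-legs [] = good N-0 P-1
    good-legs (k ∷ ks) = good-⊙ false false (good (P⇒N (goodD (good-leg k))) (goodB (good-leg k))) (good-legs ks)

    good-legs⁺ : ∀ k ks → Good true (legs (k ∷ ks))
    good-legs⁺ k ks = good-⊙ true false (good-leg k) (good-legs ks)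

    -- Moves the place where w is attached one edge away: w now sits on a fresh vertex joined to the
    -- old place.
    extend : Weight → Weight
    extend w = lift (ε ⊙ w)

    extend-cong : ∀ {v w} → v ≈ʷ w → extend v ≈ʷ extend w
    extend-cong e = lift-cong (⊙-cong ≈ʷ-refl e)

    extend-leg : ∀ k → extend (leg k) ≈ʷ leg (suc k)
    extend-leg k =
      solve 3 (λ x s p → x :* (con 1 :* p) :+ (con 0 :* p :+ con 1 :* (x :* s)) := x :* (s :+ p)) refl x (s (suc k)) (p (suc k))
      ,≈ solve 3 (λ x s p → x :* (con 1 :* p) :+ (con 0 :* p :+ con 1 :* (x :* s)) :+ con 1 :* p := p :+ x :* (s :+ p)) refl x (s (suc k)) (p (suc k))

    stretch : ℕ → Weight → Weight
    stretch zero w = w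
    stretch (suc d) w = extend (stretch d w)

    stretch-leg : ∀ d k → stretch d (leg k) ≈ʷ leg (d ℕ.+ k)
    stretch-leg zero k = ≈ʷ-refl
    stretch-leg (suc d) k = ≈ʷ-trans (extend-cong (stretch-leg d k)) (extend-leg (d ℕ.+ k))

    -- The matrix of stretch d, written [a, x c; c, a + x c].
    sa sc : ℕ → Carrier
    sa zero = 1#
    sa (suc d) = sa d + x * sc d
    sc zero = 0#
    sc (suc d) = sc d + sa d + x * sc d

    stretch-matrix : ∀ d w → stretch d w ≈ʷ
      (sa d * D w + x * sc d * B w) ,ʷ (sc d * D w + (sa d + x * sc d) * B w)
    stretch-matrix zero w =
      solve 3 (λ x d b → d := con 1 :* d :+ x :* con 0 :* b) refl x (D w) (B w)
      ,≈ solve 3 (λ x d b → b := con 0 :* d :+ (con 1 :+ x :* con 0) :* b) refl x (D w) (B w)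
    stretch-matrix (suc d) w = ≈ʷ-trans (extend-cong (stretch-matrix d w))
      (solve 5 (λ x a c d b →
          x :* (con 1 :* (c :* d :+ (a :+ x :* c) :* b)) :+ (con 0 :* (c :* d :+ (a :+ x :* c) :* b) :+ con 1 :* (a :* d :+ x :* c :* b))
          := (a :+ x :* c) :* d :+ x :* (c :+ a :+ x :* c) :* b) refl x (sa d) (sc d) (D w) (B w)
      ,≈ solve 5 (λ x a c d b →
          x :* (con 1 :* (c :* d :+ (a :+ x :* c) :* b)) :+ (con 0 :* (c :* d :+ (a :+ x :* c) :* b) :+ con 1 :* (a :* d :+ x :* c :* b))
            :+ con 1 :* (c :* d :+ (a :+ x :* c) :* b)
          := (c :+ a :+ x :* c) :* d :+ (a :+ x :* c :+ x :* (c :+ a :+ x :* c)) :* b) refl x (sa d) (sc d) (D w) (B w))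

    P-sa : ∀ d → P (sa d)
    N-sc : ∀ d → N (sc d)
    P-sa zero = P-1
    P-sa (suc d) = P-+ (P-sa d) (N-* N-x (N-sc d))
    N-sc zero = N-0
    N-sc (suc d) = N-+ (N-+ (N-sc d) (P⇒N (P-sa d))) (N-* N-x (N-sc d))

    P-sc : ∀ d → P (sc (suc d))
    P-sc d = P-resp (solve 3 (λ x a c → a :+ (c :+ x :* c) := c :+ a :+ x :* c) refl x (sa d) (sc d))
      (P-+ (P-sa d) (N-+ (N-sc d) (N-* N-x (N-sc d))))

    -- S is at least as heavy as the path on k + 1 vertices rooted at an end, with gap δ.
    Dominates : Weight → ℕ → Carrier → Set
    Dominates S k δ = A S * p k ≈ x * s (suc k) * B S + δ

    -- A path of length d + 1 joins a vertex u of weight S to a vertex v with branches leg k and W.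
    -- If S is the heavier end, moving W from v to u decreases both A and B.
    slide : ∀ b d {S W} k {δ} → Good b S → Good true W → Dominates S (suc k) δ → Q b δ →
      Less b (S ⊙ leg (suc d ℕ.+ k) ⊙ W) (S ⊙ stretch d (extend (leg k ⊙ W)))
    slide b d {S} {W} k {δ} gS gW dom qδ = Less-resp (⊙-cong (⊙-cong ≈ʷ-refl (stretch-leg (suc d) k)) ≈ʷ-refl) ≈ʷ-refl
      (Less-resp (⊙-cong (⊙-cong ≈ʷ-refl (≈ʷ-sym (stretch-matrix (suc d) (leg k)))) ≈ʷ-refl)
        (⊙-cong ≈ʷ-refl (≈ʷ-sym (stretch-matrix d (extend (leg k ⊙ W)))))
        (record
          { Qα = P-scaled
          ; Pβ = P-* (P-* (P-* (goodD gW) (P-p (suc k))) (P-sc d)) (goodB gS)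
          ; A-diff = +-cancelʳ (D W * τ * (x * s (suc (suc k)) * B S)) _ _ (trans A-identity
              (trans (+-congˡ (*-congˡ dom)) (solve 4 (λ a w y z → a :+ w :* (y :+ z) := a :+ w :* z :+ w :* y) refl _ _ _ _)))
          ; B-diff = B-identity }))
      where
      a c τ : Carrier
      a = sa d
      c = sc d
      τ = c + a + x * c
      P-scaled : Q b (D W * τ * δ)
      P-scaled = Q-resp b (*-comm _ _) (Q-* b qδ (P-* (goodD gW) (P-sc d)))
        where
        Q-resp : ∀ b {a c} → a ≈ c → Q b a → Q b c
        Q-resp true = P-resp
        Q-resp false = N-resp
      A-identity : A (S ⊙ ((a * D (extend (leg k ⊙ W)) + x * c * B (extend (leg k ⊙ W)))
                       ,ʷ (c * D (extend (leg k ⊙ W)) + (a + x * c) * B (extend (leg k ⊙ W)))))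
          + D W * τ * (x * s (suc (suc k)) * B S)
        ≈ A (S ⊙ ((sa (suc d) * D (leg k) + x * sc (suc d) * B (leg k))
              ,ʷ (sc (suc d) * D (leg k) + (sa (suc d) + x * sc (suc d)) * B (leg k))) ⊙ W)
          + D W * τ * (A S * p (suc k))
      A-identity = solve 9 (λ x a c DS BS s p DW BW →
          let BV = con 1 :* (p :* BW)
              DV = con 0 :* (p :* BW) :+ con 1 :* (x :* s :* BW :+ p :* DW)
              AV = x :* BV :+ DV
              PV = AV :+ BV
              Ad = a :* AV :+ x :* c :* PV
              Pd = c :* AV :+ (a :+ x :* c) :* PV
              τ = c :+ a :+ x :* c
              AE = (a :+ x :* c) :* (x :* s) :+ x :* τ :* p
              PE = τ :* (x :* s) :+ (a :+ x :* c :+ x :* τ) :* p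
          in x :* (BS :* Pd) :+ (DS :* Pd :+ BS :* Ad) :+ DW :* τ :* (x :* (s :+ p) :* BS)
             := x :* (BS :* PE :* BW) :+ ((DS :* PE :+ BS :* AE) :* BW :+ BS :* PE :* DW)
                :+ DW :* τ :* ((x :* BS :+ DS) :* p))
        refl x a c (D S) (B S) (s (suc k)) (p (suc k)) (D W) (B W)
      B-identity : _ ≈ _
      B-identity = solve 8 (λ x a c BS s p DW BW →
          let BV = con 1 :* (p :* BW)
              DV = con 0 :* (p :* BW) :+ con 1 :* (x :* s :* BW :+ p :* DW)
              AV = x :* BV :+ DV
              PV = AV :+ BV
              Pd = c :* AV :+ (a :+ x :* c) :* PV
              τ = c :+ a :+ x :* c
              PE = τ :* (x :* s) :+ (a :+ x :* c :+ x :* τ) :* p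
          in BS :* Pd := BS :* PE :* BW :+ DW :* p :* τ :* BS)
        refl x a c (B S) (s (suc k)) (p (suc k)) (D W) (B W)

    -- The opposite move: v is heavier than leg m at u, so the rest of u moves to v, and u ends up inside a longer branch.
    swallow : ∀ b d {S V} m {δ} → Good b S → Good false V → Dominates V (suc m) δ → P δ →
      Less b (S ⊙ leg (suc d ℕ.+ m) ⊙ V) (S ⊙ leg m ⊙ stretch d (extend V))
    swallow b d {S} {V} m {δ} gS gV dom pδ = Less-resp (⊙-cong (⊙-cong ≈ʷ-refl (stretch-leg (suc d) m)) ≈ʷ-refl) ≈ʷ-refl
      (Less-resp (⊙-cong (⊙-cong ≈ʷ-refl (≈ʷ-sym (stretch-matrix (suc d) (leg m)))) ≈ʷ-refl)
        (⊙-cong ≈ʷ-refl (≈ʷ-sym (stretch-matrix d (extend V))))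
        (record
          { Qα = Q-* b (goodD gS) Pτδ
          ; Pβ = P-* (goodB gS) Pτδ
          ; A-diff = +-cancelʳ (D S * (τ * (x * s (suc (suc m)) * B V))) _ _ (trans A-identity
              (trans (+-congˡ (*-congˡ (*-congˡ dom))) (rearrange _ _ _ _ _)))
          ; B-diff = +-cancelʳ (B S * (τ * (x * s (suc (suc m)) * B V))) _ _ (trans B-identity
              (trans (+-congˡ (*-congˡ (*-congˡ dom))) (rearrange _ _ _ _ _))) }))
      where
      a c τ : Carrier
      a = sa d
      c = sc d
      τ = c + a + x * c
      Pτδ : P (τ * δ)
      Pτδ = P-* (P-sc d) pδ
      rearrange : ∀ a w t y z → a + w * (t * (y + z)) ≈ a + w * (t * z) + w * (t * y)
      rearrange = solve 5 (λ a w t y z → a :+ w :* (t :* (y :+ z)) := a :+ w :* (t :* z) :+ w :* (t :* y)) refl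
      A-identity : A (S ⊙ leg m ⊙ ((a * D (extend V) + x * c * B (extend V)) ,ʷ (c * D (extend V) + (a + x * c) * B (extend V))))
          + D S * (τ * (x * s (suc (suc m)) * B V))
        ≈ A (S ⊙ ((sa (suc d) * D (leg m) + x * sc (suc d) * B (leg m))
              ,ʷ (sc (suc d) * D (leg m) + (sa (suc d) + x * sc (suc d)) * B (leg m))) ⊙ V)
          + D S * (τ * (A V * p (suc m)))
      A-identity = solve 9 (λ x a c DS BS s p DV′ BV′ →
          let BV = con 1 :* BV′
              DV = con 0 :* BV′ :+ con 1 :* DV′
              AV = x :* BV :+ DV
              PV = AV :+ BV
              Ad = a :* AV :+ x :* c :* PV
              Pd = c :* AV :+ (a :+ x :* c) :* PV
              τ = c :+ a :+ x :* c
              AE = (a :+ x :* c) :* (x :* s) :+ x :* τ :* p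
              PE = τ :* (x :* s) :+ (a :+ x :* c :+ x :* τ) :* p
          in x :* (BS :* p :* Pd) :+ ((DS :* p :+ BS :* (x :* s)) :* Pd :+ BS :* p :* Ad)
               :+ DS :* (τ :* (x :* (s :+ p) :* BV′))
             := x :* (BS :* PE :* BV′) :+ ((DS :* PE :+ BS :* AE) :* BV′ :+ BS :* PE :* DV′)
                :+ DS :* (τ :* ((x :* BV′ :+ DV′) :* p)))
        refl x a c (D S) (B S) (s (suc m)) (p (suc m)) (D V) (B V)
      B-identity : B S * p (suc m) * (c * D (extend V) + (a + x * c) * B (extend V)) + B S * (τ * (x * s (suc (suc m)) * B V))
        ≈ B S * (sc (suc d) * D (leg m) + (sa (suc d) + x * sc (suc d)) * B (leg m)) * B V + B S * (τ * (A V * p (suc m)))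
      B-identity = solve 8 (λ x a c BS s p DV′ BV′ →
          let BV = con 1 :* BV′
              DV = con 0 :* BV′ :+ con 1 :* DV′
              AV = x :* BV :+ DV
              PV = AV :+ BV
              Pd = c :* AV :+ (a :+ x :* c) :* PV
              τ = c :+ a :+ x :* c
              PE = τ :* (x :* s) :+ (a :+ x :* c :+ x :* τ) :* p
          in BS :* p :* Pd :+ BS :* (τ :* (x :* (s :+ p) :* BV′)) := BS :* PE :* BV′ :+ BS :* (τ :* ((x :* BV′ :+ DV′) :* p)))
        refl x a c (B S) (s (suc m)) (p (suc m)) (D V) (B V)

    -- Two legs at one vertex form a path of fixed order, so their joint A does not depend on how it
    -- is divided. Only their B changes, by the amount in `pp-shift`; it enters A of the whole with
    -- factor D_S and B with factor B_S.
    balance : ∀ b {S} j k → Good b S →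
      Less b (S ⊙ (leg (suc (j ℕ.+ k)) ⊙ leg (suc k))) (S ⊙ (leg (suc (suc (j ℕ.+ k))) ⊙ leg k))
    balance b {S} j k gS = record
      { Qα = Q-* b (goodD gS) Pδ
      ; Pβ = P-* (goodB gS) Pδ
      ; A-diff = +-cancelʳ (D S * (u * p (suc (suc k)))) _ _ (trans A-identity
          (trans (+-congˡ (*-congˡ shifted)) (solve 4 (λ a d y z → a :+ d :* (y :+ z) := a :+ d :* z :+ d :* y) refl _ _ _ _)))
      ; B-diff = trans (*-congˡ shifted) (distribˡ _ _ _) }
      where
      Pδ : P (x * s (suc j))
      Pδ = P-* P-x (P-s j)
      shifted : p (suc (suc (suc (j ℕ.+ k)))) * p (suc k) ≈ p (suc (suc (j ℕ.+ k))) * p (suc (suc k)) + x * s (suc j)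
      shifted = ≡.subst (λ n → p (suc (suc n)) * p (suc k) ≈ p (suc n) * p (suc (suc k)) + x * s (suc j)) (ℕₚ.+-suc j k) (pp-shift j (suc k))
      u v q r : Carrier
      u = p (suc (suc (j ℕ.+ k)))
      v = s (suc (suc (j ℕ.+ k)))
      q = p (suc k)
      r = s (suc k)
      A-identity : A (S ⊙ (leg (suc (suc (j ℕ.+ k))) ⊙ leg k)) + D S * (u * p (suc (suc k)))
        ≈ A (S ⊙ (leg (suc (j ℕ.+ k)) ⊙ leg (suc k))) + D S * (p (suc (suc (suc (j ℕ.+ k)))) * q)
      A-identity = solve 7 (λ x D B u v q r →
          let u′ = u :+ x :* (v :+ u)
              q′ = q :+ x :* (r :+ q)
          in x :* (B :* (u′ :* q)) :+ (D :* (u′ :* q) :+ B :* (x :* (v :+ u) :* q :+ u′ :* (x :* r))) :+ D :* (u :* q′)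
             := x :* (B :* (u :* q′)) :+ (D :* (u :* q′) :+ B :* (x :* v :* q′ :+ u :* (x :* (r :+ q)))) :+ D :* (u′ :* q))
        refl x (D S) (B S) u v q r

    -- Leg k alone is at least as heavy as leg m by `sp-shift`. Strictness comes from the further
    -- branches W; without them both sides would coincide for k = m.
    legs-dominate : ∀ {m k} W → m ℕ.≤ k → Good true W → ∃ λ δ → P δ × Dominates (leg k ⊙ W) (suc m) δ
    legs-dominate {m} {k} W m≤k gW = x * B W * s j + p (suc k) * D W * p (suc m) ,
      P-resp (+-comm _ _) (P-+ (P-* (P-* (P-p (suc k)) (goodD gW)) (P-p (suc m))) (N-* (N-* N-x (P⇒N (goodB gW))) (N-s j))) ,
      (begin
        (x * (p (suc k) * B W) + (x * s (suc k) * B W + p (suc k) * D W)) * p (suc m)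
          ≈⟨ solve 6 (λ x pₖ sₖ b d pₘ → (x :* (pₖ :* b) :+ (x :* sₖ :* b :+ pₖ :* d)) :* pₘ
               := x :* b :* ((sₖ :+ pₖ) :* pₘ) :+ pₖ :* d :* pₘ) refl x (p (suc k)) (s (suc k)) (B W) (D W) (p (suc m)) ⟩
        x * B W * (s (suc (suc k)) * p (suc m)) + p (suc k) * D W * p (suc m)
          ≈⟨ +-congʳ (*-congˡ shifted) ⟩
        x * B W * (s (suc (suc m)) * p (suc k) + s j) + p (suc k) * D W * p (suc m)
          ≈⟨ solve 6 (λ x b s p j r → x :* b :* (s :* p :+ j) :+ r := x :* s :* (p :* b) :+ (x :* b :* j :+ r)) refl
               x (B W) (s (suc (suc m))) (p (suc k)) (s j) _ ⟩
        x * s (suc (suc m)) * (p (suc k) * B W) + (x * B W * s j + p (suc k) * D W * p (suc m)) ∎)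
      where
      j : ℕ
      j = k ℕ.∸ m
      j+m : j ℕ.+ suc m ≡.≡ suc k
      j+m = ≡.trans (ℕₚ.+-suc j m) (≡.cong suc (ℕₚ.m∸n+n≡m m≤k))
      shifted : s (suc (suc k)) * p (suc m) ≈ s (suc (suc m)) * p (suc k) + s j
      shifted = ≡.subst (λ n → s (suc n) * p (suc m) ≈ s (suc (suc m)) * p n + s j) j+m (sp-shift j (suc m))

    -- From here on the cycle has length h + 3; G is the number of its vertices other than u_1.
    module Cycle (h : ℕ) where
      open Trees

      G : ℕ
      G = suc (suc h)

      ⟦_⟧ : ∀ {b} → Tree b → Weight
      ⟦ leaf ⟧ = ε
      ⟦ cyc ⟧ = (x * (t G + t G)) ,ʷ s (suc G)
      ⟦ S ◁ T ⟧ = ⟦ S ⟧ ◂ ⟦ T ⟧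

      good-⟦⟧ : ∀ {b} (T : Tree b) → Good b ⟦ T ⟧
      good-⟦⟧ leaf = good N-0 P-1
      good-⟦⟧ cyc = good (P-* P-x (P-+ (P-t (suc h)) (N-t G))) (P-s G)
      good-⟦⟧ (_◁_ {b} S T) = good-◂ b (good-⟦⟧ S) (good-⟦⟧ T)

      ⟦⟧-~ : ∀ {b} {S T : Tree b} → S ~ T → ⟦ S ⟧ ≈ʷ ⟦ T ⟧
      ⟦⟧-~ ~refl = ≈ʷ-refl
      ⟦⟧-~ (~sym e) = ≈ʷ-sym (⟦⟧-~ e)
      ⟦⟧-~ (~trans e f) = ≈ʷ-trans (⟦⟧-~ e) (⟦⟧-~ f)
      ⟦⟧-~ (~cong e f) = ⊙-cong (⟦⟧-~ e) (lift-cong (⟦⟧-~ f))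
      ⟦⟧-~ (~swap {S = S} {T} {U}) = ⊙-exchange ⟦ S ⟧ (lift ⟦ T ⟧) (lift ⟦ U ⟧)

      lift-path : ∀ k → lift ⟦ path k ⟧ ≈ʷ leg k
      lift-path zero =
        solve 1 (λ x → x :* con 1 :+ con 0 := x :* (con 0 :+ con 1)) refl x
        ,≈ solve 1 (λ x → x :* con 1 :+ con 0 :+ con 1 := con 1 :+ x :* (con 0 :+ con 1)) refl x
      lift-path (suc k) = ≈ʷ-trans (extend-cong (lift-path k)) (extend-leg k)

      ⟦◁◁⟧ : ∀ {b} (S : Tree b) ks → ⟦ S ◁◁ ks ⟧ ≈ʷ ⟦ S ⟧ ⊙ legs ks
      ⟦◁◁⟧ S [] = ≈ʷ-sym (⊙-identityʳ _)
      ⟦◁◁⟧ S (k ∷ ks) = ≈ʷ-trans (⟦◁◁⟧ (S ◁ path k) ks)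
        (≈ʷ-trans (⊙-assoc _ _ _) (⊙-cong ≈ʷ-refl (⊙-cong (lift-path k) ≈ʷ-refl)))

      lift-broom : ∀ d ks → lift ⟦ broom d ks ⟧ ≈ʷ stretch d (extend (legs ks))
      lift-broom zero ks = lift-cong (⟦◁◁⟧ leaf ks)
      lift-broom (suc d) ks = extend-cong (lift-broom d ks)

      -- Since A/B = x + D/B, and a child T adds A_T/(A_T + B_T) to D/B, the ratio grows with the
      -- ratio of the child that carries the path and with every further child. The witnesses are
      -- these gains with denominators cleared.
      deep-dominates : ∀ {b} {S : Tree b} {k} → Deep S k → ∃ λ δ → Q b δ × Dominates ⟦ S ⟧ k δ
      deep-dominates {b} (deep-root {S = S}) = D ⟦ S ⟧ , goodD (good-⟦⟧ S) ,
        solve 3 (λ x b d → (x :* b :+ d) :* con 1 := x :* (con 0 :+ con 1) :* b :+ d) refl x (B ⟦ S ⟧) (D ⟦ S ⟧)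
      deep-dominates {b} (deep-child {S = S} {T} {k} deep) with deep-dominates deep
      ... | δ , nδ , dom = D ⟦ S ⟧ * Π ⟦ T ⟧ * p (suc k) + B ⟦ S ⟧ * δ ,
        Q-+ b (Q-* b (Q-* b (goodD (good-⟦⟧ S)) (P-Π false (good-⟦⟧ T))) (P-p (suc k))) (N-* (P⇒N (goodB (good-⟦⟧ S))) nδ) ,
        (begin
          (x * (b′ * (a + c)) + (d * (a + c) + b′ * a)) * (pₖ + x * sₖ)
            ≈⟨ solve 7 (λ x b′ d a c pₖ sₖ → (x :* (b′ :* (a :+ c)) :+ (d :* (a :+ c) :+ b′ :* a)) :* (pₖ :+ x :* sₖ)
                 := b′ :* (a :* pₖ) :+ (b′ :* (a :* x :* sₖ) :+ (x :* (b′ :* (a :+ c)) :+ d :* (a :+ c)) :* (pₖ :+ x :* sₖ)))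
                 refl x b′ d a c pₖ sₖ ⟩
          b′ * (a * pₖ) + (b′ * (a * x * sₖ) + (x * (b′ * (a + c)) + d * (a + c)) * (pₖ + x * sₖ))
            ≈⟨ +-congʳ (*-congˡ dom) ⟩
          b′ * (x * sₖ * c + δ) + (b′ * (a * x * sₖ) + (x * (b′ * (a + c)) + d * (a + c)) * (pₖ + x * sₖ))
            ≈⟨ solve 8 (λ x b′ d a c pₖ sₖ δ →
                 b′ :* (x :* sₖ :* c :+ δ) :+ (b′ :* (a :* x :* sₖ) :+ (x :* (b′ :* (a :+ c)) :+ d :* (a :+ c)) :* (pₖ :+ x :* sₖ))
                 := x :* (sₖ :+ (pₖ :+ x :* sₖ)) :* (b′ :* (a :+ c)) :+ (d :* (a :+ c) :* (pₖ :+ x :* sₖ) :+ b′ :* δ))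
                 refl x b′ d a c pₖ sₖ δ ⟩
          x * (sₖ + (pₖ + x * sₖ)) * (b′ * (a + c)) + (d * (a + c) * (pₖ + x * sₖ) + b′ * δ) ∎)
        where
        b′ d a c pₖ sₖ : Carrier
        b′ = B ⟦ S ⟧
        d = D ⟦ S ⟧
        a = A ⟦ T ⟧
        c = B ⟦ T ⟧
        pₖ = p k
        sₖ = s (suc k)
      deep-dominates {b} (deep-left {S = S} {T} {k} deep) with deep-dominates deep
      ... | δ , qδ , dom = δ * Π ⟦ T ⟧ + B ⟦ S ⟧ * A ⟦ T ⟧ * p k ,
        Q-+ b (Q-* b qδ (P-Π false (good-⟦⟧ T)))
          (P⇒N (P-* (P-* (goodB (good-⟦⟧ S)) (P-A false (good-⟦⟧ T))) (P-p k))) ,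
        (begin
          (x * (b′ * π) + (d * π + b′ * a)) * p k
            ≈⟨ solve 6 (λ x b′ d a π q → (x :* (b′ :* π) :+ (d :* π :+ b′ :* a)) :* q
                 := π :* ((x :* b′ :+ d) :* q) :+ b′ :* a :* q) refl x b′ d a π (p k) ⟩
          π * ((x * b′ + d) * p k) + b′ * a * p k
            ≈⟨ +-congʳ (*-congˡ dom) ⟩
          π * (x * s (suc k) * b′ + δ) + b′ * a * p k
            ≈⟨ solve 6 (λ x b′ π s δ r → π :* (x :* s :* b′ :+ δ) :+ r := x :* s :* (b′ :* π) :+ (δ :* π :+ r))
                 refl x b′ π (s (suc k)) δ _ ⟩
          x * s (suc k) * (b′ * π) + (δ * π + b′ * a * p k) ∎)
        where
        b′ d a π : Carrier
        b′ = B ⟦ S ⟧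
        d = D ⟦ S ⟧
        a = A ⟦ T ⟧
        π = Π ⟦ T ⟧

      -- X q is the cycle with a path of length q attached, rooted at the far end of the path.
      X : ℕ → Weight
      X zero = ⟦ cyc ⟧
      X (suc q) = A (X q) ,ʷ Π (X q)

      good-X : ∀ q → Good true (X q)
      good-X zero = good-⟦⟧ cyc
      good-X (suc q) = good-lift true (good-X q)

      Φ : ℕ → List ℕ → Carrier
      Φ q ks = A (X q ⊙ legs ks)

      -- The full determinant does not depend on the root, so the root may cross the connecting
      -- edge. Repeated, this carries it from u_1 to the center of a kite.
      A-reroot : ∀ v w → A (v ◂ w) ≈ A (lift v ⊙ w)
      A-reroot v w = solve 5 (λ x d b d′ b′ →
          let a = x :* b :+ d
              a′ = x :* b′ :+ d′
          in x :* (b :* (a′ :+ b′)) :+ (d :* (a′ :+ b′) :+ b :* a′) := x :* ((a :+ b) :* b′) :+ (a :* b′ :+ (a :+ b) :* d′))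
        refl x (D v) (B v) (D w) (B w)

      A-broom : ∀ q d ks → A (X q ◂ ⟦ broom d ks ⟧) ≈ Φ (suc d ℕ.+ q) ks
      A-broom q zero ks = trans (A-reroot (X q) ⟦ leaf ◁◁ ks ⟧)
        (A-cong (⊙-cong {X (suc q)} ≈ʷ-refl (≈ʷ-trans (⟦◁◁⟧ leaf ks) (⊙-identityˡ (legs ks)))))
      A-broom q (suc d) ks = trans (A-reroot (X q) ⟦ broom (suc d) ks ⟧)
        (trans (A-cong (⊙-cong {X (suc q)} ≈ʷ-refl (⊙-identityˡ (lift ⟦ broom d ks ⟧))))
          (trans (A-broom (suc q) d ks) (reflexive (≡.cong (λ n → Φ n ks) (ℕₚ.+-suc (suc d) q)))))

      A-kite : ∀ q ks → A ⟦ kite q ks ⟧ ≈ Φ q ks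
      A-kite zero ks = A-cong (⟦◁◁⟧ cyc ks)
      A-kite (suc q) ks = trans (A-broom 0 q ks) (reflexive (≡.cong (λ n → Φ (suc n) ks) (ℕₚ.+-identityʳ q)))

      -- The branches r move one edge towards the cycle, and the vertex they leave becomes part of
      -- the branch k. The change is D_r times the cross difference of `X q` and `leg k`.
      Φ-shorten : ∀ q k r → Φ (suc q) (k ∷ r) + D (legs r) * (x * s (suc (suc k)) * B (X q))
        ≈ Φ q (suc k ∷ r) + D (legs r) * (A (X q) * p (suc k))
      Φ-shorten q k r = solve 7 (λ x d b s p d′ b′ →
          let a = x :* b :+ d
          in x :* ((a :+ b) :* (p :* b′)) :+ (a :* (p :* b′) :+ (a :+ b) :* (x :* s :* b′ :+ p :* d′)) :+ d′ :* (x :* (s :+ p) :* b)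
             := x :* (b :* ((p :+ x :* (s :+ p)) :* b′))
                :+ (d :* ((p :+ x :* (s :+ p)) :* b′) :+ b :* (x :* (s :+ p) :* b′ :+ (p :+ x :* (s :+ p)) :* d′)) :+ d′ :* (a :* p))
        refl x (D (X q)) (B (X q)) (s (suc k)) (p (suc k)) (D (legs r)) (B (legs r))

      -- The cycle outweighs every path with at most as many vertices as itself. The bound m ≤ G is
      -- the origin of the threshold for q.
      cycle-dominates : ∀ {m} → m ℕ.≤ G → ∃ λ δ → P δ × Dominates (X 0) m δ
      cycle-dominates {zero} _ = x * (t G + t G) , goodD (good-⟦⟧ cyc) ,
        solve 3 (λ x b d → (x :* b :+ d) :* con 1 := x :* (con 0 :+ con 1) :* b :+ d) refl x (s (suc G)) _
      cycle-dominates {suc m} m≤G with t-mono (G ℕ.∸ suc m) (suc m)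
      -- Adding p j = 1 + x t j to both sides completes the product in `ps-shift`, so that it can be
      -- used without subtracting.
      ... | r , nr , tG = δ , Pδ , +-cancelʳ (1# + x * t j) _ _ (begin
          (x * (s₁ + p₁) + x * (t G + t G)) * pₘ + (1# + x * t j)
            ≈⟨ +-congʳ (*-cong (+-congˡ (*-congˡ (+-cong tG′ tG′))) (p-t (suc m))) ⟩
          (x * (s₁ + p₁) + x * ((tₘ + r) + (tₘ + r))) * (1# + x * tₘ) + (1# + x * t j)
            ≈⟨ solve 5 (λ x g tₘ r j → (x :* g :+ x :* ((tₘ :+ r) :+ (tₘ :+ r))) :* (con 1 :+ x :* tₘ) :+ (con 1 :+ x :* j)
                 := x :* (con 1 :+ x :* tₘ) :* g
                    :+ ((con 1 :+ x :* tₘ) :* (con 1 :+ x :* (tₘ :+ r)) :+ (x :* x :* (tₘ :+ r) :* tₘ :+ x :* (r :+ j))))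
                 refl x (s₁ + p₁) tₘ r (t j) ⟩
          x * (1# + x * tₘ) * (s₁ + p₁) + ((1# + x * tₘ) * (1# + x * (tₘ + r)) + (x * x * (tₘ + r) * tₘ + x * (r + t j)))
            ≈⟨ +-cong (*-congʳ (*-congˡ (sym (p-t (suc m)))))
                 (+-cong (*-cong (sym (p-t (suc m))) (trans (+-congˡ (*-congˡ (sym tG′))) (sym (p-t G))))
                         (+-congʳ (*-congʳ (*-congˡ (sym tG′))))) ⟩
          x * pₘ * (s₁ + p₁) + (pₘ * p G + δ)
            ≈⟨ +-congˡ (+-congʳ (trans shifted (+-congˡ (p-t j)))) ⟩
          x * pₘ * (s₁ + p₁) + ((x * sₘ * (s₁ + p₁) + (1# + x * t j)) + δ)
            ≈⟨ solve 6 (λ x pₘ g sₘ δ e → x :* pₘ :* g :+ ((x :* sₘ :* g :+ e) :+ δ) := x :* (sₘ :+ pₘ) :* g :+ δ :+ e)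
                 refl x pₘ (s₁ + p₁) sₘ δ _ ⟩
          x * (sₘ + pₘ) * (s₁ + p₁) + δ + (1# + x * t j) ∎)
        where
        j : ℕ
        j = G ℕ.∸ suc m
        j+m : j ℕ.+ suc m ≡.≡ G
        j+m = ℕₚ.m∸n+n≡m m≤G
        s₁ p₁ pₘ sₘ tₘ δ : Carrier
        s₁ = s G
        p₁ = p G
        pₘ = p (suc m)
        sₘ = s (suc m)
        tₘ = t (suc m)
        δ = x * x * t G * tₘ + x * (r + t j)
        tG′ : t G ≈ tₘ + r
        tG′ = trans (reflexive (≡.cong t (≡.sym j+m))) tG
        Pδ : P δ
        Pδ = P-+ (P-* (P-* (P-* P-x P-x) (P-t (suc h))) (P-t m)) (N-* N-x (N-+ nr (N-t j)))
        shifted : pₘ * p G ≈ x * sₘ * s (suc G) + p j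
        shifted = ≡.subst (λ n → pₘ * p n ≈ x * sₘ * s (suc n) + p j) j+m (ps-shift j (suc m))

      private
        -- Both sides are prolonged by one edge, that is, by the same matrix of determinant 1; the
        -- gap stays exactly δ.
        dominates-step : ∀ w k {δ} → Dominates w k δ → Dominates (lift w) (suc k) δ
        dominates-step w k {δ} dom = begin
          (x * (x * b + d + b) + (x * b + d)) * (pₖ + x * sₖ)
            ≈⟨ solve 5 (λ x b d pₖ sₖ → (x :* (x :* b :+ d :+ b) :+ (x :* b :+ d)) :* (pₖ :+ x :* sₖ)
                 := (x :* b :+ d) :* pₖ :+ ((x :* b :+ d) :* x :* sₖ :+ x :* (x :* b :+ d :+ b) :* (pₖ :+ x :* sₖ)))
                 refl x b d pₖ sₖ ⟩
          (x * b + d) * pₖ + ((x * b + d) * x * sₖ + x * (x * b + d + b) * (pₖ + x * sₖ))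
            ≈⟨ +-congʳ dom ⟩
          x * sₖ * b + δ + ((x * b + d) * x * sₖ + x * (x * b + d + b) * (pₖ + x * sₖ))
            ≈⟨ solve 6 (λ x b d pₖ sₖ δ → x :* sₖ :* b :+ δ :+ ((x :* b :+ d) :* x :* sₖ :+ x :* (x :* b :+ d :+ b) :* (pₖ :+ x :* sₖ))
                 := x :* (sₖ :+ (pₖ :+ x :* sₖ)) :* (x :* b :+ d :+ b) :+ δ) refl x b d pₖ sₖ δ ⟩
          x * (sₖ + (pₖ + x * sₖ)) * (x * b + d + b) + δ ∎
          where
          b d pₖ sₖ : Carrier
          b = B w
          d = D w
          pₖ = p k
          sₖ = s (suc k)

      X-dominates : ∀ q {m} → m ℕ.≤ q ℕ.+ G → ∃ λ δ → P δ × Dominates (X q) m δ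
      X-dominates zero m≤ = cycle-dominates m≤
      X-dominates (suc q) {zero} _ = D (X (suc q)) , goodD (good-X (suc q)) ,
        solve 3 (λ x b d → (x :* b :+ d) :* con 1 := x :* (con 0 :+ con 1) :* b :+ d) refl x (B (X (suc q))) (D (X (suc q)))
      X-dominates (suc q) {suc m} m≤ with X-dominates q (ℕ.s≤s⁻¹ m≤)
      ... | δ , pδ , dom = δ , pδ , dominates-step (X q) m dom

      Φ-decrease : ∀ q k j r → k ℕ.< q ℕ.+ G → ∃ λ δ → P δ × Φ (suc q) (k ∷ j ∷ r) ≈ Φ q (suc k ∷ j ∷ r) + δ
      Φ-decrease q k j r k< with X-dominates q k<
      ... | δ , pδ , dom = D (legs (j ∷ r)) * δ , P-* (goodD (good-legs⁺ j r)) pδ ,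
        +-cancelʳ (D (legs (j ∷ r)) * (x * s (suc (suc k)) * B (X q))) _ _
          (trans (Φ-shorten q k (j ∷ r))
            (trans (+-congˡ (*-congˡ dom)) (solve 4 (λ f d u v → f :+ d :* (u :+ v) := f :+ d :* v :+ d :* u) refl _ _ _ _)))

      -- The cross difference of `X q` and the path with index i + q does not depend on q. It
      -- reduces the comparison of two kites to the bare cycle against a path with index i.
      X-cross : ∀ q i → A (X q) * p (i ℕ.+ q) + x * s (suc i) * B (X 0) ≈ x * s (suc (i ℕ.+ q)) * B (X q) + A (X 0) * p i
      X-cross zero i rewrite ℕₚ.+-identityʳ i = +-comm _ _
      X-cross (suc q) i rewrite ℕₚ.+-suc i q = begin
        (x * (x * b + d + b) + (x * b + d)) * (pₖ + x * sₖ) + e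
          ≈⟨ solve 6 (λ x b d pₖ sₖ e → (x :* (x :* b :+ d :+ b) :+ (x :* b :+ d)) :* (pₖ :+ x :* sₖ) :+ e
               := (x :* b :+ d) :* pₖ :+ e :+ ((x :* b :+ d) :* x :* sₖ :+ x :* (x :* b :+ d :+ b) :* (pₖ :+ x :* sₖ)))
               refl x b d pₖ sₖ e ⟩
        (x * b + d) * pₖ + e + ((x * b + d) * x * sₖ + x * (x * b + d + b) * (pₖ + x * sₖ))
          ≈⟨ +-congʳ (X-cross q i) ⟩
        x * sₖ * b + f + ((x * b + d) * x * sₖ + x * (x * b + d + b) * (pₖ + x * sₖ))
          ≈⟨ solve 6 (λ x b d pₖ sₖ f → x :* sₖ :* b :+ f :+ ((x :* b :+ d) :* x :* sₖ :+ x :* (x :* b :+ d :+ b) :* (pₖ :+ x :* sₖ))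
               := x :* (sₖ :+ (pₖ :+ x :* sₖ)) :* (x :* b :+ d :+ b) :+ f) refl x b d pₖ sₖ f ⟩
        x * (sₖ + (pₖ + x * sₖ)) * (x * b + d + b) + f ∎
        where
        b d pₖ sₖ e f : Carrier
        b = B (X q)
        d = D (X q)
        pₖ = p (i ℕ.+ q)
        sₖ = s (suc (i ℕ.+ q))
        e = x * s (suc i) * B (X 0)
        f = A (X 0) * p i

      -- D of a bundle of legs is divisible by x, and this is the quotient. Its constant term is the
      -- number of vertices in the legs.
      E : List ℕ → Carrier
      E [] = 0#
      E (k ∷ ks) = s (suc k) * B (legs ks) + p (suc k) * E ks

      D-legs : ∀ ks → D (legs ks) ≈ x * E ks
      D-legs [] = sym (zeroʳ x)
      D-legs (k ∷ ks) = trans (+-congˡ (*-congˡ (D-legs ks)))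
        (solve 5 (λ x s b p e → x :* s :* b :+ p :* (x :* e) := x :* (s :* b :+ p :* e)) refl _ _ _ _ _)

      -- Only the terms with s and t depend on the order of the two kites; for i > G the lowest coefficient
      -- of the difference is negative although its value at x = 4 is positive.
      Φ-compare : ∀ q i k r → suc k ≡.≡ i ℕ.+ q →
        Φ (suc q) (k ∷ r) + x * (x * (E r * (s i * s (suc G)))) ≈ Φ q (suc k ∷ r) + x * (x * (E r * ((t G + t G) * p i)))
      Φ-compare q i k r k≡ = +-cancelʳ (d * (u + w)) _ _ (begin
        Φ (suc q) (k ∷ r) + x * (x * (E r * (s i * g))) + d * (u + w)
          ≈⟨ +-congʳ (+-congˡ (trans (solve 4 (λ x e i g → x :* (x :* (e :* (i :* g))) := (x :* e) :* (x :* i :* g)) refl x (E r) (s i) g)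
               (*-congʳ (sym (D-legs r))))) ⟩
        Φ (suc q) (k ∷ r) + d * (x * s i * g) + d * (u + w)
          ≈⟨ solve 5 (λ f d y u w → f :+ d :* y :+ d :* (u :+ w) := (f :+ d :* u) :+ d :* (w :+ y)) refl _ d (x * s i * g) u w ⟩
        (Φ (suc q) (k ∷ r) + d * u) + d * (w + x * s i * g)
          ≈⟨ +-congʳ (Φ-shorten q k r) ⟩
        Φ q (suc k ∷ r) + d * v + d * (w + x * s i * g)
          ≈⟨ solve 7 (λ f d v x i p g → f :+ d :* v :+ d :* (x :* p :* g :+ x :* i :* g) := f :+ d :* (v :+ x :* (i :+ p) :* g))
               refl _ d v x (s i) (p i) g ⟩
        Φ q (suc k ∷ r) + d * (v + x * s (suc i) * g)
          ≈⟨ +-congˡ (*-congˡ cross) ⟩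
        Φ q (suc k ∷ r) + d * (u + (x * g + x * (t G + t G)) * p i)
          ≈⟨ solve 7 (λ f d u x g t p → f :+ d :* (u :+ (x :* g :+ x :* t) :* p) := f :+ d :* (x :* (t :* p)) :+ d :* (u :+ x :* p :* g))
               refl _ d u x g (t G + t G) (p i) ⟩
        Φ q (suc k ∷ r) + d * (x * ((t G + t G) * p i)) + d * (u + w)
          ≈⟨ +-congʳ (+-congˡ (trans (*-congʳ (D-legs r)) (solve 3 (λ x e y → x :* e :* (x :* y) := x :* (x :* (e :* y))) refl x (E r) _))) ⟩
        Φ q (suc k ∷ r) + x * (x * (E r * ((t G + t G) * p i))) + d * (u + w) ∎)
        where
        d u v w g : Carrier
        d = D (legs r)
        g = s (suc G)
        u = x * s (suc (suc k)) * B (X q)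
        v = A (X q) * p (suc k)
        w = x * p i * g
        cross : v + x * s (suc i) * g ≈ u + (x * g + x * (t G + t G)) * p i
        cross = ≡.subst (λ n → A (X q) * p n + x * s (suc i) * g ≈ x * s (suc n) * B (X q) + A (X 0) * p i) (≡.sym k≡) (X-cross q i)

-- Reduction of an arbitrary tree to an optimal kite.

module Reduction where

  open import Data.Nat using (ℕ; zero; suc; _+_; _*_; _⊔_; _≤_; _<_; z≤n; s≤s; _≤?_)
  open import Data.Nat.Properties
  open import Data.Nat.Induction using (<-wellFounded)
  open import Data.Nat.Tactic.RingSolver using (solve-∀)
  open import Induction.WellFounded using (Acc; acc)
  open import Data.Bool using (Bool; true; false)
  open import Data.List using (List; []; _∷_; _++_; length)
  open import Data.List.Relation.Binary.Permutation.Propositional using (_↭_; ↭-sym)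
  import Data.List.Relation.Binary.Permutation.Propositional as ↭
  open import Data.List.Relation.Binary.Permutation.Propositional.Properties using (↭-length)
  open import Data.Product using (∃; _×_; _,_; proj₁; proj₂)
  open import Data.Sum using (_⊎_; inj₁; inj₂)
  open import Relation.Binary.PropositionalEquality
  open import Relation.Nullary using (¬_; Dec; yes; no; contradiction)
  open Trees
  open Balanced
  open Weights

  ◁◁-++ : ∀ {b} (S : Tree b) ks js → S ◁◁ (ks ++ js) ≡ S ◁◁ ks ◁◁ js
  ◁◁-++ S [] js = refl
  ◁◁-++ S (k ∷ ks) js = ◁◁-++ (S ◁ path k) ks js

  ◁◁-cong : ∀ {b} {S S′ : Tree b} ks → S ~ S′ → S ◁◁ ks ~ S′ ◁◁ ks
  ◁◁-cong [] e = e
  ◁◁-cong (k ∷ ks) e = ◁◁-cong ks (~cong e ~refl)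

  ◁◁-◁ : ∀ {b} (S : Tree b) T ks → S ◁ T ◁◁ ks ~ S ◁◁ ks ◁ T
  ◁◁-◁ S T [] = ~refl
  ◁◁-◁ S T (k ∷ ks) = ~trans (◁◁-cong ks ~swap) (◁◁-◁ (S ◁ path k) T ks)

  ◁◁-↭ : ∀ {b} (S : Tree b) {ks js} → ks ↭ js → S ◁◁ ks ~ S ◁◁ js
  ◁◁-↭ S ↭.refl = ~refl
  ◁◁-↭ S (↭.prep k e) = ◁◁-↭ (S ◁ path k) e
  ◁◁-↭ S (↭.swap {xs = ks} k j e) = ~trans (◁◁-cong ks ~swap) (◁◁-↭ (S ◁ path j ◁ path k) e)
  ◁◁-↭ S (↭.trans e f) = ~trans (◁◁-↭ S e) (◁◁-↭ S f)

  broom-↭ : ∀ d {ks js} → ks ↭ js → broom d ks ~ broom d js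
  broom-↭ zero e = ◁◁-↭ leaf e
  broom-↭ (suc d) e = ~cong ~refl (broom-↭ d e)

  leaves-path : ∀ k → leaves (path k) ⊔ 1 ≡ 1
  leaves-path zero = refl
  leaves-path (suc k) = cong (_⊔ 1) (leaves-path k)

  leaves-◁◁ : ∀ {b} (S : Tree b) ks → leaves (S ◁◁ ks) ≡ leaves S + length ks
  leaves-◁◁ S [] = sym (+-identityʳ _)
  leaves-◁◁ S (k ∷ ks) = trans (leaves-◁◁ (S ◁ path k) ks)
    (trans (cong (λ n → leaves S + n + length ks) (leaves-path k)) (+-assoc (leaves S) 1 (length ks)))

  leaves-broom : ∀ d k ks → leaves (broom d (k ∷ ks)) ≡ suc (length ks)
  leaves-broom zero k ks = leaves-◁◁ leaf (k ∷ ks)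
  leaves-broom (suc d) k ks = trans (cong (_⊔ 1) (leaves-broom d k ks)) (cong suc (⊔-identityʳ (length ks)))

  leaves-~ : ∀ {b} {S T : Tree b} → S ~ T → leaves S ≡ leaves T
  leaves-~ ~refl = refl
  leaves-~ (~sym e) = sym (leaves-~ e)
  leaves-~ (~trans e f) = trans (leaves-~ e) (leaves-~ f)
  leaves-~ (~cong e f) = cong₂ (λ u v → u + (v ⊔ 1)) (leaves-~ e) (leaves-~ f)
  leaves-~ (~swap {S = S} {T} {U}) = lemma (leaves S) _ _
    where
    lemma : ∀ a b c → a + b + c ≡ a + c + b
    lemma = solve-∀

  module _ (h : ℕ) where
    open Sizes h

    extra-path : ∀ k → extra (path k) ≡ k
    extra-path zero = refl
    extra-path (suc k) = cong suc (extra-path k)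

    extra-◁◁ : ∀ {b} (S : Tree b) ks → extra (S ◁◁ ks) ≡ extra S + total ks
    extra-◁◁ S [] = sym (+-identityʳ _)
    extra-◁◁ S (k ∷ ks) = trans (extra-◁◁ (S ◁ path k) ks)
      (trans (cong (λ n → extra S + suc n + total ks) (extra-path k)) (+-assoc (extra S) (suc k) (total ks)))

    extra-broom : ∀ d ks → extra (broom d ks) ≡ d + total ks
    extra-broom zero ks = extra-◁◁ leaf ks
    extra-broom (suc d) ks = cong suc (extra-broom d ks)

    extra-~ : ∀ {b} {S T : Tree b} → S ~ T → extra S ≡ extra T
    extra-~ ~refl = refl
    extra-~ (~sym e) = sym (extra-~ e)
    extra-~ (~trans e f) = trans (extra-~ e) (extra-~ f)
    extra-~ (~cong e f) = cong₂ (λ u v → u + suc v) (extra-~ e) (extra-~ f)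
    extra-~ (~swap {S = S} {T} {U}) = lemma (extra S) _ _
      where
      lemma : ∀ a b c → a + b + c ≡ a + c + b
      lemma = solve-∀

  module Reduce (C : Cone) (h : ℕ) where
    open WeightAlgebra C using (P; _≈ʷ_; Less; Less-resp; Less-trans; Less-◂ʳ; Less-⊙ˡ; _⊙_; leg; legs; stretch; extend; Good; good;
      good-⊙; good-lift; good-leg; good-legs; good-legs⁺; A; A-cong; A-diff; Qα; ⊙-cong; ⊙-assoc; ⊙-comm; slide; swallow; balance;
      legs-dominate; Dominates)
    module W = WeightAlgebra C
    open W.Cycle h
    open Sizes h

    -- The numbers of vertices and leaves are carried along because the final kite has to lie in the
    -- same class. The case without strict gain is kept as `~`, not as equality of weights, so that
    -- minimal graphs are identified up to isomorphism.
    record Reduces {b} (S T : Tree b) : Set where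
      constructor reduces
      field
        same-extra : extra S ≡ extra T
        same-leaves : leaves S ≡ leaves T
        step : S ~ T ⊎ Less b ⟦ S ⟧ ⟦ T ⟧
    open Reduces

    R-~ : ∀ {b} {S T : Tree b} → S ~ T → Reduces S T
    R-~ e = reduces (extra-~ h e) (leaves-~ e) (inj₁ e)

    R-trans : ∀ {b} {S T U : Tree b} → Reduces S T → Reduces T U → Reduces S U
    R-trans (reduces e l s) (reduces e′ l′ s′) = reduces (trans e e′) (trans l l′) (go s s′)
      where
      go : _ → _ → _
      go (inj₁ a) (inj₁ b) = inj₁ (~trans a b)
      go (inj₁ a) (inj₂ b) = inj₂ (Less-resp (⟦⟧-~ (~sym a)) W.≈ʷ-refl b)
      go (inj₂ a) (inj₁ b) = inj₂ (Less-resp W.≈ʷ-refl (⟦⟧-~ b) a)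
      go (inj₂ a) (inj₂ b) = inj₂ (Less-trans a b)

    R-◁ : ∀ {b} {S S′ : Tree b} {T T′} → Reduces S S′ → Reduces T T′ → Reduces (S ◁ T) (S′ ◁ T′)
    R-◁ {b} {S} {S′} {T} {T′} (reduces e l s) (reduces e′ l′ s′) =
      reduces (cong₂ (λ u v → u + suc v) e e′) (cong₂ (λ u v → u + (v ⊔ 1)) l l′) (go s s′)
      where
      right : Less false ⟦ T ⟧ ⟦ T′ ⟧ → Less b ⟦ S ◁ T ⟧ ⟦ S ◁ T′ ⟧
      right = Less-◂ʳ b (good-⟦⟧ S)
      left : Less b ⟦ S ⟧ ⟦ S′ ⟧ → Less b ⟦ S ◁ T′ ⟧ ⟦ S′ ◁ T′ ⟧
      left a = Less-⊙ˡ b true a (good-lift false (good-⟦⟧ T′))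
      go : _ → _ → _
      go (inj₁ a) (inj₁ c) = inj₁ (~cong a c)
      go (inj₁ a) (inj₂ c) = inj₂ (Less-resp (W.≈ʷ-refl {⟦ S ◁ T ⟧}) (⟦⟧-~ (~cong {S = S} {S′} {T′} a ~refl)) (right c))
      go (inj₂ a) (inj₁ c) = inj₂ (Less-resp (⟦⟧-~ (~cong {S = S} {S} {T′} {T} ~refl (~sym c))) (W.≈ʷ-refl {⟦ S′ ◁ T′ ⟧}) (left a))
      go (inj₂ a) (inj₂ c) = inj₂ (Less-trans (right c) (left a))

    private
      ⟦◁◁path⟧ : ∀ {b} (S : Tree b) k ks → ⟦ S ◁ path k ◁◁ ks ⟧ ≈ʷ ⟦ S ⟧ ⊙ leg k ⊙ legs ks
      ⟦◁◁path⟧ S k ks = W.≈ʷ-trans {⟦ S ◁ path k ◁◁ ks ⟧} {⟦ S ◁ path k ⟧ ⊙ legs ks} {⟦ S ⟧ ⊙ leg k ⊙ legs ks} (⟦◁◁⟧ (S ◁ path k) ks)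
        (⊙-cong {⟦ S ◁ path k ⟧} {⟦ S ⟧ ⊙ leg k} {legs ks} {legs ks}
          (⊙-cong {⟦ S ⟧} {⟦ S ⟧} {W.lift ⟦ path k ⟧} {leg k} W.≈ʷ-refl (lift-path k)) W.≈ʷ-refl)

    private
      extra-slide : ∀ {b} (S : Tree b) d k ks → extra (S ◁ path (suc d + k) ◁◁ ks) ≡ extra (S ◁ broom d (k ∷ ks))
      extra-slide S d k ks = trans (extra-◁◁ h (S ◁ path (suc d + k)) ks) (trans (cong (λ n → extra S + suc n + total ks) (extra-path h (suc d + k)))
        (trans (lemma (extra S) d k (total ks)) (cong (λ n → extra S + suc n) (sym (extra-broom h d (k ∷ ks))))))
        where
        lemma : ∀ s d k r → s + suc (suc d + k) + r ≡ s + suc (d + (suc k + r))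
        lemma = solve-∀

      leaves-slide : ∀ {b} (S : Tree b) d k ks → leaves (S ◁ path (suc d + k) ◁◁ ks) ≡ leaves (S ◁ broom d (k ∷ ks))
      leaves-slide S d k ks = trans (leaves-◁◁ (S ◁ path (suc d + k)) ks) (trans (cong (λ n → leaves S + n + length ks) (leaves-path (suc d + k)))
        (trans (+-assoc (leaves S) 1 (length ks)) (cong (leaves S +_)
          (sym (trans (cong (_⊔ 1) (leaves-broom d k ks)) (cong suc (⊔-identityʳ (length ks))))))))

      extra-swallow : ∀ {b} (S : Tree b) d m ks → extra (S ◁ path (suc d + m) ◁◁ ks) ≡ extra (S ◁ path m ◁ broom d ks)
      extra-swallow S d m ks = trans (extra-◁◁ h (S ◁ path (suc d + m)) ks) (trans (cong (λ n → extra S + suc n + total ks) (extra-path h (suc d + m)))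
        (trans (lemma (extra S) d m (total ks)) (sym (cong₂ (λ u v → extra S + suc u + suc v) (extra-path h m) (extra-broom h d ks)))))
        where
        lemma : ∀ s d k r → s + suc (suc d + k) + r ≡ s + suc k + suc (d + r)
        lemma = solve-∀

      leaves-swallow : ∀ {b} (S : Tree b) d m k ks → leaves (S ◁ path (suc d + m) ◁◁ (k ∷ ks)) ≡ leaves (S ◁ path m ◁ broom d (k ∷ ks))
      leaves-swallow S d m k ks = trans (leaves-◁◁ (S ◁ path (suc d + m)) (k ∷ ks))
        (cong₂ (λ u v → leaves S + u + v) (trans (leaves-path (suc d + m)) (sym (leaves-path m)))
          (sym (trans (cong (_⊔ 1) (leaves-broom d k ks)) (cong suc (⊔-identityʳ (length ks))))))

      ⟦◁broom⟧ : ∀ {b} (S : Tree b) d ks → ⟦ S ⟧ ⊙ stretch d (extend (legs ks)) ≈ʷ ⟦ S ◁ broom d ks ⟧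
      ⟦◁broom⟧ S d ks = ⊙-cong {⟦ S ⟧} {⟦ S ⟧} {stretch d (extend (legs ks))} {W.lift ⟦ broom d ks ⟧} W.≈ʷ-refl (W.≈ʷ-sym (lift-broom d ks))

      ⟦◁path◁broom⟧ : ∀ {b} (S : Tree b) m d ks → ⟦ S ⟧ ⊙ leg m ⊙ stretch d (extend (legs ks)) ≈ʷ ⟦ S ◁ path m ◁ broom d ks ⟧
      ⟦◁path◁broom⟧ S m d ks = ⊙-cong {⟦ S ⟧ ⊙ leg m} {⟦ S ◁ path m ⟧} {stretch d (extend (legs ks))} {W.lift ⟦ broom d ks ⟧}
        (⊙-cong {⟦ S ⟧} {⟦ S ⟧} {leg m} {W.lift ⟦ path m ⟧} W.≈ʷ-refl (W.≈ʷ-sym (lift-path m))) (W.≈ʷ-sym (lift-broom d ks))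

    -- The connecting path and the branch k fuse into one branch, so no leaf is lost. The descent of
    -- k + 1 steps in S makes the root the heavier end.
    R-slide : ∀ {b} (S : Tree b) d k j ks → Deep S (suc k) →
      Reduces (S ◁ path (suc d + k) ◁◁ (j ∷ ks)) (S ◁ broom d (k ∷ j ∷ ks))
    R-slide {b} S d k j ks deep with deep-dominates deep
    ... | δ , qδ , dom = reduces (extra-slide S d k (j ∷ ks)) (leaves-slide S d k (j ∷ ks))
      (inj₂ (Less-resp (W.≈ʷ-sym (⟦◁◁path⟧ S (suc d + k) (j ∷ ks))) (⟦◁broom⟧ S d (k ∷ j ∷ ks))
        (slide b d {⟦ S ⟧} {legs (j ∷ ks)} k (good-⟦⟧ S) (good-legs⁺ j ks) dom qδ)))

    private
      less-swallow : ∀ {b} (S : Tree b) d m k j ks → m ≤ k →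
        Less b (⟦ S ⟧ ⊙ leg (suc d + m) ⊙ legs (k ∷ j ∷ ks)) (⟦ S ⟧ ⊙ leg m ⊙ stretch d (extend (legs (k ∷ j ∷ ks))))
      less-swallow {b} S d m k j ks m≤k = swallow b d {⟦ S ⟧} {V} m {proj₁ dom} (good-⟦⟧ S) gV (proj₂ (proj₂ dom)) (proj₁ (proj₂ dom))
        where
        V : W.Weight
        V = legs (k ∷ j ∷ ks)
        gV : Good false V
        gV = good-legs (k ∷ j ∷ ks)
        dom : ∃ λ δ → P δ × Dominates V (suc m) δ
        dom = legs-dominate {m} {k} (legs (j ∷ ks)) m≤k (good-legs⁺ j ks)

    -- When the leg m at the root is the lighter end, it is S, with the cycle if there is one, that
    -- moves to the far end; the connecting path then prolongs the leg m.
    R-swallow : ∀ {b} (S : Tree b) d m k j ks → m ≤ k →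
      Reduces (S ◁ path (suc d + m) ◁◁ (k ∷ j ∷ ks)) (S ◁ path m ◁ broom d (k ∷ j ∷ ks))
    R-swallow {b} S d m k j ks m≤k = reduces (extra-swallow S d m (k ∷ j ∷ ks)) (leaves-swallow S d m k (j ∷ ks))
      (inj₂ (Less-resp {b} {⟦ S ⟧ ⊙ leg (suc d + m) ⊙ legs (k ∷ j ∷ ks)} {⟦ S ◁ path (suc d + m) ◁◁ (k ∷ j ∷ ks) ⟧}
        {⟦ S ⟧ ⊙ leg m ⊙ stretch d (extend (legs (k ∷ j ∷ ks)))} {⟦ S ◁ path m ◁ broom d (k ∷ j ∷ ks) ⟧}
        (W.≈ʷ-sym (⟦◁◁path⟧ S (suc d + m) (k ∷ j ∷ ks))) (⟦◁path◁broom⟧ S m d (k ∷ j ∷ ks))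
        (less-swallow S d m k j ks m≤k)))

    base : (b : Bool) → Tree b
    base false = leaf
    base true = cyc

    -- In a `comet` nothing but one path starts at the base, and its center carries at least two
    -- branches; with a single branch it would be a `spider`.
    data Normal {b} : Tree b → Set where
      spider : ∀ ks → Normal (base b ◁◁ ks)
      comet  : ∀ d k j ks → Normal (base b ◁ broom d (k ∷ j ∷ ks))

    -- A normal tree as seen from a parent. The edge to the parent makes the root of a spider with
    -- at most one leg an ordinary vertex of a path.
    data Branch : Tree false → Set where
      thread : ∀ m → Branch (path m)
      brush  : ∀ d k j ks → Branch (broom d (k ∷ j ∷ ks))

    branch : ∀ {T} → Normal T → Branch T
    branch (spider []) = thread 0
    branch (spider (k ∷ [])) = thread (suc k)
    branch (spider (k ∷ j ∷ ks)) = brush 0 k j ks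
    branch (comet d k j ks) = brush (suc d) k j ks

    Reducible : ∀ {b} → Tree b → Set
    Reducible T = ∃ λ S → Normal S × Reduces S T

    private
      via : ∀ {b} {S T : Tree b} → Reduces S T → Reducible S → Reducible T
      via r (U , n , r′) = U , n , R-trans r′ r

      spider-++ : ∀ {b} ks js {T : Tree b} → Reduces (base b ◁◁ ks ◁◁ js) T → Reducible T
      spider-++ {b} ks js r = _ , spider (ks ++ js) , subst (λ S → Reduces S _) (sym (◁◁-++ (base b) ks js)) r

      deep-leg : ∀ {b} (S : Tree b) {k m} ks → k ≤ m → Deep (S ◁ path m ◁◁ ks) (suc k)
      deep-leg S ks k≤m = deep-◁◁ ks (deep-child (deep-≤ k≤m (deep-path _)))

      deep-broom : ∀ d k ks → Deep (broom d (k ∷ ks)) k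
      deep-broom zero k ks = deep-◁◁ ks (deep-≤ (n≤1+n k) (deep-child (deep-path k)))
      deep-broom (suc d) k ks = deep-≤ (n≤1+n k) (deep-child (deep-broom d k ks))

      -- The leg m at the root competes with the first branch k of the broom; whichever is longer
      -- keeps its end as the common center.
      merge-legs : ∀ b m ms d k j ks → Reducible (base b ◁◁ (m ∷ ms) ◁ broom d (k ∷ j ∷ ks))
      merge-legs b m ms d k j ks with k ≤? m
      ... | yes k≤m = spider-++ (m ∷ ms) (suc d + k ∷ j ∷ ks) (R-slide (base b ◁◁ (m ∷ ms)) d k j ks (deep-leg (base b) ms k≤m))
      ... | no k≰m = spider-++ ms (suc d + m ∷ k ∷ j ∷ ks)
        (R-trans (R-swallow (base b ◁◁ ms) d m k j ks (<⇒≤ (≰⇒> k≰m))) (R-~ (~sym (~cong (◁◁-◁ (base b) (path m) ms) ~refl))))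

      -- A broom descends at least as far as its first branch is long. The broom with the longer
      -- first branch therefore makes the root heavy enough to attract the branches of the other
      -- one, and a single broom with legs remains.
      merge-brooms : ∀ b d k j ks d′ k′ j′ ks′ → k′ ≤ k →
        Reducible (base b ◁ broom d (k ∷ j ∷ ks) ◁ broom d′ (k′ ∷ j′ ∷ ks′))
      merge-brooms b d k j ks d′ k′ j′ ks′ k′≤k =
        via (R-trans (R-~ (~sym (◁◁-◁ (base b) (broom d (k ∷ j ∷ ks)) (suc d′ + k′ ∷ j′ ∷ ks′))))
              (R-slide (base b ◁ broom d (k ∷ j ∷ ks)) d′ k′ j′ ks′ (deep-child (deep-≤ k′≤k (deep-broom d k (j ∷ ks))))))
          (merge-legs b (suc d′ + k′) (j′ ∷ ks′) d k j ks)

    merge : ∀ {b} {S : Tree b} {T} → Normal S → Branch T → Reducible (S ◁ T)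
    merge {b} (spider ks) (thread m) = _ , spider (m ∷ ks) , R-~ (◁◁-◁ (base b) (path m) ks)
    merge {b} (spider []) (brush d k j ks) = _ , comet d k j ks , R-~ ~refl
    merge {b} (spider (m ∷ ms)) (brush d k j ks) = merge-legs b m ms d k j ks
    merge {b} (comet d k j ks) (thread m) = via (R-~ ~swap) (merge-legs b m [] d k j ks)
    merge {b} (comet d k j ks) (brush d′ k′ j′ ks′) with k′ ≤? k
    ... | yes k′≤k = merge-brooms b d k j ks d′ k′ j′ ks′ k′≤k
    ... | no k′≰k = via (R-~ ~swap) (merge-brooms b d′ k′ j′ ks′ d k j ks (<⇒≤ (≰⇒> k′≰k)))

    reduce : ∀ {b} (T : Tree b) → Reducible T
    reduce leaf = _ , spider [] , R-~ ~refl
    reduce cyc = _ , spider [] , R-~ ~refl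
    reduce (S ◁ T) with reduce S | reduce T
    ... | _ , nS , rS | _ , nT , rT = via (R-◁ rS rT) (merge nS (branch nT))

    kite-↭ : ∀ q {ks js} → ks ↭ js → kite q ks ~ kite q js
    kite-↭ zero e = ◁◁-↭ cyc e
    kite-↭ (suc q) e = ~cong ~refl (broom-↭ q e)

    extra-kite : ∀ q ks → extra (kite q ks) ≡ G + (q + total ks)
    extra-kite zero ks = extra-◁◁ h cyc ks
    extra-kite (suc q) ks = cong (λ n → G + suc n) (extra-broom h q ks)

    leaves-kite : ∀ q k ks → leaves (kite q (k ∷ ks)) ≡ suc (length ks)
    leaves-kite zero k ks = leaves-◁◁ cyc (k ∷ ks)
    leaves-kite (suc q) k ks = trans (cong (_⊔ 1) (leaves-broom q k ks)) (cong suc (⊔-identityʳ (length ks)))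

    Φ-↭ : ∀ q {ks js} → ks ↭ js → Φ q ks W.≈ Φ q js
    Φ-↭ q e = W.trans (W.sym (A-kite q _)) (W.trans (A-cong (⟦⟧-~ (kite-↭ q e))) (A-kite q _))

    infix 4 _⊏_
    record _⊏_ (a c : W.Carrier) : Set where
      constructor below
      field
        gap : W.Carrier
        gap-positive : P gap
        gap-diff : c W.≈ a W.+ gap

    ⊏-trans : ∀ {a c e} → a ⊏ c → c ⊏ e → a ⊏ e
    ⊏-trans {a} (below δ pδ e) (below δ′ pδ′ e′) = below (δ W.+ δ′) (W.P-+ pδ (W.P⇒N pδ′)) (W.trans e′ (W.trans (W.+-congʳ e) (W.+-assoc a δ δ′)))

    ⊏-resp : ∀ {a a′ c c′} → a W.≈ a′ → c W.≈ c′ → a ⊏ c → a′ ⊏ c′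
    ⊏-resp e e′ (below δ pδ f) = below δ pδ (W.trans (W.sym e′) (W.trans f (W.+-congʳ e)))

    ⊏-Less : ∀ {v w} → Less true v w → A v ⊏ A w
    ⊏-Less less = below _ (Qα less) (A-diff less)

    private
      regroup : ∀ q rest a c → A (X q ⊙ legs rest ⊙ (leg a ⊙ leg c)) W.≈ Φ q (a ∷ c ∷ rest)
      regroup q rest a c = A-cong {X q ⊙ legs rest ⊙ (leg a ⊙ leg c)} {X q ⊙ legs (a ∷ c ∷ rest)}
        (W.≈ʷ-trans (⊙-assoc (X q) (legs rest) (leg a ⊙ leg c))
          (⊙-cong {X q} {X q} {legs rest ⊙ (leg a ⊙ leg c)} {legs (a ∷ c ∷ rest)} W.≈ʷ-refl
            (W.≈ʷ-trans (⊙-comm (legs rest) (leg a ⊙ leg c)) (⊙-assoc (leg a) (leg c) (legs rest)))))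

      balance-⊏ : ∀ q j i rest → Φ q (suc (j + i) ∷ suc i ∷ rest) ⊏ Φ q (suc (suc (j + i)) ∷ i ∷ rest)
      balance-⊏ q j i rest = ⊏-resp (regroup q rest (suc (j + i)) (suc i)) (regroup q rest (suc (suc (j + i))) i)
        (⊏-Less (balance true {X q ⊙ legs rest} j i (good-⊙ true false (good-X q) (good-legs rest))))

    Equalized : ℕ → List ℕ → Set
    Equalized q ks = ks ↭ bal (total ks) (length ks) ⊎ Φ q (bal (total ks) (length ks)) ⊏ Φ q ks

    private
      equalized-step : ∀ q {ks ms} → bal (total ms) (length ms) ≡ bal (total ks) (length ks) → Φ q ms ⊏ Φ q ks →
        Equalized q ms → Equalized q ks
      equalized-step q same moved (inj₁ e) = inj₂ (⊏-resp (W.trans (Φ-↭ q e) (W.reflexive (cong (Φ q) same))) W.refl moved)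
      equalized-step q {ks} same moved (inj₂ f) = inj₂ (⊏-trans (subst (λ js → Φ q js ⊏ _) same f) moved)

    equalize : ∀ q k ks → Equalized q (k ∷ ks)
    equalize q k ks = go k ks (<-wellFounded _)
      where
      go : ∀ k ks → Acc _<_ (squares (k ∷ ks)) → Equalized q (k ∷ ks)
      go k ks (acc rec) = by-shape (shape k ks)
        where
        by-shape : Shape (k ∷ ks) → Equalized q (k ∷ ks)
        by-shape (balanced c m j e) = inj₁ (bal-unique {c = c} {m} {j} e)
        by-shape (unbalanced j i rest e) = equalized-step q
          (cong₂ bal (trans (total-balance j i rest) (sym (total-↭ e))) (sym (↭-length e)))
          (⊏-resp W.refl (Φ-↭ q (↭-sym e)) (balance-⊏ q j i rest))
          (go (suc (j + i)) (suc i ∷ rest) (rec (<-≤-trans (squares-decrease j i rest) (≤-reflexive (sym (squares-↭ e))))))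

    module _ (l N : ℕ) (2≤l : 2 ≤ l) (enough : l * G ≤ N) where

      -- With r = N - q vertices left for the branches this reads r ≥ l (q + G): balanced branches
      -- have at least g + q - 1 vertices each, so no further step towards the cycle is forced.
      Admissible : ℕ → Set
      Admissible q = q + l * (q + G) ≤ N

      length≤total : ∀ ks → length ks ≤ total ks
      length≤total [] = z≤n
      length≤total (k ∷ ks) = s≤s (≤-trans (length≤total ks) (m≤n+m (total ks) k))

      Best : (ℕ → ℕ → Set) → Set
      Best R = ∃ λ q → ∃ λ r → Admissible q × q + r ≡ N × l ≤ r × R q r

      Optimized : ℕ → List ℕ → Set
      Optimized q ks = Best λ q′ r → (q′ ≡ q × ks ↭ bal r l) ⊎ Φ q′ (bal r l) ⊏ Φ q ks

      private
        lowered : ∀ {q ks q′ ms} → Φ q′ ms ⊏ Φ q ks → Optimized q′ ms → Optimized q ks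
        lowered shorter (q″ , r , adm , tot , l≤r , inj₁ (refl , f)) = q″ , r , adm , tot , l≤r , inj₂ (⊏-resp (Φ-↭ q″ f) W.refl shorter)
        lowered shorter (q″ , r , adm , tot , l≤r , inj₂ f) = q″ , r , adm , tot , l≤r , inj₂ (⊏-trans f shorter)

        finished : ∀ {q ks} → length ks ≡ l → q + total ks ≡ N → Admissible q → Equalized q ks → Optimized q ks
        finished {q} {ks} refl tot adm (inj₁ e) = q , total ks , adm , tot , length≤total ks , inj₁ (refl , e)
        finished {q} {ks} refl tot adm (inj₂ f) = q , total ks , adm , tot , length≤total ks , inj₂ f

        Φ-decrease-⊏ : ∀ q i j rest → i < q + G → Φ q (suc i ∷ j ∷ rest) ⊏ Φ (suc q) (i ∷ j ∷ rest)
        Φ-decrease-⊏ q i j rest i< = below (proj₁ d) (proj₁ (proj₂ d)) (proj₂ (proj₂ d))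
          where
          d : ∃ λ δ → P δ × Φ (suc q) (i ∷ j ∷ rest) W.≈ Φ q (suc i ∷ j ∷ rest) W.+ δ
          d = Φ-decrease q i j rest i<

        ShortBranch : ℕ → List ℕ → Set
        ShortBranch q ks = ∃ λ i → ∃ λ j → ∃ λ rest → i < q + G × ks ↭ i ∷ j ∷ rest

        -- Inadmissibility bounds the average branch length, and `smallEntry` finds a short branch.
        -- The second branch j, present because l ≥ 2, makes the step strict.
        shortBranch : ∀ q ks → length ks ≡ l → suc q + total ks ≡ N → ¬ Admissible (suc q) → ShortBranch q ks
        shortBranch q ks len tot ¬adm with smallEntry (q + G) ks few
          where
          few : total ks < length ks * suc (q + G)
          few = +-cancelˡ-< (suc q) _ _ (subst₂ _<_ (sym tot) (cong (λ l → suc q + l * (suc q + G)) (sym len)) (≰⇒> ¬adm))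
        ... | i , [] , i< , e = contradiction (subst (2 ≤_) (trans (sym len) (↭-length e)) 2≤l) λ { (s≤s ()) }
        ... | i , j ∷ rest , i< , e = i , j , rest , i< , e

      -- The center approaches the cycle until q is admissible, at the latest for q = 0. Balancing
      -- waits until then, since a single short branch suffices for a step.
      optimize : ∀ q ks → length ks ≡ l → q + total ks ≡ N → Optimized q ks
      optimize q [] len tot = contradiction (subst (2 ≤_) (sym len) 2≤l) λ ()
      optimize zero (k ∷ ks) len tot = finished len tot enough (equalize 0 k ks)
      optimize (suc q) (k ∷ ks) len tot = decide (suc q + l * (suc q + G) ≤? N)
        where
        continue : ShortBranch q (k ∷ ks) → Optimized (suc q) (k ∷ ks)
        continue (i , j , rest , i< , e) = lowered (⊏-resp W.refl (Φ-↭ (suc q) (↭-sym e)) (Φ-decrease-⊏ q i j rest i<))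
          (optimize q (suc i ∷ j ∷ rest) (trans (sym (↭-length e)) len)
            (trans (+-suc q _) (trans (cong (suc q +_) (sym (total-↭ e))) tot)))
        decide : Dec (Admissible (suc q)) → Optimized (suc q) (k ∷ ks)
        decide (yes adm) = finished len tot adm (equalize (suc q) k ks)
        decide (no ¬adm) = continue (shortBranch q (k ∷ ks) len tot ¬adm)

      IsKite : Tree true → Set
      IsKite S = ∃ λ q → ∃ λ k → ∃ λ ks → S ≡ kite q (k ∷ ks)

      private
        kiteForm : ∀ {S} → Normal S → leaves S ≡ l → IsKite S
        kiteForm (spider []) e = contradiction (subst (2 ≤_) (sym e) 2≤l) λ ()
        kiteForm (spider (k ∷ ks)) _ = 0 , k , ks , refl
        kiteForm (comet d k j ks) _ = suc d , k , j ∷ ks , refl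

      Optimal : Tree true → Set
      Optimal T = Best λ q r → kite q (bal r l) ~ T ⊎ Φ q (bal r l) ⊏ A ⟦ T ⟧

      private
        combine : ∀ q ks T → kite q ks ~ T ⊎ Less true ⟦ kite q ks ⟧ ⟦ T ⟧ → Optimized q ks → Optimal T
        combine q ks T st (q′ , r , adm , tot , l≤r , res) = q′ , r , adm , tot , l≤r , go res st
          where
          go : (q′ ≡ q × ks ↭ bal r l) ⊎ Φ q′ (bal r l) ⊏ Φ q ks → kite q ks ~ T ⊎ Less true ⟦ kite q ks ⟧ ⟦ T ⟧ →
            kite q′ (bal r l) ~ T ⊎ Φ q′ (bal r l) ⊏ A ⟦ T ⟧
          go (inj₁ (refl , perm)) (inj₁ c) = inj₁ (~trans (kite-↭ q (↭-sym perm)) c)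
          go (inj₁ (refl , perm)) (inj₂ c) = inj₂ (⊏-resp (W.trans (A-kite q ks) (Φ-↭ q perm)) W.refl (⊏-Less c))
          go (inj₂ g) (inj₁ c) = inj₂ (⊏-resp W.refl (W.trans (W.sym (A-kite q ks)) (A-cong (⟦⟧-~ c))) g)
          go (inj₂ g) (inj₂ c) = inj₂ (⊏-trans (⊏-resp W.refl (W.sym (A-kite q ks)) g) (⊏-Less c))

      optimal : ∀ (T : Tree true) → leaves T ≡ l → extra T ≡ G + N → Optimal T
      optimal T lv ex = go (kiteForm (proj₁ (proj₂ red)) (trans (same-leaves (proj₂ (proj₂ red))) lv)) (proj₂ (proj₂ red))
        where
        red : Reducible T
        red = reduce T
        go : ∀ {S} → IsKite S → Reduces S T → Optimal T
        go (q , k , ks , refl) (reduces e f st) = combine q (k ∷ ks) T st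
          (optimize q (k ∷ ks) (trans (sym (leaves-kite q k ks)) (trans f lv))
            (+-cancelˡ-≡ G _ _ (trans (sym (extra-kite q (k ∷ ks))) (trans e ex))))

-- Adjacency and degrees in a numbered tree.

module Adjacency where

  open import Data.Nat
  open import Data.Nat.Properties
  open import Data.Bool using (Bool; true; false; if_then_else_; _∧_; _∨_; T)
  open import Data.Bool.Properties using (∨-comm; T-≡)
  open import Data.Fin using (toℕ)
  open import Data.Product using (_,_)
  open import Data.Unit using (tt)
  open import Function using (_∘_)
  open import Function.Bundles using (Equivalence)
  open import Relation.Binary.PropositionalEquality
  open import Relation.Nullary using (contradiction)
  open import Defs using (sumFin)
  open Trees

  bool : Bool → ℕ
  bool b = if b then 1 else 0

  ≡ᵇ-refl : ∀ n → (n ≡ᵇ n) ≡ true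
  ≡ᵇ-refl zero = refl
  ≡ᵇ-refl (suc n) = ≡ᵇ-refl n

  ≡ᵇ-true : ∀ {m n} → (m ≡ᵇ n) ≡ true → m ≡ n
  ≡ᵇ-true {m} {n} e = ≡ᵇ⇒≡ m n (subst T (sym e) tt)

  ≡ᵇ-false : ∀ {m n} → m ≢ n → (m ≡ᵇ n) ≡ false
  ≡ᵇ-false {m} {n} ne with m ≡ᵇ n in e
  ... | true = contradiction (≡ᵇ-true e) ne
  ... | false = refl

  ≡ᵇ-sym : ∀ m n → (m ≡ᵇ n) ≡ (n ≡ᵇ m)
  ≡ᵇ-sym zero zero = refl
  ≡ᵇ-sym zero (suc n) = refl
  ≡ᵇ-sym (suc m) zero = refl
  ≡ᵇ-sym (suc m) (suc n) = ≡ᵇ-sym m n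

  ≡ᵇ-+ : ∀ a m n → (a + m ≡ᵇ a + n) ≡ (m ≡ᵇ n)
  ≡ᵇ-+ zero m n = refl
  ≡ᵇ-+ (suc a) m n = ≡ᵇ-+ a m n

  <ᵇ-true : ∀ {m n} → m < n → (m <ᵇ n) ≡ true
  <ᵇ-true h = Equivalence.to T-≡ (<⇒<ᵇ h)

  <ᵇ-false : ∀ a j → (a + j <ᵇ a) ≡ false
  <ᵇ-false zero j = refl
  <ᵇ-false (suc a) j = <ᵇ-false a j

  sum< : ℕ → (ℕ → ℕ) → ℕ
  sum< zero f = 0
  sum< (suc n) f = f 0 + sum< n (f ∘ suc)

  count< : ℕ → (ℕ → Bool) → ℕ
  count< n f = sum< n (bool ∘ f)

  sum<-cong : ∀ n {f g : ℕ → ℕ} → (∀ i → i < n → f i ≡ g i) → sum< n f ≡ sum< n g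
  sum<-cong zero e = refl
  sum<-cong (suc n) e = cong₂ _+_ (e 0 (s≤s z≤n)) (sum<-cong n λ i h → e (suc i) (s≤s h))

  sum<-split : ∀ m n f → sum< (m + n) f ≡ sum< m f + sum< n (λ i → f (m + i))
  sum<-split zero n f = refl
  sum<-split (suc m) n f = trans (cong (f 0 +_) (sum<-split m n (f ∘ suc))) (sym (+-assoc (f 0) _ _))

  sum<-+ : ∀ n f g → sum< n (λ i → f i + g i) ≡ sum< n f + sum< n g
  sum<-+ zero f g = refl
  sum<-+ (suc n) f g = trans (cong (f 0 + g 0 +_) (sum<-+ n (f ∘ suc) (g ∘ suc)))
    (lemma (f 0) (g 0) (sum< n (f ∘ suc)) (sum< n (g ∘ suc)))
    where
    open import Data.Nat.Tactic.RingSolver using (solve-∀)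
    lemma : ∀ a b c d → a + b + (c + d) ≡ a + c + (b + d)
    lemma = solve-∀

  sum<-zero : ∀ n {f : ℕ → ℕ} → (∀ i → i < n → f i ≡ 0) → sum< n f ≡ 0
  sum<-zero zero e = refl
  sum<-zero (suc n) e = cong₂ _+_ (e 0 (s≤s z≤n)) (sum<-zero n λ i h → e (suc i) (s≤s h))

  sumFin-toℕ : ∀ n (f : ℕ → ℕ) → sumFin {n} (λ i → f (toℕ i)) ≡ sum< n f
  sumFin-toℕ zero f = refl
  sumFin-toℕ (suc n) f = cong (f 0 +_) (sumFin-toℕ n (f ∘ suc))

  count<-point : ∀ {n} k → k < n → count< n (_≡ᵇ k) ≡ 1
  count<-point {suc n} zero h = cong suc (sum<-zero n λ i _ → refl)
  count<-point {suc n} (suc k) (s≤s h) = count<-point k h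

  count<-∨ : ∀ n (f g : ℕ → Bool) → (∀ i → f i ≡ true → g i ≡ false) → count< n (λ i → f i ∨ g i) ≡ count< n f + count< n g
  count<-∨ n f g disj = trans (sum<-cong n λ i _ → pointwise i) (sum<-+ n (bool ∘ f) (bool ∘ g))
    where
    pointwise : ∀ i → bool (f i ∨ g i) ≡ bool (f i) + bool (g i)
    pointwise i with f i in e
    ... | true = cong (λ b → 1 + bool b) (sym (disj i e))
    ... | false = refl

  module Adjacent (h : ℕ) where
    open Sizes h

    last : ℕ
    last = suc (suc h)

    next : ℕ → ℕ
    next i = if i ≡ᵇ last then 0 else suc i

    prev : ℕ → ℕ
    prev zero = last
    prev (suc i) = i

    -- The root has number 0 and T is numbered after S. This order fits both the block form in
    -- `Δ-coupled` and the labels of the edge lists.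
    adj : ∀ {b} → Tree b → ℕ → ℕ → Bool
    adj leaf i j = false
    adj cyc i j = (j ≡ᵇ next i) ∨ (i ≡ᵇ next j)
    adj (S ◁ T) i j =
      if i <ᵇ size S
      then (if j <ᵇ size S then adj S i j else (i ≡ᵇ 0) ∧ (j ∸ size S ≡ᵇ 0))
      else (if j <ᵇ size S then (j ≡ᵇ 0) ∧ (i ∸ size S ≡ᵇ 0) else adj T (i ∸ size S) (j ∸ size S))

    module _ {b} (S : Tree b) (T : Tree false) where

      adj-ll : ∀ {i j} → i < size S → j < size S → adj (S ◁ T) i j ≡ adj S i j
      adj-ll hi hj rewrite <ᵇ-true hi | <ᵇ-true hj = refl

      adj-lr : ∀ {i} j → i < size S → adj (S ◁ T) i (size S + j) ≡ (i ≡ᵇ 0) ∧ (j ≡ᵇ 0)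
      adj-lr j hi rewrite <ᵇ-true hi | <ᵇ-false (size S) j | m+n∸m≡n (extra S) j = refl

      adj-rl : ∀ i {j} → j < size S → adj (S ◁ T) (size S + i) j ≡ (j ≡ᵇ 0) ∧ (i ≡ᵇ 0)
      adj-rl i hj rewrite <ᵇ-true hj | <ᵇ-false (size S) i | m+n∸m≡n (extra S) i = refl

      adj-rr : ∀ i j → adj (S ◁ T) (size S + i) (size S + j) ≡ adj T i j
      adj-rr i j rewrite <ᵇ-false (size S) i | <ᵇ-false (size S) j | m+n∸m≡n (extra S) i | m+n∸m≡n (extra S) j = refl

    adj-sym : ∀ {b} (T : Tree b) i j → adj T i j ≡ adj T j i
    adj-sym leaf i j = refl
    adj-sym cyc i j = ∨-comm (j ≡ᵇ next i) (i ≡ᵇ next j)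
    adj-sym (S ◁ T) i j with i <ᵇ size S | j <ᵇ size S
    ... | true | true = adj-sym S i j
    ... | true | false = refl
    ... | false | true = refl
    ... | false | false = adj-sym T (i ∸ size S) (j ∸ size S)

    next≢ : ∀ i → i ≢ next i
    next≢ i e with i ≡ᵇ last in eq
    ... | true = contradiction (trans (sym (≡ᵇ-true eq)) e) λ ()
    ... | false = 1+n≢n (sym e)

    adj-irrefl : ∀ {b} (T : Tree b) i → adj T i i ≡ false
    adj-irrefl leaf i = refl
    adj-irrefl cyc i = cong₂ _∨_ (≡ᵇ-false (next≢ i)) (≡ᵇ-false (next≢ i))
    adj-irrefl (S ◁ T) i with i <ᵇ size S
    ... | true = adj-irrefl S i
    ... | false = adj-irrefl T (i ∸ size S)

    next-< : ∀ {i} → i < suc last → next i < suc last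
    next-< {i} hi with i ≡ᵇ last in e
    ... | true = s≤s z≤n
    ... | false = s≤s (≤∧≢⇒< (s≤s⁻¹ hi) λ { refl → contradiction (trans (sym e) (≡ᵇ-refl last)) λ () })

    prev-< : ∀ {i} → i < suc last → prev i < suc last
    prev-< {zero} _ = n<1+n last
    prev-< {suc i} h = <⇒≤ h

    next-prev : ∀ {i} → i < suc last → next (prev i) ≡ i
    next-prev {zero} h rewrite ≡ᵇ-refl last = refl
    next-prev {suc i} (s≤s h) rewrite ≡ᵇ-false (<⇒≢ h) = refl

    prev-next : ∀ i → prev (next i) ≡ i
    prev-next i with i ≡ᵇ last in e
    ... | true = sym (≡ᵇ-true e)
    ... | false = refl

    ≡ᵇ-next : ∀ {i} j → i < suc last → (i ≡ᵇ next j) ≡ (j ≡ᵇ prev i)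
    ≡ᵇ-next {i} j hi with i ≡ᵇ next j in e | j ≡ᵇ prev i in e′
    ... | true | true = refl
    ... | false | false = refl
    ... | true | false = contradiction (trans (sym e′) (trans (cong (_≡ᵇ prev i) (trans (sym (prev-next j)) (cong prev (sym (≡ᵇ-true {i} {next j} e))))) (≡ᵇ-refl (prev i)))) λ ()
    ... | false | true = contradiction (trans (sym e) (trans (cong (i ≡ᵇ_) (trans (cong next (≡ᵇ-true e′)) (next-prev hi))) (≡ᵇ-refl i))) λ ()

    -- A cycle of at least three vertices has two different neighbours at each vertex, hence degree
    -- 2 there.
    next≢prev : ∀ i → i < suc last → next i ≢ prev i
    next≢prev zero h e = contradiction e λ ()
    next≢prev (suc i) h e with suc i ≡ᵇ last in eq
    ... | true = contradiction (trans e (suc-injective (≡ᵇ-true {suc i} eq))) λ ()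
    ... | false = contradiction e (λ e → m≢1+n+m i {1} (sym e))

    deg : ∀ {b} → Tree b → ℕ → ℕ
    deg T i = count< (size T) (adj T i)

    deg-cyc : ∀ {i} → i < suc last → deg cyc i ≡ 2
    deg-cyc {i} hi = trans
      (trans (sum<-cong (suc last) λ j _ → cong (λ b → bool ((j ≡ᵇ next i) ∨ b)) (≡ᵇ-next j hi))
        (count<-∨ (suc last) (_≡ᵇ next i) (_≡ᵇ prev i) λ j e → ≡ᵇ-false {j} λ e′ → next≢prev i hi (trans (sym (≡ᵇ-true e)) e′)))
      (cong₂ _+_ (count<-point (next i) (next-< hi)) (count<-point (prev i) (prev-< hi)))

    private
      ∧-count : ∀ c n → count< (suc n) (λ j → c ∧ (j ≡ᵇ 0)) ≡ bool c
      ∧-count true n = count<-point {suc n} 0 (s≤s z≤n)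
      ∧-count false n = sum<-zero (suc n) λ i _ → refl

      ∧-count′ : ∀ c n → count< (suc n) (λ j → (j ≡ᵇ 0) ∧ c) ≡ bool c
      ∧-count′ c n = trans (cong (bool c +_) (sum<-zero n λ i _ → refl)) (+-identityʳ _)

    deg-l : ∀ {b} (S : Tree b) T {i} → i < size S → deg (S ◁ T) i ≡ deg S i + bool (i ≡ᵇ 0)
    deg-l S T {i} hi = trans (sum<-split (size S) (size T) (bool ∘ adj (S ◁ T) i))
      (cong₂ _+_ (sum<-cong (size S) λ j hj → cong bool (adj-ll S T hi hj))
        (trans (sum<-cong (size T) λ j _ → cong bool (adj-lr S T j hi)) (∧-count (i ≡ᵇ 0) (extra T))))

    deg-r : ∀ {b} (S : Tree b) T i → deg (S ◁ T) (size S + i) ≡ deg T i + bool (i ≡ᵇ 0)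
    deg-r S T i = trans (sum<-split (size S) (size T) (bool ∘ adj (S ◁ T) (size S + i)))
      (trans (cong₂ _+_ (trans (sum<-cong (size S) λ j hj → cong bool (adj-rl S T i hj)) (∧-count′ (i ≡ᵇ 0) (extra S)))
        (sum<-cong (size T) λ j _ → cong bool (adj-rr S T i j))) (+-comm (bool (i ≡ᵇ 0)) _))

-- Laplacian determinants of trees and of the cycle.

module TreeDeterminant where

  open import Data.Nat as ℕ using (ℕ; zero; suc; _≤_; _<_; z≤n; s≤s; _≡ᵇ_)
  open import Algebra.Bundles using (CommutativeRing)
  open Weights
  open Determinant
  open BlockDeterminant
  open Trees
  open Adjacency

  module Entries (C : Cone) where
    open Cone C using (R)
    open CommutativeRing R using (Carrier; 0#; 1#; _+_)
    open Determinants R using (-1#)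
    open import Data.Bool using (Bool; if_then_else_)

    nat : ℕ → Carrier
    nat zero = 0#
    nat (suc n) = 1# + nat n

    edge : Bool → Carrier
    edge b = if b then -1# else 0#

  module TreeDeterminants (C : Cone) (h : ℕ) where
    open WeightAlgebra C
    open Cycle h
    open Entries C
    open import Algebra.Solver.Ring.NaturalCoefficients.Default commutativeSemiring
      using (solve; _:=_; con; _:+_; _:*_)
    open import Relation.Binary.Reasoning.Setoid setoid
    open import Data.Nat.Properties as ℕₚ using (≤-refl; ≤-trans; <⇒≢; m≤m+n)
    open import Data.Bool using (Bool; true; false; if_then_else_; _∧_; _∨_)
    open import Data.Product using (_×_; _,_; proj₁; proj₂)
    import Relation.Binary.PropositionalEquality as ≡
    open ≡ using (_≡_)
    open Determinants R using (sgn; sgn-suc; -1#; -1*-1)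
    open BlockDeterminants R
    open Adjacent h
    open Sizes h

    lap : ∀ {b} → Tree b → ℕ → ℕ → Carrier
    lap T i j = if i ≡ᵇ j then x + nat (deg T i) else edge (adj T i j)

    full minor : ∀ {b} → Tree b → Carrier
    full T = Δ (size T) (lap T)
    minor T = Δ (extra T) (λ i j → lap T (suc i) (suc j))

    -- The determinant is affine in its corner entry, and the complementary minor is the slope. It
    -- accounts for the extra degree of a root that receives an edge.
    Δ-update : ∀ n (m m′ : ℕ → ℕ → Carrier) c → m 0 0 ≈ m′ 0 0 + c →
      (∀ j → j < n → m 0 (suc j) ≈ m′ 0 (suc j)) → (∀ i j → i < n → j < suc n → m (suc i) j ≈ m′ (suc i) j) →
      Δ (suc n) m ≈ Δ (suc n) m′ + c * Δ n (λ i j → m′ (suc i) (suc j))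
    Δ-update n m m′ c e₀ e₁ e₂ = trans
      (+-cong (*-cong (*-congˡ e₀) (Δ-cong n λ i j hi hj → e₂ i (suc j) hi (s≤s hj)))
        (∑<-cong n λ j hj → *-cong (*-congˡ (e₁ j hj)) (Δ-cong n λ i k hi hk → e₂ i _ hi (pun-< (suc j) hk))))
      (solve 4 (λ m c d r → con 1 :* (m :+ c) :* d :+ r := (con 1 :* m :* d :+ r) :+ c :* d) refl (m′ 0 0) c _ _)

    nat-+ : ∀ m n → nat (m ℕ.+ n) ≈ nat m + nat n
    nat-+ zero n = sym (+-identityˡ _)
    nat-+ (suc m) n = trans (+-congˡ (nat-+ m n)) (sym (+-assoc _ _ _))

    module Join {b} (S : Tree b) (T : Tree false) where

      lap-ll : ∀ i j → i < size S → j < size S → lap (S ◁ T) i j ≈ lap S i j + (if i ≡ᵇ j then nat (bool (i ≡ᵇ 0)) else 0#)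
      lap-ll i j hi hj with i ≡ᵇ j
      ... | true = trans (+-congˡ (trans (reflexive (≡.cong nat (deg-l S T hi))) (nat-+ (deg S i) _))) (sym (+-assoc _ _ _))
      ... | false = trans (reflexive (≡.cong edge (adj-ll S T hi hj))) (sym (+-identityʳ _))

      lap-rr : ∀ i j → lap (S ◁ T) (size S ℕ.+ i) (size S ℕ.+ j) ≈ lap T i j + (if i ≡ᵇ j then nat (bool (i ≡ᵇ 0)) else 0#)
      lap-rr i j rewrite ≡ᵇ-+ (extra S) i j with i ≡ᵇ j
      ... | true = trans (+-congˡ (trans (reflexive (≡.cong nat (deg-r S T i))) (nat-+ (deg T i) _))) (sym (+-assoc _ _ _))
      ... | false = trans (reflexive (≡.cong edge (adj-rr S T i j))) (sym (+-identityʳ _))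

      lap-lr : ∀ i j → i < size S → lap (S ◁ T) i (size S ℕ.+ j) ≈ edge ((i ≡ᵇ 0) ∧ (j ≡ᵇ 0))
      lap-lr i j hi rewrite ≡ᵇ-false {i} {size S ℕ.+ j} (<⇒≢ (≤-trans hi (m≤m+n (size S) j))) = reflexive (≡.cong edge (adj-lr S T j hi))

      lap-rl : ∀ i j → j < size S → lap (S ◁ T) (size S ℕ.+ i) j ≈ edge ((j ≡ᵇ 0) ∧ (i ≡ᵇ 0))
      lap-rl i j hj rewrite ≡ᵇ-false {size S ℕ.+ i} {j} (λ e → <⇒≢ (≤-trans hj (m≤m+n (size S) i)) (≡.sym e)) = reflexive (≡.cong edge (adj-rl S T i hj))

      unit-off : ∀ i j → (if suc i ≡ᵇ j then nat (bool (suc i ≡ᵇ 0)) else 0#) ≈ 0#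
      unit-off i j with suc i ≡ᵇ j
      ... | true = refl
      ... | false = refl

      left-block : Δ (size S) (lap (S ◁ T)) ≈ full S + minor S
      left-block = trans (Δ-update (extra S) (lap (S ◁ T)) (lap S) 1#
          (trans (lap-ll 0 0 (s≤s z≤n) (s≤s z≤n)) (+-congˡ (+-identityʳ _)))
          (λ j hj → trans (lap-ll 0 (suc j) (s≤s z≤n) (s≤s hj)) (+-identityʳ _))
          (λ i j hi hj → trans (lap-ll (suc i) j (s≤s hi) hj) (trans (+-congˡ (unit-off i j)) (+-identityʳ _))))
        (+-congˡ (*-identityˡ _))

      right-block : Δ (size T) (λ i j → lap (S ◁ T) (size S ℕ.+ i) (size S ℕ.+ j)) ≈ full T + minor T
      right-block = trans (Δ-update (extra T) (λ i j → lap (S ◁ T) (size S ℕ.+ i) (size S ℕ.+ j)) (lap T) 1#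
          (trans (lap-rr 0 0) (+-congˡ (+-identityʳ _)))
          (λ j hj → trans (lap-rr 0 (suc j)) (+-identityʳ _))
          (λ i j hi hj → trans (lap-rr (suc i) j) (trans (+-congˡ (unit-off i j)) (+-identityʳ _))))
        (+-congˡ (*-identityˡ _))

      left-minor : Δ (extra S) (λ i j → lap (S ◁ T) (suc i) (suc j)) ≈ minor S
      left-minor = Δ-cong (extra S) λ i j hi hj →
        trans (lap-ll (suc i) (suc j) (s≤s hi) (s≤s hj)) (trans (+-congˡ (unit-off i (suc j))) (+-identityʳ _))

      right-minor : Δ (extra T) (λ i j → lap (S ◁ T) (size S ℕ.+ suc i) (size S ℕ.+ suc j)) ≈ minor T
      right-minor = Δ-cong (extra T) λ i j _ _ → trans (lap-rr (suc i) (suc j)) (trans (+-congˡ (unit-off i (suc j))) (+-identityʳ _))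

      beyond : ∀ {i j} → i < size S → size S ≤ j → lap (S ◁ T) i j ≈ edge ((i ≡ᵇ 0) ∧ (j ℕ.∸ size S ≡ᵇ 0))
      beyond {i} {j} hi hj = ≡.subst (λ k → lap (S ◁ T) i k ≈ edge ((i ≡ᵇ 0) ∧ (j ℕ.∸ size S ≡ᵇ 0)))
        (ℕₚ.m+[n∸m]≡n hj) (lap-lr i (j ℕ.∸ size S) hi)

      below : ∀ {i j} → size S ≤ i → j < size S → lap (S ◁ T) i j ≈ edge ((j ≡ᵇ 0) ∧ (i ℕ.∸ size S ≡ᵇ 0))
      below {i} {j} hi hj = ≡.subst (λ k → lap (S ◁ T) k j ≈ edge ((j ≡ᵇ 0) ∧ (i ℕ.∸ size S ≡ᵇ 0)))
        (ℕₚ.m+[n∸m]≡n hi) (lap-rl (i ℕ.∸ size S) j hj)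

      positive : ∀ {j} → size S < j → (j ℕ.∸ size S ≡ᵇ 0) ≡ false
      positive {j} hj = ≡ᵇ-false (λ e → <⇒≢ (ℕₚ.m<n⇒0<n∸m hj) (≡.sym e))

      edge-false : ∀ c {b} → b ≡ false → edge (c ∧ b) ≈ 0#
      edge-false false ≡.refl = refl
      edge-false true ≡.refl = refl

      coupled : Coupled (size S) (lap (S ◁ T))
      coupled = record
        { upper = λ i j hi hj → trans (beyond hi (ℕₚ.<⇒≤ hj)) (edge-false (i ≡ᵇ 0) (positive hj))
        ; upperCol = λ i hi → trans (beyond hi ≤-refl) refl
        ; lower = λ i j hi hj → trans (below (ℕₚ.<⇒≤ hi) hj) (edge-false (j ≡ᵇ 0) (positive hi))
        ; lowerRow = λ j hj → trans (below ≤-refl hj) refl }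

      -- The bridge raises the degree of both roots, which gives the two factors, and its two
      -- entries -1 contribute the product of the minors with negative sign.
      full-◁ : full (S ◁ T) + minor S * minor T ≈ (full S + minor S) * (full T + minor T)
      full-◁ = begin
        full (S ◁ T) + minor S * minor T
          ≈⟨ +-congˡ (trans (sym (*-identityˡ _)) (*-cong corner (*-cong (sym left-minor) (sym right-minor)))) ⟩
        full (S ◁ T) + lap (S ◁ T) 0 (size S) * lap (S ◁ T) (size S) 0
            * (Δ (extra S) (λ i j → lap (S ◁ T) (suc i) (suc j)) * Δ (extra T) (λ i j → lap (S ◁ T) (size S ℕ.+ suc i) (size S ℕ.+ suc j)))
          ≈⟨ Δ-coupled (extra S) (extra T) (lap (S ◁ T)) coupled ⟩
        Δ (size S) (lap (S ◁ T)) * Δ (size T) (λ i j → lap (S ◁ T) (size S ℕ.+ i) (size S ℕ.+ j))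
          ≈⟨ *-cong left-block right-block ⟩
        (full S + minor S) * (full T + minor T) ∎
        where
        corner : 1# ≈ lap (S ◁ T) 0 (size S) * lap (S ◁ T) (size S) 0
        corner = trans (sym -1*-1) (*-cong
          (sym (trans (beyond (s≤s z≤n) ≤-refl) (reflexive (≡.cong edge (≡.cong (_≡ᵇ 0) (ℕₚ.n∸n≡0 (extra S)))))))
          (sym (trans (below ≤-refl (s≤s z≤n)) (reflexive (≡.cong edge (≡.cong (_≡ᵇ 0) (ℕₚ.n∸n≡0 (extra S))))))))

      -- Deleting the root of S cuts the bridge, but T keeps the extra degree at its root.
      minor-◁ : minor (S ◁ T) ≈ minor S * (full T + minor T)
      minor-◁ = trans (Δ-block (extra S) (size T) (λ i j → lap (S ◁ T) (suc i) (suc j))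
          λ i j hi hj → beyond (s≤s hi) (s≤s hj))
        (*-cong left-minor right-block)

    -- K n belongs to the path on n vertices with both ends grounded, i.e. the cycle with one vertex removed.
    y : Carrier
    y = x + nat 2

    tri : ℕ → ℕ → Carrier
    tri i j = if i ≡ᵇ j then y else edge ((suc i ≡ᵇ j) ∨ (i ≡ᵇ suc j))

    K : ℕ → Carrier
    K n = Δ n tri

    tri-far : ∀ i j → suc i < j → tri i j ≈ 0#
    tri-far zero (suc (suc j)) _ = refl
    tri-far zero (suc zero) (s≤s ())
    tri-far (suc i) (suc j) (s≤s h) = tri-far i j h

    tri-far′ : ∀ i j → suc j < i → tri i j ≈ 0#
    tri-far′ (suc (suc i)) zero _ = refl
    tri-far′ (suc zero) zero (s≤s ())
    tri-far′ (suc i) (suc j) (s≤s h) = tri-far′ i j h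

    tri-up : ∀ i → tri i (suc i) ≈ -1#
    tri-up zero = refl
    tri-up (suc i) = tri-up i

    tri-down : ∀ i → tri (suc i) i ≈ -1#
    tri-down zero = refl
    tri-down (suc i) = tri-down i

    K-step : ∀ n → K (suc (suc n)) + K n ≈ y * K (suc n)
    K-step n = begin
      K (suc (suc n)) + K n
        ≈⟨ +-congˡ (trans (sym (*-identityˡ _)) (*-cong (sym -1*-1) (sym (*-identityˡ _)))) ⟩
      K (suc (suc n)) + -1# * -1# * (1# * K n)
        ≈⟨ Δ-coupled 0 n tri (record { upper = λ { zero j (s≤s h) hj → tri-far 0 j hj } ; upperCol = λ { i (s≤s ()) }
             ; lower = λ { i zero hi h → tri-far′ i 0 hi ; i (suc j) _ (s≤s ()) } ; lowerRow = λ { j (s≤s ()) } }) ⟩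
      Δ 1 tri * K (suc n)
        ≈⟨ *-congʳ (solve 1 (λ y → con 1 :* y :* con 1 :+ con 0 := y) refl y) ⟩
      y * K (suc n) ∎

    -- `K` and `s` obey the same three-term recurrence, so two consecutive values are proved
    -- together.
    K-s : ∀ n → K n ≈ s (suc n) × K (suc n) ≈ s (suc (suc n))
    K-s zero = sym (+-identityˡ _) ,
      solve 1 (λ x → con 1 :* (x :+ (con 1 :+ (con 1 :+ con 0))) :* con 1 :+ con 0 := con 0 :+ con 1 :+ (con 1 :+ x :* (con 0 :+ con 1))) refl x
    K-s (suc n) with K-s n
    ... | e , e′ = e′ , +-cancelʳ (K n) _ _ (trans (K-step n) (trans (*-congˡ e′)
      (trans (solve 3 (λ x s p → (x :+ (con 1 :+ (con 1 :+ con 0))) :* (s :+ p :+ (p :+ x :* (s :+ p)))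
          := s :+ p :+ (p :+ x :* (s :+ p)) :+ (p :+ x :* (s :+ p) :+ x :* (s :+ p :+ (p :+ x :* (s :+ p)))) :+ (s :+ p)) refl x (s n) (p n))
        (+-congˡ (sym e)))))

    Δ-lower : ∀ n m → (∀ i j → i < j → m i j ≈ 0#) → (∀ i → m i i ≈ -1#) → Δ n m ≈ sgn n
    Δ-lower zero m z d = refl
    Δ-lower (suc n) m z d = begin
      Δ (suc n) m
        ≈⟨ Δ-block 1 n m (λ i j hi hj → z i j (≤-trans hi hj)) ⟩
      (1# * m 0 0 * 1# + 0#) * Δ n (λ i j → m (suc i) (suc j))
        ≈⟨ *-cong (trans (solve 1 (λ m → con 1 :* m :* con 1 :+ con 0 := m) refl (m 0 0)) (d 0))
             (Δ-lower n (λ i j → m (suc i) (suc j)) (λ i j h → z (suc i) (suc j) (s≤s h)) (λ i → d (suc i))) ⟩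
      -1# * sgn n
        ≈⟨ sym (sgn-suc n) ⟩
      sgn (suc n) ∎

    Δ-upper : ∀ n m → (∀ i j → j < i → m i j ≈ 0#) → (∀ i → m i i ≈ -1#) → Δ n m ≈ sgn n
    Δ-upper zero m z d = refl
    Δ-upper (suc n) m z d = begin
      Δ (suc n) m
        ≈⟨ +-congˡ (∑<-zero n λ j hj → x*y*0 _ _ (Δ-singular n 0 _ (≤-trans (s≤s z≤n) hj) λ { i .0 _ _ z≤n → z (suc i) 0 (s≤s z≤n) })) ⟩
      1# * m 0 0 * Δ n (λ i j → m (suc i) (suc j)) + 0#
        ≈⟨ +-congʳ (*-cong (*-congˡ (d 0)) (Δ-upper n (λ i j → m (suc i) (suc j)) (λ i j h → z (suc i) (suc j) (s≤s h)) (λ i → d (suc i)))) ⟩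
      1# * -1# * sgn n + 0#
        ≈⟨ solve 2 (λ a b → con 1 :* a :* b :+ con 0 := a :* b) refl -1# (sgn n) ⟩
      -1# * sgn n
        ≈⟨ sym (sgn-suc n) ⟩
      sgn (suc n) ∎

    private
      zero-corner : (ℕ → ℕ → Carrier) → ℕ → ℕ → Carrier
      zero-corner m zero zero = 0#
      zero-corner m zero (suc j) = m zero (suc j)
      zero-corner m (suc i) j = m (suc i) j

      -- Column 0 has the entry -1 at both ends and zeros in between. Splitting off the upper entry
      -- by linearity leaves one nonzero entry in the last row; for the cycle, one of the two minors
      -- is triangular and the other tridiagonal.
      Δ-ends : ∀ n m → (∀ i → suc i < suc n → m (suc i) 0 ≈ 0#) → m 0 0 ≈ -1# → m (suc n) 0 ≈ -1# →
        Δ (suc (suc n)) m ≈ sgn (suc n) * -1# * Δ (suc n) (λ i j → m i (suc j)) + -1# * Δ (suc n) (λ i j → m (suc i) (suc j))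
      Δ-ends n m z first final = trans
        (Δ-update (suc n) m (zero-corner m) -1# (trans first (sym (+-identityˡ _))) (λ _ _ → refl) (λ _ _ _ _ → refl))
        (+-congʳ (trans (Δ-lastRow (suc n) (zero-corner m) λ { zero _ → refl ; (suc i) hi → z i hi })
          (*-cong (*-congˡ final) (Δ-cong (suc n) {λ i j → zero-corner m i (suc j)} {λ i j → m i (suc j)} λ { zero j _ _ → refl ; (suc i) j _ _ → refl }))))

    lap-cyc-inner : ∀ i j → i < G → j < G → lap cyc (suc i) (suc j) ≈ tri i j
    lap-cyc-inner i j hi hj with i ≡ᵇ j
    ... | true = +-congˡ (reflexive (≡.cong nat (deg-cyc (s≤s hi))))
    ... | false = reflexive (≡.cong edge (≡.trans (≡.cong₂ _∨_ (bounded j i hj) (bounded i j hi)) (reorder j i)))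
      where
      bounded : ∀ a b → a < G → (suc a ≡ᵇ next (suc b)) ≡ (a ≡ᵇ suc b)
      bounded a b ha with suc b ≡ᵇ last in e
      ... | false = ≡.refl
      ... | true = ≡.sym (≡ᵇ-false {a} {suc b} λ { ≡.refl → ℕₚ.<-irrefl (≡ᵇ-true {suc b} e) ha })
      reorder : ∀ a b → (a ≡ᵇ suc b) ∨ (b ≡ᵇ suc a) ≡ (suc b ≡ᵇ a) ∨ (b ≡ᵇ suc a)
      reorder a b = ≡.cong (_∨ (b ≡ᵇ suc a)) (≡ᵇ-sym a (suc b))

    rim : ℕ → Carrier
    rim j = edge ((j ≡ᵇ 0) ∨ (j ≡ᵇ suc h))

    circulant : ℕ → ℕ → Carrier
    circulant zero zero = y
    circulant zero (suc j) = rim j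
    circulant (suc i) zero = rim i
    circulant (suc i) (suc j) = tri i j

    rim-mid : ∀ j → j < h → rim (suc j) ≈ 0#
    rim-mid j hj = reflexive (≡.cong edge (≡ᵇ-false (<⇒≢ hj)))

    rim-last : rim (suc h) ≈ -1#
    rim-last = reflexive (≡.cong edge (≡ᵇ-refl h))

    lap-circulant : ∀ i j → i < suc G → j < suc G → lap cyc i j ≈ circulant i j
    lap-circulant zero zero _ _ = +-congˡ (reflexive (≡.cong nat (deg-cyc (s≤s z≤n))))
    lap-circulant zero (suc j) _ _ = reflexive (≡.cong (λ b → edge ((j ≡ᵇ 0) ∨ b)) (wraps j))
      where
      wraps : ∀ j → (0 ≡ᵇ next (suc j)) ≡ (j ≡ᵇ suc h)
      wraps j with j ≡ᵇ suc h
      ... | true = ≡.refl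
      ... | false = ≡.refl
    lap-circulant (suc i) zero hi hj = trans (reflexive (≡.cong edge (adj-sym cyc (suc i) 0))) (lap-circulant zero (suc i) hj hi)
    lap-circulant (suc i) (suc j) (s≤s hi) (s≤s hj) = lap-cyc-inner i j hi hj

    minor-cyc : minor cyc ≈ s (suc G)
    minor-cyc = trans (Δ-cong G lap-cyc-inner) (proj₁ (K-s G))

    -- Row 0 contributes y times the path with both ends grounded, and its two entries -1 contribute
    -- -(1 + s G) each. The result (x+2) s(G+1) - 2 s(G) - 2 becomes nonnegative through s(G+1) =
    -- s(G) + p(G) and p(G) = 1 + x t(G).
    full-cyc : full cyc ≈ x * s (suc G) + x * (t G + t G)
    full-cyc = +-cancelʳ ((1# + s G) + (1# + s G)) _ _ (begin
      full cyc + ((1# + s G) + (1# + s G))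
        ≈⟨ +-congʳ (trans (Δ-cong (suc G) lap-circulant) (+-cong (*-congˡ (proj₁ (K-s G))) ends)) ⟩
      1# * y * s (suc G) + (e * (1# + s G) + e * (1# + s G)) + ((1# + s G) + (1# + s G))
        ≈⟨ solve 4 (λ y g e u → con 1 :* y :* g :+ (e :* u :+ e :* u) :+ (u :+ u) := y :* g :+ (e :+ con 1) :* (u :+ u)) refl y (s (suc G)) e (1# + s G) ⟩
      y * s (suc G) + (e + 1#) * ((1# + s G) + (1# + s G))
        ≈⟨ +-congˡ (trans (*-congʳ (-‿inverseˡ 1#)) (zeroˡ _)) ⟩
      y * s (suc G) + 0#
        ≈⟨ solve 3 (λ x s p → (x :+ (con 1 :+ (con 1 :+ con 0))) :* (s :+ p) :+ con 0 := x :* (s :+ p) :+ (p :+ p) :+ (s :+ s)) refl x (s G) (p G) ⟩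
      x * s (suc G) + (p G + p G) + (s G + s G)
        ≈⟨ +-congʳ (+-congˡ (+-cong (p-t G) (p-t G))) ⟩
      x * s (suc G) + ((1# + x * t G) + (1# + x * t G)) + (s G + s G)
        ≈⟨ solve 4 (λ x a t s → x :* a :+ ((con 1 :+ x :* t) :+ (con 1 :+ x :* t)) :+ (s :+ s)
             := x :* a :+ x :* (t :+ t) :+ ((con 1 :+ s) :+ (con 1 :+ s))) refl x (s (suc G)) (t G) (s G) ⟩
      x * s (suc G) + x * (t G + t G) + ((1# + s G) + (1# + s G)) ∎)
      where
      e σ : Carrier
      e = -1#
      σ = sgn (suc h)
      Kh : K (suc h) ≈ s G
      Kh = proj₂ (K-s h)
      term : ℕ → Carrier
      term j = sgn (suc j) * rim j * Δ G (λ i k → circulant (suc i) (pun (suc j) k))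
      vanish : ∀ i → suc i < suc h → rim (suc i) ≈ 0#
      vanish i (s≤s hi) = rim-mid i hi
      first : term 0 ≈ e * (1# + s G)
      first = begin
        e * e * Δ G (λ i k → circulant (suc i) (pun 1 k))
          ≈⟨ *-cong -1*-1 (Δ-ends h (λ i k → circulant (suc i) (pun 1 k)) vanish refl rim-last) ⟩
        1# * (σ * e * Δ (suc h) (λ i j → tri i (suc j)) + e * K (suc h))
          ≈⟨ *-congˡ (+-cong (*-congˡ (Δ-lower (suc h) (λ i j → tri i (suc j)) (λ i j hij → tri-far i (suc j) (s≤s hij)) tri-up)) (*-congˡ Kh)) ⟩
        1# * (σ * e * σ + e * s G)
          ≈⟨ solve 3 (λ σ e g → con 1 :* (σ :* e :* σ :+ e :* g) := e :* (σ :* σ :+ g)) refl σ e (s G) ⟩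
        e * (σ * σ + s G)
          ≈⟨ *-congˡ (+-congʳ (sgn-sq (suc h))) ⟩
        e * (1# + s G) ∎
      final : term (suc h) ≈ e * (1# + s G)
      final = begin
        sgn (suc (suc h)) * rim (suc h) * Δ G (λ i k → circulant (suc i) (pun (suc (suc h)) k))
          ≈⟨ *-cong (*-cong (sgn-suc (suc h)) rim-last) (trans
               (Δ-cong G λ i k _ hk → reflexive (≡.cong (circulant (suc i)) (pun-below hk)))
               (Δ-ends h (λ i k → circulant (suc i) k) vanish refl rim-last)) ⟩
        e * σ * e * (σ * e * K (suc h) + e * Δ (suc h) (λ i j → tri (suc i) j))
          ≈⟨ *-congˡ (+-cong (*-congˡ Kh) (*-congˡ (Δ-upper (suc h) (λ i j → tri (suc i) j) (λ i j hij → tri-far′ (suc i) j (s≤s hij)) tri-down))) ⟩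
        e * σ * e * (σ * e * s G + e * σ)
          ≈⟨ solve 3 (λ σ e g → e :* σ :* e :* (σ :* e :* g :+ e :* σ) := (e :* e) :* (σ :* σ) :* (e :* (con 1 :+ g))) refl σ e (s G) ⟩
        (e * e) * (σ * σ) * (e * (1# + s G))
          ≈⟨ trans (*-congʳ (trans (*-cong -1*-1 (sgn-sq (suc h))) (*-identityˡ 1#))) (*-identityˡ _) ⟩
        e * (1# + s G) ∎
      ends : ∑< G term ≈ e * (1# + s G) + e * (1# + s G)
      ends = +-cong first (trans (reflexive (≡.cong (λ n → ∑< n (λ j → term (suc j))) (ℕₚ.+-comm 1 h)))
        (trans (∑<-split h 1 (λ j → term (suc j)))
          (trans (+-cong (∑<-zero h λ j hj → x*0*y _ _ (rim-mid j hj)) (trans (+-identityʳ _) (reflexive (≡.cong (λ n → term (suc n)) (ℕₚ.+-identityʳ h)))))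
            (trans (+-identityˡ _) final))))

    full≈A : ∀ {b} (T : Tree b) → full T ≈ A ⟦ T ⟧
    minor≈B : ∀ {b} (T : Tree b) → minor T ≈ B ⟦ T ⟧
    full≈A leaf = solve 1 (λ x → con 1 :* (x :+ con 0) :* con 1 :+ con 0 := x :* con 1 :+ con 0) refl x
    full≈A cyc = full-cyc
    full≈A (S ◁ T) = +-cancelʳ (B ⟦ S ⟧ * B ⟦ T ⟧) _ _ (trans
      (+-congˡ (*-cong (sym (minor≈B S)) (sym (minor≈B T))))
      (trans (Join.full-◁ S T) (trans (*-cong (+-cong (full≈A S) (minor≈B S)) (+-cong (full≈A T) (minor≈B T)))
        (solve 5 (λ x d b d′ b′ →
          let a′ = x :* b′ :+ d′
          in (x :* b :+ d :+ b) :* (a′ :+ b′) := x :* (b :* (a′ :+ b′)) :+ (d :* (a′ :+ b′) :+ b :* a′) :+ b :* b′)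
          refl x (D ⟦ S ⟧) (B ⟦ S ⟧) (D ⟦ T ⟧) (B ⟦ T ⟧)))))
    minor≈B leaf = refl
    minor≈B cyc = minor-cyc
    minor≈B (S ◁ T) = trans (Join.minor-◁ S T) (*-cong (minor≈B S) (+-cong (full≈A T) (minor≈B T)))

-- From weights to Laplacian coefficients.

module Laplacian where

  open import Data.Nat as ℕ using (ℕ; zero; suc; z≤n; s≤s; _∸_; _⊔_)
  import Data.Nat.Properties as ℕₚ
  open import Data.Integer using (ℤ; +_; -_; _+_; _*_; _≤_; _<_; +≤+; +<+)
  open import Data.Integer.Properties
  open import Data.Integer.Tactic.RingSolver using (solve-∀)
  open import Data.Bool using (Bool; true; false; if_then_else_)
  open import Data.Fin as Fin using (Fin; toℕ; punchIn) renaming (zero to fzero; suc to fsuc)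
  import Data.Fin.Properties as Finₚ
  open import Data.List using ([]; _∷_; length)
  open import Data.List.Properties using (length-map)
  open import Data.Product using (Σ; _×_; _,_; proj₁; proj₂)
  open import Data.Empty using (⊥-elim)
  open import Function using (_∘_; Inverse)
  open import Relation.Binary.PropositionalEquality
  open import Relation.Nullary using (yes; no; contradiction)
  open import Relation.Nullary.Decidable using (⌊_⌋)
  open import Defs
  open PolyRing
  open FinPerm
  open Determinant
  open BlockDeterminant
  open Weights
  open Trees
  open Adjacency
  open TreeDeterminant

  -- Being nonzero is recorded as a positive value at x = 4. Evaluation is a ring homomorphism, so
  -- closure under products is immediate, and on alternating polynomials a positive value yields a
  -- positive coefficient.
  polyCone : Cone
  polyCone = record
    { R = polyRing
    ; N = Alternating 0
    ; P = λ p → Alternating 0 p × + 0 < ev p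
    ; N-resp = alternating-resp
    ; P-resp = λ e (n , h) → alternating-resp e n , subst (+ 0 <_) (ev-cong e) h
    ; N-0 = λ k → subst (+ 0 ≤_) (sym (*-zeroʳ (signℤ k))) ≤-refl
    ; N-+ = λ {p} {q} → alternating-+ {0} {p} {q}
    ; N-* = λ {p} {q} → alternating-* 0 0 p q
    ; P⇒N = proj₁
    ; P-1 = (λ { zero → +≤+ z≤n ; (suc k) → subst (+ 0 ≤_) (sym (*-zeroʳ (signℤ (suc k)))) ≤-refl }) , +<+ (s≤s z≤n)
    ; P-+ = λ {p} {q} (n , h) n′ → alternating-+ {0} {p} {q} n n′ ,
        subst (+ 0 <_) (sym (ev-+ p q)) (+-mono-<-≤ h (subst (+ 0 ≤_) (*-identityˡ (ev q)) (ev-nonneg 0 q n′)))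
    ; P-* = λ {p} {q} (n , h) (n′ , h′) → alternating-* 0 0 p q n n′ , subst (+ 0 <_) (sym (ev-* p q)) (0<* h h′)
    ; x = negP varP
    ; P-x = (λ { zero → ≤-refl ; (suc zero) → +≤+ z≤n ; (suc (suc k)) → subst (+ 0 ≤_) (sym (*-zeroʳ (signℤ k))) ≤-refl }) , +<+ (s≤s z≤n)
    }
    where
    alternating-resp : ∀ {p q} → p ≈P q → Alternating 0 p → Alternating 0 q
    alternating-resp e n k = subst (λ c → + 0 ≤ signℤ k * c) (at e k) (n k)

  sumFin-cong : ∀ {n} {f g : Fin n → ℕ} → (∀ i → f i ≡ g i) → sumFin f ≡ sumFin g
  sumFin-cong {zero} e = refl
  sumFin-cong {suc n} e = cong₂ ℕ._+_ (e fzero) (sumFin-cong (e ∘ fsuc))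

  countFin-cong : ∀ {n} {f g : Fin n → Bool} → (∀ i → f i ≡ g i) → countFin f ≡ countFin g
  countFin-cong e = sumFin-cong λ i → cong bool (e i)

  sumFin-act : ∀ {n} (π : Code n) (f : Fin n → ℕ) → sumFin (f ∘ act π) ≡ sumFin f
  sumFin-act idle f = refl
  sumFin-act swp f = lemma (f (fsuc fzero)) (f fzero) _
    where
    lemma : ∀ a b c → a ℕ.+ (b ℕ.+ c) ≡ b ℕ.+ (a ℕ.+ c)
    lemma a b c = trans (sym (ℕₚ.+-assoc a b c)) (trans (cong (ℕ._+ c) (ℕₚ.+-comm a b)) (ℕₚ.+-assoc b a c))
  sumFin-act (lft π) f = cong (f fzero ℕ.+_) (sumFin-act π (f ∘ fsuc))
  sumFin-act (π ∙ ρ) f = trans (sumFin-act ρ (f ∘ act π)) (sumFin-act π f)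

  isoCode : ∀ {n} {G H : Graph n} (σ : G ≅ H) → Σ (Code n) λ π → ∀ i → act π i ≡ Inverse.to (proj₁ σ) i
  isoCode (σ , _) = encode (Inverse.to σ) λ {i} {j} e →
    trans (sym (Inverse.strictlyInverseʳ σ i)) (trans (cong (Inverse.from σ) e) (Inverse.strictlyInverseʳ σ j))

  sumFin-iso : ∀ {n} {G H : Graph n} (σ : G ≅ H) (f : Fin n → ℕ) → sumFin (f ∘ Inverse.to (proj₁ σ)) ≡ sumFin f
  sumFin-iso {G = G} {H} σ f with isoCode {G = G} {H} σ
  ... | π , e = trans (sumFin-cong λ i → cong f (sym (e i))) (sumFin-act π f)

  degree-iso : ∀ {n} {G H : Graph n} (σ : G ≅ H) i → degree G i ≡ degree H (Inverse.to (proj₁ σ) i)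
  degree-iso {G = G} {H} σ i = trans (countFin-cong (proj₂ σ i)) (sumFin-iso {G = G} {H} σ (λ j → bool (H (Inverse.to (proj₁ σ) i) j)))

  leafCount-iso : ∀ {n} {G H : Graph n} → G ≅ H → leafCount G ≡ leafCount H
  leafCount-iso {G = G} {H} σ = trans (countFin-cong λ i → cong (ℕ._≡ᵇ 1) (degree-iso {G = G} {H} σ i))
    (sumFin-iso {G = G} {H} σ (λ j → bool (degree H j ℕ.≡ᵇ 1)))

  open Determinants polyRing using (det-cong; det-permute; det-neg; sgn; -1#; Matrix; ∑) renaming (det to detR)
  open BlockDeterminants polyRing using (det-Δ)

  open Entries polyCone

  -- det (x I + L) for x = −λ
  lapMatrix : ∀ {n} → Graph n → Matrix n
  lapMatrix G i j = if ⌊ i Fin.≟ j ⌋ then negP varP +P nat (degree G i) else edge (G i j)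

  Phi : ∀ {n} → Graph n → Poly
  Phi G = detR (lapMatrix G)

  Phi-iso : ∀ {n} {G H : Graph n} → G ≅ H → Phi G ≈P Phi H
  Phi-iso {n} {G} {H} σ with isoCode {G = G} {H} σ
  ... | π , e = ≈trans (det-cong entries) (det-permute π (lapMatrix H))
    where
    to = Inverse.to (proj₁ σ)
    entries : ∀ i j → lapMatrix G i j ≈P lapMatrix H (act π i) (act π j)
    entries i j rewrite e i | e j with i Fin.≟ j | to i Fin.≟ to j
    ... | yes refl | yes _ = mk≈ λ k → cong (λ d → coeff (negP varP +P nat d) k) (degree-iso {G = G} {H} σ i)
    ... | yes refl | no ne = contradiction refl ne
    ... | no ne | yes eq = contradiction (trans (sym (Inverse.strictlyInverseʳ (proj₁ σ) i))
          (trans (cong (Inverse.from (proj₁ σ)) eq) (Inverse.strictlyInverseʳ (proj₁ σ) j))) ne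
    ... | no _ | no _ = mk≈ λ k → cong (λ b → coeff (edge b) k) (proj₂ σ i j)

  nat-const : ∀ d → nat d ≈P constP (+ d)
  nat-const zero = mk≈ λ { zero → refl ; (suc k) → refl }
  nat-const (suc d) = mk≈ λ k → trans (coeff-+ (constP (+ 1)) (nat d) k)
    (trans (cong (λ c → coeff (constP (+ 1)) k + c) (at (nat-const d) k)) (constants k))
    where
    constants : ∀ k → coeff (constP (+ 1)) k + coeff (constP (+ d)) k ≡ coeff (constP (+ suc d)) k
    constants zero = refl
    constants (suc k) = refl

  -- With x = -λ every entry of λI - L is -1 times that of xI + L. `det-frozen` identifies the
  -- expansion of the statement with the one over the bundled ring.
  charPoly-Phi : ∀ {n} (G : Graph n) → charPolyL G ≈P sgn n *P Phi G
  charPoly-Phi {n} G = ≈trans (det-frozen {n} (λ i j → (if ⌊ i Fin.≟ j ⌋ then varP else []) +P constP (- laplacian G i j))) (≈trans (det-cong entries) (det-neg (lapMatrix G)))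
    where
    signP-sgn : ∀ k → signP k ≡ sgn k
    signP-sgn zero = refl
    signP-sgn (suc zero) = refl
    signP-sgn (suc (suc k)) = signP-sgn k
    sum-frozen : ∀ {n} {f g : Fin n → Poly} → (∀ i → f i ≈P g i) → sumFinP f ≈P ∑ g
    sum-frozen {zero} e = ≈refl
    sum-frozen {suc n} e = +P-cong (e fzero) (sum-frozen (e ∘ fsuc))
    det-frozen : ∀ {n} (M : Matrix n) → det M ≈P detR M
    det-frozen {zero} M = ≈refl
    det-frozen {suc n} M = sum-frozen {f = λ j → signP (toℕ j) *P M fzero j *P det (λ i k → M (fsuc i) (punchIn j k))} λ j →
      *P-cong {signP (toℕ j) *P M fzero j} {sgn (toℕ j) *P M fzero j} (mk≈ λ k → cong (λ s → coeff (s *P M fzero j) k) (signP-sgn (toℕ j)))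
        (det-frozen (λ i k → M (fsuc i) (punchIn j k)))
    minus : ∀ p → -1# *P p ≈P negP p
    minus p = mk≈ λ k → trans (coeff-* (- + 1) [] p k) (trans (lemma (coeff p k) k) (sym (coeff-neg p k)))
      where
      zeros : ∀ k → coeff (shift []) k ≡ + 0
      zeros zero = refl
      zeros (suc k) = refl
      ring : ∀ c → - + 1 * c + + 0 ≡ - c
      ring c = trans (+-identityʳ _) (-1*i≡-i c)
      lemma : ∀ c k → - + 1 * c + coeff (shift ([] *P p)) k ≡ - c
      lemma c k = trans (cong (λ z → - + 1 * c + z) (zeros k)) (ring c)
    diag : ∀ d → varP +P constP (- + d) ≈P -1# *P (negP varP +P nat d)
    diag d = ≈sym (≈trans (minus (negP varP +P nat d)) (≈trans (negP-cong (+P-cong {negP varP} ≈refl (nat-const d)))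
      (mk≈ λ { zero → trans (cong -_ (+-identityˡ (+ d))) (sym (+-identityˡ (- + d))) ; (suc zero) → refl ; (suc (suc k)) → refl })))
    off : ∀ b → [] +P constP (- (if b then - + 1 else + 0)) ≈P -1# *P edge b
    off true = ≈sym (minus (constP (- + 1)))
    off false = ≈sym (≈trans (minus []) (mk≈ λ { zero → refl ; (suc k) → refl }))
    entries : ∀ i j → (if ⌊ i Fin.≟ j ⌋ then varP else []) +P constP (- laplacian G i j) ≈P -1# *P lapMatrix G i j
    entries i j with i Fin.≟ j
    ... | yes _ = diag (degree G i)
    ... | no _ = off (G i j)

  sgn-coeff : ∀ n p k → coeff (sgn n *P p) k ≡ signℤ n * coeff p k
  sgn-coeff n p k = trans (cong (λ s → coeff (s *P p) k) (const n)) (trans (coeff-* (signℤ n) [] p k)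
    (trans (cong (λ z → signℤ n * coeff p k + z) (zeros k)) (+-identityʳ _)))
    where
    const : ∀ n → sgn n ≡ constP (signℤ n)
    const zero = refl
    const (suc zero) = refl
    const (suc (suc n)) = const n
    zeros : ∀ k → coeff (shift []) k ≡ + 0
    zeros zero = refl
    zeros (suc k) = refl

  -- The signs (-1)^k and (-1)^n combine to (-1)^(n-k), the sign between powers of λ and of x. So
  -- c_k is the coefficient of x^(n-k) in `Phi`.
  lapCoeff-Phi : ∀ {n} (G : Graph n) k → k ℕ.≤ n → lapCoeff G k ≡ signℤ (n ∸ k) * coeff (Phi G) (n ∸ k)
  lapCoeff-Phi {n} G k k≤n = trans (cong (signℤ k *_) (trans (at (charPoly-Phi G) (n ∸ k)) (sgn-coeff n (Phi G) (n ∸ k))))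
    (trans (sym (*-assoc (signℤ k) (signℤ n) _)) (cong (_* coeff (Phi G) (n ∸ k)) signs))
    where
    signs : signℤ k * signℤ n ≡ signℤ (n ∸ k)
    signs = trans (cong (λ m → signℤ k * signℤ m) (sym (ℕₚ.m+[n∸m]≡n k≤n)))
      (trans (cong (signℤ k *_) (signℤ-+ k (n ∸ k))) (trans (sym (*-assoc (signℤ k) (signℤ k) _))
        (trans (cong (_* signℤ (n ∸ k)) (signℤ-sq k)) (*-identityˡ _))))

  length-+P : ∀ p q → length (p +P q) ≡ length p ⊔ length q
  length-+P [] q = refl
  length-+P (a ∷ p) [] = refl
  length-+P (a ∷ p) (b ∷ q) = cong suc (length-+P p q)

  length-*P : ∀ {a b} p q → length p ℕ.≤ suc a → length q ℕ.≤ suc b → length (p *P q) ℕ.≤ suc (a ℕ.+ b)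
  length-*P [] q _ _ = z≤n
  length-*P {a} {b} (c ∷ p) q (s≤s hp) hq = subst (ℕ._≤ suc (a ℕ.+ b)) (sym (length-+P (scale c q) (shift (p *P q))))
    (ℕₚ.⊔-lub (subst (ℕ._≤ suc (a ℕ.+ b)) (sym (length-map (c *_) q)) (ℕₚ.≤-trans hq (s≤s (ℕₚ.m≤n+m b a)))) (rest p hp))
    where
    rest : ∀ {a} p → length p ℕ.≤ a → suc (length (p *P q)) ℕ.≤ suc (a ℕ.+ b)
    rest [] _ = s≤s z≤n
    rest {suc a} (d ∷ p) hp = s≤s (length-*P (d ∷ p) q hp hq)

  length-∑ : ∀ {n m} (f : Fin n → Poly) → (∀ i → length (f i) ℕ.≤ m) → length (∑ f) ℕ.≤ m
  length-∑ {zero} f h = z≤n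
  length-∑ {suc n} {m} f h = subst (ℕ._≤ m) (sym (length-+P (f fzero) (∑ (f ∘ fsuc)))) (ℕₚ.⊔-lub (h fzero) (length-∑ (f ∘ fsuc) (h ∘ fsuc)))

  length-det : ∀ {n} (M : Matrix n) → (∀ i j → length (M i j) ℕ.≤ 2) → length (detR M) ℕ.≤ suc n
  length-det {zero} M h = ℕₚ.≤-refl
  length-det {suc n} M h = length-∑ {suc n} (λ j → sgn (toℕ j) *P M fzero j *P detR (λ i k → M (fsuc i) (punchIn j k))) λ j →
    length-*P {1} {n} (sgn (toℕ j) *P M fzero j) (detR (λ i k → M (fsuc i) (punchIn j k))) (length-*P {0} {1} (sgn (toℕ j)) (M fzero j) (length-sgn (toℕ j)) (h fzero j))
      (length-det (λ i k → M (fsuc i) (punchIn j k)) λ i k → h (fsuc i) (punchIn j k))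
    where
    length-sgn : ∀ k → length (sgn k) ℕ.≤ 1
    length-sgn zero = ℕₚ.≤-refl
    length-sgn (suc zero) = ℕₚ.≤-refl
    length-sgn (suc (suc k)) = length-sgn k

  -- A degree bound: `⪯` sees the coefficients up to n only, while `Alternating` speaks of all of
  -- them.
  length-Phi : ∀ {n} (G : Graph n) → length (Phi G) ℕ.≤ suc n
  length-Phi G = length-det (lapMatrix G) entries
    where
    length-nat : ∀ d → length (nat d) ℕ.≤ 1
    length-nat zero = z≤n
    length-nat (suc d) = subst (ℕ._≤ 1) (sym (length-+P (constP (+ 1)) (nat d))) (ℕₚ.⊔-lub ℕₚ.≤-refl (length-nat d))
    length-edge : ∀ b → length (edge b) ℕ.≤ 2
    length-edge true = s≤s z≤n
    length-edge false = z≤n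
    entries : ∀ i j → length (lapMatrix G i j) ℕ.≤ 2
    entries i j with i Fin.≟ j
    ... | yes _ = subst (ℕ._≤ 2) (sym (length-+P (negP varP) (nat (degree G i))))
          (ℕₚ.⊔-lub ℕₚ.≤-refl (ℕₚ.≤-trans (length-nat (degree G i)) (s≤s z≤n)))
    ... | no _ = length-edge (G i j)

  coeff-beyond : ∀ p k → length p ℕ.≤ k → coeff p k ≡ + 0
  coeff-beyond [] k _ = refl
  coeff-beyond (a ∷ p) (suc k) (s≤s h) = coeff-beyond p k h

  module _ {n} {G H : Graph n} where

    ⪯⇒alternating : G ⪯ H → Alternating 0 (Phi H +P negP (Phi G))
    ⪯⇒alternating le k = subst (+ 0 ≤_) (sym expand) (nonneg k)
      where
      a b : ℕ → ℤ
      a k = coeff (Phi G) k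
      b k = coeff (Phi H) k
      ring : ∀ s u v → s * (u + - v) ≡ s * u + - (s * v)
      ring = solve-∀
      expand : signℤ k * coeff (Phi H +P negP (Phi G)) k ≡ signℤ k * b k + - (signℤ k * a k)
      expand = trans (cong (signℤ k *_) (trans (coeff-+ (Phi H) (negP (Phi G)) k) (cong (λ c → b k + c) (coeff-neg (Phi G) k))))
        (ring (signℤ k) (b k) (a k))
      nonneg : ∀ k → + 0 ≤ signℤ k * b k + - (signℤ k * a k)
      nonneg k with k ℕ.≤? n
      ... | yes k≤n = i≤j⇒0≤j-i (subst₂ _≤_ (turn G) (turn H) (le (n ∸ k) (ℕₚ.m∸n≤m n k)))
        where
        turn : ∀ (G : Graph n) → lapCoeff G (n ∸ k) ≡ signℤ k * coeff (Phi G) k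
        turn G = trans (lapCoeff-Phi G (n ∸ k) (ℕₚ.m∸n≤m n k))
          (cong (λ j → signℤ j * coeff (Phi G) j) (ℕₚ.m∸[m∸n]≡n k≤n))
      ... | no k≰n = ≤-reflexive (sym (trans
              (cong₂ (λ u v → signℤ k * u + - (signℤ k * v)) (beyond H) (beyond G)) (+-inverseʳ (signℤ k * + 0))))
        where
        beyond : ∀ (G : Graph n) → coeff (Phi G) k ≡ + 0
        beyond G = coeff-beyond (Phi G) k (ℕₚ.≤-trans (length-Phi G) (ℕₚ.≰⇒> k≰n))

    private
      added : ∀ {δ} → Phi H ≈P Phi G +P δ → ∀ k → signℤ k * coeff (Phi H) k ≡ signℤ k * coeff (Phi G) k + signℤ k * coeff δ k
      added {δ} e k = trans (cong (signℤ k *_) (trans (at e k) (coeff-+ (Phi G) δ k))) (*-distribˡ-+ (signℤ k) _ _)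

    alternating⇒⪯ : ∀ {δ} → Alternating 0 δ → Phi H ≈P Phi G +P δ → G ⪯ H
    alternating⇒⪯ {δ} alt e k k≤n = subst₂ _≤_
      (trans (+-identityʳ _) (sym (lapCoeff-Phi G k k≤n)))
      (trans (sym (added e (n ∸ k))) (sym (lapCoeff-Phi H k k≤n)))
      (+-monoʳ-≤ (signℤ (n ∸ k) * coeff (Phi G) (n ∸ k)) (alt (n ∸ k)))

    positive⇒≺ : ∀ {δ} → Alternating 0 δ → + 0 < ev δ → Phi H ≈P Phi G +P δ → G ≺ H
    positive⇒≺ {δ} alt pos e with ev-positive 0 δ alt (subst (+ 0 <_) (sym (*-identityˡ (ev δ))) pos)
    ... | k , h with k ℕ.≤? n
    ... | yes k≤n = alternating⇒⪯ alt e , n ∸ k , ℕₚ.m∸n≤m n k , subst₂ _<_ (trans (+-identityʳ _) (turn G)) (trans (sym (added e k)) (turn H))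
          (+-monoʳ-< (signℤ k * coeff (Phi G) k) h)
      where
      turn : ∀ (G : Graph n) → signℤ k * coeff (Phi G) k ≡ lapCoeff G (n ∸ k)
      turn G = sym (trans (lapCoeff-Phi G (n ∸ k) (ℕₚ.m∸n≤m n k))
        (cong (λ j → signℤ j * coeff (Phi G) j) (ℕₚ.m∸[m∸n]≡n k≤n)))
    -- Beyond degree n both polynomials vanish, so the strict coefficient cannot lie there.
    ... | no k≰n = ⊥-elim (<-irrefl refl (subst (+ 0 <_) zero-diff h))
      where
      zero-coeff : ∀ (G : Graph n) → signℤ k * coeff (Phi G) k ≡ + 0
      zero-coeff G = trans (cong (signℤ k *_) (coeff-beyond (Phi G) k (ℕₚ.≤-trans (length-Phi G) (ℕₚ.≰⇒> k≰n)))) (*-zeroʳ (signℤ k))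
      zero-diff : signℤ k * coeff δ k ≡ + 0
      zero-diff = trans (sym (+-identityˡ _)) (trans (cong (_+ signℤ k * coeff δ k) (sym (zero-coeff G)))
        (trans (sym (added e k)) (zero-coeff H)))

  module Realize (h : ℕ) where
    open Sizes h
    open Adjacent h
    open WeightAlgebra polyCone using (A)
    open WeightAlgebra.Cycle polyCone h using (⟦_⟧)
    open TreeDeterminants polyCone h using (full≈A; lap)

    -- Meant for n = size T; the number of vertices is kept apart to avoid transports.
    Γ : ∀ n {b} (T : Tree b) → Graph n
    Γ n T i j = adj T (toℕ i) (toℕ j)

    degree-Γ : ∀ {n b} (T : Tree b) → n ≡ size T → ∀ i → degree (Γ n T) i ≡ deg T (toℕ i)
    degree-Γ T refl i = sumFin-toℕ (size T) (λ j → bool (adj T (toℕ i) j))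

    Phi-Γ : ∀ {n b} (T : Tree b) → n ≡ size T → Phi (Γ n T) ≈P A ⟦ T ⟧
    Phi-Γ T refl = ≈trans (det-Δ (lapMatrix (Γ (size T) T)) (lap T) entries) (full≈A T)
      where
      entries : ∀ i j → lapMatrix (Γ (size T) T) i j ≈P lap T (toℕ i) (toℕ j)
      entries i j with i Fin.≟ j
      ... | yes refl rewrite ≡ᵇ-refl (toℕ i) | degree-Γ T refl i = ≈refl
      ... | no ne rewrite ≡ᵇ-false {toℕ i} {toℕ j} (ne ∘ Finₚ.toℕ-injective) = ≈refl

-- Rooted graphs on arbitrary vertex types and insertion of a leaf.

module RootedGraphs where

  open import Data.Nat using (ℕ; suc; _≡ᵇ_)
  open import Data.Bool using (Bool; true; false; _∧_)
  open import Data.Bool.Properties using (∧-zeroʳ; ∧-identityʳ)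
  open import Data.Fin using (Fin; toℕ) renaming (zero to fzero; suc to fsuc)
  open import Data.Fin.Properties using (+↔⊎; toℕ-↑ˡ; toℕ-↑ʳ; toℕ<n; toℕ-injective)
  open import Data.Maybe using (Maybe; just; nothing)
  open import Data.Product using (Σ; _×_; _,_)
  open import Data.Sum using (_⊎_; inj₁; inj₂)
  open import Data.Sum.Function.Propositional using (_⊎-↔_)
  open import Data.Unit using (⊤; tt)
  open import Function using (_∘_; _↔_; Inverse; mk↔ₛ′)
  open import Function.Construct.Identity using (↔-id)
  open import Function.Construct.Symmetry using (↔-sym)
  open import Function.Construct.Composition using (_↔-∘_)
  open import Relation.Binary.PropositionalEquality
  open Trees
  open Adjacency

  -- Vertex types follow the shape of a tree, so that isomorphisms are given by cases without index
  -- arithmetic. The root is a Boolean predicate because it enters adjacency as a conjunction.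
  record Rooted : Set₁ where
    field
      V : Set
      E : V → V → Bool
      root : V → Bool
  open Rooted public

  infix 4 _≃_
  record _≃_ (A B : Rooted) : Set where
    field
      bij : V A ↔ V B
    to : V A → V B
    to = Inverse.to bij
    field
      E-pres : ∀ v w → E A v w ≡ E B (to v) (to w)
      root-pres : ∀ v → root A v ≡ root B (to v)
  open _≃_ public

  ≃-refl : ∀ {A} → A ≃ A
  ≃-refl = record { bij = ↔-id _ ; E-pres = λ _ _ → refl ; root-pres = λ _ → refl }

  ≃-trans : ∀ {A B C} → A ≃ B → B ≃ C → A ≃ C
  ≃-trans f g = record { bij = bij g ↔-∘ bij f
    ; E-pres = λ v w → trans (E-pres f v w) (E-pres g (to f v) (to f w))
    ; root-pres = λ v → trans (root-pres f v) (root-pres g (to f v)) }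

  ≃-sym : ∀ {A B} → A ≃ B → B ≃ A
  ≃-sym {A} {B} f = record { bij = ↔-sym (bij f)
    ; E-pres = λ v w → sym (trans (E-pres f (back v) (back w)) (cong₂ (E B) (there v) (there w)))
    ; root-pres = λ v → sym (trans (root-pres f (back v)) (cong (root B) (there v))) }
    where
    back : V B → V A
    back = Inverse.from (bij f)
    there : ∀ v → to f (back v) ≡ v
    there = Inverse.strictlyInverseˡ (bij f)

  join : Rooted → Rooted → Rooted
  V (join A B) = V A ⊎ V B
  E (join A B) (inj₁ a) (inj₁ a′) = E A a a′
  E (join A B) (inj₁ a) (inj₂ b) = root A a ∧ root B b
  E (join A B) (inj₂ b) (inj₁ a) = root A a ∧ root B b
  E (join A B) (inj₂ b) (inj₂ b′) = E B b b′
  root (join A B) (inj₁ a) = root A a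
  root (join A B) (inj₂ b) = false

  join-cong : ∀ {A A′ B B′} → A ≃ A′ → B ≃ B′ → join A B ≃ join A′ B′
  join-cong f g = record { bij = bij f ⊎-↔ bij g
    ; E-pres = λ { (inj₁ a) (inj₁ a′) → E-pres f a a′ ; (inj₁ a) (inj₂ b) → cong₂ _∧_ (root-pres f a) (root-pres g b)
                 ; (inj₂ b) (inj₁ a) → cong₂ _∧_ (root-pres f a) (root-pres g b) ; (inj₂ b) (inj₂ b′) → E-pres g b b′ }
    ; root-pres = λ { (inj₁ a) → root-pres f a ; (inj₂ b) → refl } }

  join-swap : ∀ {A B C} → join (join A B) C ≃ join (join A C) B
  join-swap = record
    { bij = mk↔ₛ′ exchange exchange exchange² exchange²
    ; E-pres = λ { (inj₁ (inj₁ _)) (inj₁ (inj₁ _)) → refl ; (inj₁ (inj₁ _)) (inj₁ (inj₂ _)) → refl ; (inj₁ (inj₁ _)) (inj₂ _) → refl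
                 ; (inj₁ (inj₂ _)) (inj₁ (inj₁ _)) → refl ; (inj₁ (inj₂ _)) (inj₁ (inj₂ _)) → refl ; (inj₁ (inj₂ _)) (inj₂ _) → refl
                 ; (inj₂ _) (inj₁ (inj₁ _)) → refl ; (inj₂ _) (inj₁ (inj₂ _)) → refl ; (inj₂ _) (inj₂ _) → refl }
    ; root-pres = λ { (inj₁ (inj₁ _)) → refl ; (inj₁ (inj₂ _)) → refl ; (inj₂ _) → refl } }
    where
    exchange : ∀ {X Y Z : Set} → (X ⊎ Y) ⊎ Z → (X ⊎ Z) ⊎ Y
    exchange (inj₁ (inj₁ x)) = inj₁ (inj₁ x)
    exchange (inj₁ (inj₂ y)) = inj₂ y
    exchange (inj₂ z) = inj₁ (inj₂ z)
    exchange² : ∀ {X Y Z : Set} (v : (X ⊎ Y) ⊎ Z) → exchange (exchange v) ≡ v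
    exchange² (inj₁ (inj₁ x)) = refl
    exchange² (inj₁ (inj₂ y)) = refl
    exchange² (inj₂ z) = refl

  -- Adds one vertex whose neighbours are given by e; with e = `same T p` this is a leaf attached to
  -- p.
  grow : (A : Rooted) → (V A → Bool) → Rooted
  V (grow A e) = Maybe (V A)
  E (grow A e) nothing nothing = false
  E (grow A e) nothing (just v) = e v
  E (grow A e) (just v) nothing = e v
  E (grow A e) (just v) (just w) = E A v w
  root (grow A e) nothing = false
  root (grow A e) (just v) = root A v

  module RootedTrees (h : ℕ) where
    open Sizes h
    open Adjacent h

    g : ℕ
    g = suc last

    ⟪_⟫ : ∀ {b} → Tree b → Rooted
    ⟪ leaf ⟫ = record { V = ⊤ ; E = λ _ _ → false ; root = λ _ → true }
    ⟪ cyc ⟫ = record { V = Fin g ; E = λ i j → adj cyc (toℕ i) (toℕ j) ; root = λ i → toℕ i ≡ᵇ 0 }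
    ⟪ S ◁ T ⟫ = join ⟪ S ⟫ ⟪ T ⟫

    ⟪⟫-~ : ∀ {b} {S T : Tree b} → S ~ T → ⟪ S ⟫ ≃ ⟪ T ⟫
    ⟪⟫-~ ~refl = ≃-refl
    ⟪⟫-~ (~sym e) = ≃-sym (⟪⟫-~ e)
    ⟪⟫-~ (~trans e f) = ≃-trans (⟪⟫-~ e) (⟪⟫-~ f)
    ⟪⟫-~ (~cong e f) = join-cong (⟪⟫-~ e) (⟪⟫-~ f)
    ⟪⟫-~ ~swap = join-swap

    numbered : ∀ {b} → Tree b → Rooted
    numbered T = record { V = Fin (size T) ; E = λ i j → adj T (toℕ i) (toℕ j) ; root = λ i → toℕ i ≡ᵇ 0 }

    numbered-join : ∀ {b} (S : Tree b) T → join (numbered S) (numbered T) ≃ numbered (S ◁ T)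
    numbered-join S T = record
      { bij = ↔-sym (+↔⊎ {size S} {size T})
      ; E-pres = λ { (inj₁ a) (inj₁ b) → sym (trans (cong₂ (adj (S ◁ T)) (toℕ-↑ˡ a (size T)) (toℕ-↑ˡ b (size T))) (adj-ll S T (toℕ<n a) (toℕ<n b)))
                   ; (inj₁ a) (inj₂ b) → sym (trans (cong₂ (adj (S ◁ T)) (toℕ-↑ˡ a (size T)) (toℕ-↑ʳ (size S) b)) (adj-lr S T (toℕ b) (toℕ<n a)))
                   ; (inj₂ b) (inj₁ a) → sym (trans (cong₂ (adj (S ◁ T)) (toℕ-↑ʳ (size S) b) (toℕ-↑ˡ a (size T))) (adj-rl S T (toℕ b) (toℕ<n a)))
                   ; (inj₂ a) (inj₂ b) → sym (trans (cong₂ (adj (S ◁ T)) (toℕ-↑ʳ (size S) a) (toℕ-↑ʳ (size S) b)) (adj-rr S T (toℕ a) (toℕ b))) }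
      ; root-pres = λ { (inj₁ a) → cong (_≡ᵇ 0) (sym (toℕ-↑ˡ a (size T))) ; (inj₂ b) → sym (cong (_≡ᵇ 0) (toℕ-↑ʳ (size S) b)) } }

    number : ∀ {b} (T : Tree b) → ⟪ T ⟫ ≃ numbered T
    number leaf = record { bij = mk↔ₛ′ (λ _ → fzero) (λ _ → tt) (λ { fzero → refl ; (fsuc ()) }) (λ _ → refl)
      ; E-pres = λ _ _ → refl ; root-pres = λ _ → refl }
    number cyc = ≃-refl
    number (S ◁ T) = ≃-trans (join-cong (number S) (number T)) (numbered-join S T)

    same : ∀ {b} (T : Tree b) → V ⟪ T ⟫ → V ⟪ T ⟫ → Bool
    same leaf _ _ = true
    same cyc i j = toℕ i ≡ᵇ toℕ j
    same (S ◁ T) (inj₁ a) (inj₁ a′) = same S a a′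
    same (S ◁ T) (inj₂ b) (inj₂ b′) = same T b b′
    same (S ◁ T) _ _ = false

    same-refl : ∀ {b} (T : Tree b) v → same T v v ≡ true
    same-refl leaf v = refl
    same-refl cyc i = ≡ᵇ-refl (toℕ i)
    same-refl (S ◁ T) (inj₁ a) = same-refl S a
    same-refl (S ◁ T) (inj₂ b) = same-refl T b

    same-true : ∀ {b} (T : Tree b) v w → same T v w ≡ true → v ≡ w
    same-true leaf v w _ = refl
    same-true cyc i j e = toℕ-injective (≡ᵇ-true e)
    same-true (S ◁ T) (inj₁ a) (inj₁ a′) e = cong inj₁ (same-true S a a′ e)
    same-true (S ◁ T) (inj₂ b) (inj₂ b′) e = cong inj₂ (same-true T b b′ e)

    -- At `cyc` the position is ignored and the leaf goes to u_1, so the result is the intended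
    -- graph only under `OffCycle`.
    insert : ∀ {b} (T : Tree b) → V ⟪ T ⟫ → Tree b
    insert leaf _ = leaf ◁ leaf
    insert cyc _ = cyc ◁ leaf
    insert (S ◁ T) (inj₁ a) = insert S a ◁ T
    insert (S ◁ T) (inj₂ b) = S ◁ insert T b

    -- All vertices where a leaf may be attached: everything but u_2, ..., u_g, and thus including
    -- u_1.
    OffCycle : ∀ {b} (T : Tree b) → V ⟪ T ⟫ → Set
    OffCycle leaf _ = ⊤
    OffCycle cyc i = i ≡ fzero
    OffCycle (S ◁ T) (inj₁ a) = OffCycle S a
    OffCycle (S ◁ T) (inj₂ b) = OffCycle T b

    offCycle : (T : Tree false) (v : V ⟪ T ⟫) → OffCycle T v
    offCycle leaf v = tt
    offCycle (S ◁ T) (inj₁ a) = offCycle S a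
    offCycle (S ◁ T) (inj₂ b) = offCycle T b

    cyclePos : (T : Tree true) → Fin g → V ⟪ T ⟫
    cyclePos cyc i = i
    cyclePos (S ◁ T) i = inj₁ (cyclePos S i)

    offCycle? : (T : Tree true) (v : V ⟪ T ⟫) → OffCycle T v ⊎ Σ (Fin g) λ i → toℕ i ≢ 0 × v ≡ cyclePos T i
    offCycle? cyc fzero = inj₁ refl
    offCycle? cyc (fsuc i) = inj₂ (fsuc i , (λ ()) , refl)
    offCycle? (S ◁ T) (inj₂ b) = inj₁ (offCycle T b)
    offCycle? (S ◁ T) (inj₁ a) with offCycle? S a
    ... | inj₁ ok = inj₁ ok
    ... | inj₂ (i , i≢0 , e) = inj₂ (i , i≢0 , cong inj₁ e)

    private
      grow-leaf : ∀ {A} → grow A (root A) ≃ join A ⟪ leaf ⟫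
      grow-leaf {A} = record
        { bij = mk↔ₛ′ (λ { nothing → inj₂ tt ; (just v) → inj₁ v }) (λ { (inj₁ v) → just v ; (inj₂ _) → nothing })
            (λ { (inj₁ v) → refl ; (inj₂ _) → refl }) (λ { nothing → refl ; (just v) → refl })
        ; E-pres = λ { nothing nothing → refl ; nothing (just v) → sym (∧-identityʳ _) ; (just v) nothing → sym (∧-identityʳ _) ; (just v) (just w) → refl }
        ; root-pres = λ { nothing → refl ; (just v) → refl } }

      grow-cong : ∀ {A} {e e′ : V A → Bool} → (∀ v → e v ≡ e′ v) → grow A e ≃ grow A e′
      grow-cong eq = record { bij = ↔-id _
        ; E-pres = λ { nothing nothing → refl ; nothing (just v) → eq v ; (just v) nothing → eq v ; (just v) (just w) → refl }
        ; root-pres = λ { nothing → refl ; (just v) → refl } }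

      grow-joinˡ : ∀ {A B} {e : V (join A B) → Bool} → (∀ b → e (inj₂ b) ≡ false) → grow (join A B) e ≃ join (grow A (e ∘ inj₁)) B
      grow-joinˡ z = record
        { bij = mk↔ₛ′ (λ { nothing → inj₁ nothing ; (just (inj₁ a)) → inj₁ (just a) ; (just (inj₂ b)) → inj₂ b })
            (λ { (inj₁ nothing) → nothing ; (inj₁ (just a)) → just (inj₁ a) ; (inj₂ b) → just (inj₂ b) })
            (λ { (inj₁ nothing) → refl ; (inj₁ (just a)) → refl ; (inj₂ b) → refl })
            (λ { nothing → refl ; (just (inj₁ a)) → refl ; (just (inj₂ b)) → refl })
        ; E-pres = λ { nothing nothing → refl ; nothing (just (inj₁ a)) → refl ; nothing (just (inj₂ b)) → z b
                     ; (just (inj₁ a)) nothing → refl ; (just (inj₂ b)) nothing → z b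
                     ; (just (inj₁ a)) (just (inj₁ a′)) → refl ; (just (inj₁ a)) (just (inj₂ b)) → refl
                     ; (just (inj₂ b)) (just (inj₁ a)) → refl ; (just (inj₂ b)) (just (inj₂ b′)) → refl }
        ; root-pres = λ { nothing → refl ; (just (inj₁ a)) → refl ; (just (inj₂ b)) → refl } }

      grow-joinʳ : ∀ {A B} {e : V (join A B) → Bool} → (∀ a → e (inj₁ a) ≡ false) → grow (join A B) e ≃ join A (grow B (e ∘ inj₂))
      grow-joinʳ {A} z = record
        { bij = mk↔ₛ′ (λ { nothing → inj₂ nothing ; (just (inj₁ a)) → inj₁ a ; (just (inj₂ b)) → inj₂ (just b) })
            (λ { (inj₂ nothing) → nothing ; (inj₂ (just b)) → just (inj₂ b) ; (inj₁ a) → just (inj₁ a) })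
            (λ { (inj₂ nothing) → refl ; (inj₂ (just b)) → refl ; (inj₁ a) → refl })
            (λ { nothing → refl ; (just (inj₁ a)) → refl ; (just (inj₂ b)) → refl })
        ; E-pres = λ { nothing nothing → refl ; nothing (just (inj₁ a)) → trans (z a) (sym (∧-zeroʳ (root A a))) ; nothing (just (inj₂ b)) → refl
                     ; (just (inj₁ a)) nothing → trans (z a) (sym (∧-zeroʳ (root A a))) ; (just (inj₂ b)) nothing → refl
                     ; (just (inj₁ a)) (just (inj₁ a′)) → refl ; (just (inj₁ a)) (just (inj₂ b)) → refl
                     ; (just (inj₂ b)) (just (inj₁ a)) → refl ; (just (inj₂ b)) (just (inj₂ b′)) → refl }
        ; root-pres = λ { nothing → refl ; (just (inj₁ a)) → refl ; (just (inj₂ b)) → refl } }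

    insert-iso : ∀ {b} (T : Tree b) p → OffCycle T p → grow ⟪ T ⟫ (same T p) ≃ ⟪ insert T p ⟫
    insert-iso leaf p ok = grow-leaf
    insert-iso cyc p refl = ≃-trans (grow-cong λ i → ≡ᵇ-sym 0 (toℕ i)) grow-leaf
    insert-iso (S ◁ T) (inj₁ a) ok = ≃-trans (grow-joinˡ λ _ → refl) (join-cong (insert-iso S a ok) ≃-refl)
    insert-iso (S ◁ T) (inj₂ b) ok = ≃-trans (grow-joinʳ λ _ → refl) (join-cong ≃-refl (insert-iso T b ok))

    insert-cyclePos : (T : Tree true) (p : V ⟪ T ⟫) (ok : OffCycle T p) (i : Fin g) →
      to (insert-iso T p ok) (just (cyclePos T i)) ≡ cyclePos (insert T p) i
    insert-cyclePos cyc p refl i = refl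
    insert-cyclePos (S ◁ T) (inj₁ a) ok i = cong inj₁ (insert-cyclePos S a ok i)
    insert-cyclePos (S ◁ T) (inj₂ b) ok i = refl

-- Reconstruction of a tree from a graph by deleting leaves.

module Extraction where

  open import Data.Nat as ℕ using (ℕ; zero; suc; _+_; _≤_; _<_; z≤n; s≤s; _≡ᵇ_; _<ᵇ_)
  open import Data.Nat.Properties as ℕₚ using (≤-refl; ≤-trans; +-comm; +-identityʳ; +-suc; +-mono-≤; +-cancelˡ-≤)
  open import Data.Nat.Tactic.RingSolver using (solve-∀)
  open import Data.Bool using (Bool; true; false; _∧_)
  open import Data.Fin as Fin using (Fin; toℕ; fromℕ<; punchIn; punchOut) renaming (zero to fzero; suc to fsuc)
  open import Data.Fin.Properties using (toℕ<n; toℕ-injective; toℕ-fromℕ<; punchIn-punchOut; punchInᵢ≢i; punchOut-injective; punchIn-injective; any?)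
  open import Data.Maybe as Maybe using (Maybe; just; nothing)
  open import Data.Product using (∃; _×_; _,_; proj₁; proj₂)
  open import Data.Sum using (_⊎_; inj₁; inj₂; [_,_]′)
  open import Function using (_∘_; _↔_; Inverse; mk↔ₛ′)
  open import Function.Construct.Composition using (_↔-∘_)
  open import Function.Definitions using (Injective)
  open import Relation.Binary.PropositionalEquality
  open import Relation.Binary.Definitions using (tri<; tri≈; tri>)
  open import Relation.Nullary using (yes; no; contradiction)
  open import Defs
  open Trees
  open Adjacency
  open Laplacian using (sumFin-cong)
  open RootedGraphs

  true≢false : ∀ {b} → b ≡ true → b ≡ false → ∀ {ℓ} {X : Set ℓ} → X
  true≢false refl ()

  sumFin-+ : ∀ {n} (f g : Fin n → ℕ) → sumFin (λ i → f i + g i) ≡ sumFin f + sumFin g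
  sumFin-+ {zero} f g = refl
  sumFin-+ {suc n} f g = trans (cong (f fzero + g fzero +_) (sumFin-+ (f ∘ fsuc) (g ∘ fsuc))) (lemma (f fzero) (g fzero) _ _)
    where
    lemma : ∀ a b c d → a + b + (c + d) ≡ a + c + (b + d)
    lemma = solve-∀

  sumFin-zero : ∀ n → sumFin {n} (λ _ → 0) ≡ 0
  sumFin-zero zero = refl
  sumFin-zero (suc n) = sumFin-zero n

  sumFin-swap : ∀ {m n} (f : Fin m → Fin n → ℕ) → sumFin (λ i → sumFin (f i)) ≡ sumFin (λ j → sumFin (λ i → f i j))
  sumFin-swap {zero} {n} f = sym (sumFin-zero n)
  sumFin-swap {suc m} f = trans (cong (sumFin (f fzero) +_) (sumFin-swap (f ∘ fsuc))) (sym (sumFin-+ (f fzero) _))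

  sumFin-punch : ∀ {n} (i : Fin (suc n)) (f : Fin (suc n) → ℕ) → sumFin f ≡ f i + sumFin (f ∘ punchIn i)
  sumFin-punch fzero f = refl
  sumFin-punch {suc n} (fsuc i) f = trans (cong (f fzero +_) (sumFin-punch i (f ∘ fsuc))) (lemma (f fzero) (f (fsuc i)) _)
    where
    lemma : ∀ a b c → a + (b + c) ≡ b + (a + c)
    lemma = solve-∀

  module _ {n} (f : Fin n → Bool) where

    count-≥1 : ∀ {i} → f i ≡ true → 1 ≤ countFin f
    count-≥1 = go f
      where
      go : ∀ {n} (f : Fin n → Bool) {i} → f i ≡ true → 1 ≤ countFin f
      go {suc n} f {i} e = subst (1 ≤_) (sym (sumFin-punch i (bool ∘ f))) (subst (λ b → 1 ≤ bool b + sumFin (bool ∘ f ∘ punchIn i)) (sym e) (s≤s z≤n))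

    count-exists : 1 ≤ countFin f → ∃ λ i → f i ≡ true
    count-exists = go f
      where
      go : ∀ {n} (f : Fin n → Bool) → 1 ≤ countFin f → ∃ λ i → f i ≡ true
      go {suc n} f h with f fzero in e
      ... | true = fzero , e
      ... | false with go (f ∘ fsuc) h
      ... | i , e′ = fsuc i , e′

  count-punch : ∀ {n} (f : Fin (suc n) → Bool) {i} → f i ≡ true → countFin f ≡ suc (countFin (f ∘ punchIn i))
  count-punch f {i} e = trans (sumFin-punch i (bool ∘ f)) (cong (λ b → bool b + countFin (f ∘ punchIn i)) e)

  count-≥2 : ∀ {n} (f : Fin n → Bool) {i j} → i ≢ j → f i ≡ true → f j ≡ true → 2 ≤ countFin f
  count-≥2 {suc n} f i≢j e e′ = subst (2 ≤_) (sym (count-punch f e))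
    (s≤s (count-≥1 (f ∘ punchIn _) (trans (cong f (punchIn-punchOut i≢j)) e′)))

  count-≥3 : ∀ {n} (f : Fin n → Bool) {i j k} → i ≢ j → i ≢ k → j ≢ k → f i ≡ true → f j ≡ true → f k ≡ true → 3 ≤ countFin f
  count-≥3 {suc n} f i≢j i≢k j≢k e e′ e″ = subst (3 ≤_) (sym (count-punch f e))
    (s≤s (count-≥2 (f ∘ punchIn _) (j≢k ∘ punchOut-injective i≢j i≢k) (trans (cong f (punchIn-punchOut i≢j)) e′) (trans (cong f (punchIn-punchOut i≢k)) e″)))

  count-unique : ∀ {n} (f : Fin n → Bool) {i j} → countFin f ≡ 1 → f i ≡ true → f j ≡ true → i ≡ j
  count-unique f {i} {j} c e e′ with i Fin.≟ j
  ... | yes p = p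
  ... | no ne = contradiction (subst (2 ≤_) c (count-≥2 f ne e e′)) λ { (s≤s ()) }

  count-pair : ∀ {n} (f : Fin n → Bool) {i j k} → countFin f ≡ 2 → i ≢ j → f i ≡ true → f j ≡ true → f k ≡ true → k ≡ i ⊎ k ≡ j
  count-pair f {i} {j} {k} c i≢j e e′ e″ with k Fin.≟ i | k Fin.≟ j
  ... | yes p | _ = inj₁ p
  ... | no _ | yes p = inj₂ p
  ... | no k≢i | no k≢j = contradiction (subst (3 ≤_) c (count-≥3 f i≢j (k≢i ∘ sym) (k≢j ∘ sym) e e′ e″)) λ { (s≤s (s≤s ())) }

  handshake : ∀ {n} (G : Graph n) → IsSimple G → sumFin (degree G) ≡ edgeCount G + edgeCount G
  handshake {n} G (symm , irr) = trans
    (sumFin-cong λ i → trans (sumFin-cong λ j → pointwise i j) (sumFin-+ (λ j → upper i j) (λ j → upper j i)))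
    (trans (sumFin-+ (λ i → sumFin (upper i)) (λ i → sumFin (λ j → upper j i)))
      (cong (edgeCount G +_) (sumFin-swap (λ i j → upper j i))))
    where
    upper : Fin n → Fin n → ℕ
    upper i j = bool ((toℕ i <ᵇ toℕ j) ∧ G i j)
    <ᵇ-≥ : ∀ {m n} → n ≤ m → (m <ᵇ n) ≡ false
    <ᵇ-≥ {m} z≤n = refl
    <ᵇ-≥ (s≤s h) = <ᵇ-≥ h
    pointwise : ∀ i j → bool (G i j) ≡ upper i j + upper j i
    pointwise i j with ℕₚ.<-cmp (toℕ i) (toℕ j)
    ... | tri< i<j _ _ rewrite <ᵇ-true i<j | <ᵇ-≥ (ℕₚ.<⇒≤ i<j) = sym (+-identityʳ _)
    ... | tri≈ _ i≡j _ rewrite toℕ-injective {i = i} {j} i≡j | irr j = sym (cong₂ _+_ (none (toℕ j <ᵇ toℕ j)) (none (toℕ j <ᵇ toℕ j)))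
      where
      none : ∀ b → bool (b ∧ false) ≡ 0
      none true = refl
      none false = refl
    ... | tri> _ _ j<i rewrite <ᵇ-true j<i | <ᵇ-≥ (ℕₚ.<⇒≤ j<i) = cong bool (symm i j)

  module Extract (h : ℕ) where
    open Sizes h
    open Adjacent h
    open RootedTrees h

    Consecutive : ℕ → ℕ → Set
    Consecutive i j = suc i ≡ j ⊎ (suc i ≡ g × j ≡ 0)

    consecutive-next : ∀ i → Consecutive i (next i)
    consecutive-next i with i ≡ᵇ last in e
    ... | true = inj₂ (cong suc (≡ᵇ-true e) , refl)
    ... | false = inj₁ refl

    consecutive⇒next : ∀ {i j} → j < g → Consecutive i j → j ≡ next i
    consecutive⇒next {i} {j} j<g c with i ≡ᵇ last in e
    ... | true = [ (λ { refl → contradiction (subst (λ k → suc k < g) (≡ᵇ-true e) j<g) (ℕₚ.<-irrefl refl) }) , proj₂ ]′ c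
    ... | false = [ sym , (λ (p , _) → true≢false (trans (cong (_≡ᵇ last) (ℕₚ.suc-injective p)) (≡ᵇ-refl last)) e) ]′ c

    succ pred : Fin g → Fin g
    succ i = fromℕ< (next-< (toℕ<n i))
    pred i = fromℕ< (prev-< (toℕ<n i))

    toℕ-succ : ∀ i → toℕ (succ i) ≡ next (toℕ i)
    toℕ-succ i = toℕ-fromℕ< _

    toℕ-pred : ∀ i → toℕ (pred i) ≡ prev (toℕ i)
    toℕ-pred i = toℕ-fromℕ< _

    consecutive-succ : ∀ i → Consecutive (toℕ i) (toℕ (succ i))
    consecutive-succ i = subst (Consecutive (toℕ i)) (sym (toℕ-succ i)) (consecutive-next (toℕ i))

    consecutive-pred : ∀ i → Consecutive (toℕ (pred i)) (toℕ i)
    consecutive-pred i = subst₂ Consecutive (sym (toℕ-pred i)) (next-prev (toℕ<n i)) (consecutive-next (prev (toℕ i)))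

    succ≢pred : ∀ i → succ i ≢ pred i
    succ≢pred i e = next≢prev (toℕ i) (toℕ<n i) (trans (sym (toℕ-succ i)) (trans (cong toℕ e) (toℕ-pred i)))

    -- Invariant of leaf deletion: u is the cycle, and only u₁ = u 0 may have neighbours off the cycle.
    record Lollipop {m} (G : Graph m) : Set where
      field
        simple : IsSimple G
        connected : Connected G
        degrees : sumFin (degree G) ≡ m + m
        u : Fin g → Fin m
        u-injective : Injective _≡_ _≡_ u
        u-edge : ∀ i j → Consecutive (toℕ i) (toℕ j) → G (u i) (u j) ≡ true
        closed : ∀ i → toℕ i ≢ 0 → ∀ v → G (u i) v ≡ true → ∃ λ k → v ≡ u k

      G-sym : ∀ {v w} → G v w ≡ true → G w v ≡ true
      G-sym {v} {w} e = trans (proj₁ simple w v) e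

      toSucc : ∀ i → G (u i) (u (succ i)) ≡ true
      toSucc i = u-edge i (succ i) (consecutive-succ i)

      toPred : ∀ i → G (u i) (u (pred i)) ≡ true
      toPred i = G-sym (u-edge (pred i) i (consecutive-pred i))

      cycle-degree : ∀ i → 2 ≤ degree G (u i)
      cycle-degree i = count-≥2 (G (u i)) (succ≢pred i ∘ u-injective) (toSucc i) (toPred i)

    record Shape {m} {G : Graph m} (L : Lollipop G) : Set where
      field
        T : Tree true
        vertices : Fin m ↔ V ⟪ T ⟫
        edges : ∀ v w → G v w ≡ E ⟪ T ⟫ (Inverse.to vertices v) (Inverse.to vertices w)
        marks : ∀ k → Inverse.to vertices (Lollipop.u L k) ≡ cyclePos T k

    -- Without leaves all degrees are at least 2, and their sum 2m makes them equal to 2. The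
    -- neighbours of a cycle vertex are then its two cycle neighbours, so by connectedness there is
    -- nothing but the cycle.
    module Base {m} {G : Graph m} (L : Lollipop G) (noLeaf : ∀ i → degree G i ≢ 1) where
      open Lollipop L

      neighbour : ∀ {v w} → v ≢ w → Reachable G v w → ∃ λ x → G v x ≡ true
      neighbour v≢w here = contradiction refl v≢w
      neighbour v≢w (step {v = x} e _) = x , e

      nonzero : ∀ v → 1 ≤ degree G v
      nonzero v with v Fin.≟ u fzero
      ... | yes e = subst (λ w → 1 ≤ degree G w) (sym e) (≤-trans (s≤s z≤n) (cycle-degree fzero))
      ... | no ne = count-≥1 (G v) (proj₂ (neighbour ne (connected v (u fzero))))

      ≥2 : ∀ v → 2 ≤ degree G v
      ≥2 v = ℕₚ.≤∧≢⇒< (nonzero v) (noLeaf v ∘ sym)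

      sum-tight : ∀ {n} (f : Fin n → ℕ) → (∀ i → 2 ≤ f i) → sumFin f ≡ n + n → ∀ i → f i ≡ 2
      sum-tight {suc n} f lo e i = ℕₚ.≤-antisym
        (+-cancelˡ-≤ (n + n) (f i) 2 (≤-trans (+-mono-≤ (lower (f ∘ punchIn i) (lo ∘ punchIn i)) (≤-refl {f i}))
          (ℕₚ.≤-reflexive (trans (+-comm _ (f i)) (trans (sym (sumFin-punch i f)) (trans e (lemma n))))))) (lo i)
        where
        lemma : ∀ n → suc n + suc n ≡ n + n + 2
        lemma = solve-∀
        lower : ∀ {n} (f : Fin n → ℕ) → (∀ i → 2 ≤ f i) → n + n ≤ sumFin f
        lower {zero} f lo = z≤n
        lower {suc n} f lo = subst (_≤ sumFin f) (sym (+-suc (suc n) n)) (+-mono-≤ (lo fzero) (lower (f ∘ fsuc) (lo ∘ fsuc)))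

      two : ∀ v → degree G v ≡ 2
      two = sum-tight (degree G) ≥2 degrees

      around : ∀ i {v} → G (u i) v ≡ true → v ≡ u (succ i) ⊎ v ≡ u (pred i)
      around i e = count-pair (G (u i)) (two (u i)) (succ≢pred i ∘ u-injective) (toSucc i) (toPred i) e

      onto : ∀ {v w} → Reachable G v w → (∃ λ k → v ≡ u k) → ∃ λ k → w ≡ u k
      onto here k = k
      onto (step e r) (k , refl) = onto r ([ (succ k ,_) , (pred k ,_) ]′ (around k e))

      index : Fin m → Fin g
      index v = proj₁ (onto (connected (u fzero) v) (fzero , refl))

      u-index : ∀ v → u (index v) ≡ v
      u-index v = sym (proj₂ (onto (connected (u fzero) v) (fzero , refl)))

      cyc-edge : ∀ i j → G (u i) (u j) ≡ adj cyc (toℕ i) (toℕ j)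
      cyc-edge i j with toℕ j ≡ᵇ next (toℕ i) in e | toℕ i ≡ᵇ next (toℕ j) in e′
      ... | true | _ = u-edge i j (subst (Consecutive (toℕ i)) (sym (≡ᵇ-true e)) (consecutive-next (toℕ i)))
      ... | false | true = G-sym (u-edge j i (subst (Consecutive (toℕ j)) (sym (≡ᵇ-true e′)) (consecutive-next (toℕ j))))
      ... | false | false with G (u i) (u j) in e″
      ... | false = refl
      ... | true with around i e″
      ... | inj₁ p = true≢false (trans (cong (_≡ᵇ next (toℕ i)) (trans (cong toℕ (u-injective p)) (toℕ-succ i))) (≡ᵇ-refl (next (toℕ i)))) e
      ... | inj₂ p = true≢false (trans (cong (toℕ i ≡ᵇ_) (trans (cong next (trans (cong toℕ (u-injective p)) (toℕ-pred i))) (next-prev (toℕ<n i)))) (≡ᵇ-refl (toℕ i))) e′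

      result : Shape L
      result = record
        { T = cyc
        ; vertices = mk↔ₛ′ index u (λ k → u-injective (u-index (u k))) u-index
        ; edges = λ v w → trans (sym (cong₂ G (u-index v) (u-index w))) (cyc-edge (index v) (index w))
        ; marks = λ k → u-injective (u-index (u k)) }

    module Peel {m} {G : Graph (suc m)} (L : Lollipop G) (i : Fin (suc m)) (leaf-i : degree G i ≡ 1) where
      open Lollipop L

      neighbour : ∃ λ j → G i j ≡ true
      neighbour = count-exists (G i) (subst (1 ≤_) (sym leaf-i) ≤-refl)

      j : Fin (suc m)
      j = proj₁ neighbour

      only : ∀ {v} → G i v ≡ true → v ≡ j
      only e = count-unique (G i) leaf-i e (proj₂ neighbour)

      i≢j : i ≢ j
      i≢j e = true≢false (trans (cong (G i) e) (proj₂ neighbour)) (proj₂ simple i)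

      j′ : Fin m
      j′ = punchOut i≢j

      i≢u : ∀ k → i ≢ u k
      i≢u k e = contradiction (subst (2 ≤_) (trans (cong (degree G) (sym e)) leaf-i) (cycle-degree k)) λ { (s≤s ()) }

      G′ : Graph m
      G′ v w = G (punchIn i v) (punchIn i w)

      u′ : Fin g → Fin m
      u′ k = punchOut (i≢u k)

      punch-u′ : ∀ k → punchIn i (u′ k) ≡ u k
      punch-u′ k = punchIn-punchOut (i≢u k)

      to-j : ∀ {v w} → punchIn i v ≡ j → punchIn i w ≡ j → v ≡ w
      to-j e e′ = punchIn-injective i _ _ (trans e (sym e′))

      mutual
        -- A walk can enter the deleted leaf i only from j and must leave it to j again, so the
        -- detour can be cut out; `bounce` treats the moment at i.
        avoid : ∀ {x w} v → x ≡ punchIn i v → Reachable G x (punchIn i w) → Reachable G′ v w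
        avoid {w = w} v e here = subst (λ w → Reachable G′ v w) (punchIn-injective i v w (sym e)) here
        avoid v refl (step {v = y} e r) with i Fin.≟ y
        ... | yes refl = bounce v (only (G-sym e)) r
        ... | no ne = step (trans (cong (G (punchIn i v)) (punchIn-punchOut ne)) e) (avoid (punchOut ne) (sym (punchIn-punchOut ne)) r)

        bounce : ∀ {w} v → punchIn i v ≡ j → Reachable G i (punchIn i w) → Reachable G′ v w
        bounce v vj r = go refl r
          where
          go : ∀ {x w} → x ≡ i → Reachable G x (punchIn i w) → Reachable G′ v w
          go {w = w} e here = contradiction e (punchInᵢ≢i i w)
          go refl (step e r) = avoid v (trans (only e) (sym vj)) r

      -- The sum loses the degree 1 of the leaf and one unit at its neighbour, which matches the
      -- drop from 2(m + 1) to 2m.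
      degrees′ : sumFin (degree G′) ≡ m + m
      degrees′ = ℕₚ.+-cancelˡ-≡ 2 _ _ (begin
        2 + sumFin (degree G′)
          ≡⟨ cong (λ d → 1 + (d + sumFin (degree G′))) (sym column) ⟩
        1 + (sumFin (λ v → bool (G (punchIn i v) i)) + sumFin (degree G′))
          ≡⟨ cong suc (sym (sumFin-+ (λ v → bool (G (punchIn i v) i)) (degree G′))) ⟩
        1 + sumFin (λ v → bool (G (punchIn i v) i) + degree G′ v)
          ≡⟨ cong₂ _+_ (sym leaf-i) (sumFin-cong λ v → sym (sumFin-punch i (bool ∘ G (punchIn i v)))) ⟩
        degree G i + sumFin (λ v → degree G (punchIn i v))
          ≡⟨ sym (sumFin-punch i (degree G)) ⟩
        sumFin (degree G)
          ≡⟨ degrees ⟩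
        suc m + suc m
          ≡⟨ cong suc (+-suc m m) ⟩
        2 + (m + m) ∎)
        where
        open ≡-Reasoning
        column : sumFin (λ v → bool (G (punchIn i v) i)) ≡ 1
        column = trans (sumFin-cong λ v → cong bool (proj₁ simple (punchIn i v) i))
          (trans (cong (λ b → bool b + sumFin (bool ∘ G i ∘ punchIn i)) (sym (proj₂ simple i))) (trans (sym (sumFin-punch i (bool ∘ G i))) leaf-i))

      lollipop : Lollipop G′
      lollipop = record
        { simple = (λ v w → proj₁ simple (punchIn i v) (punchIn i w)) , λ v → proj₂ simple (punchIn i v)
        ; connected = λ v w → avoid v refl (connected (punchIn i v) (punchIn i w))
        ; degrees = degrees′
        ; u = u′
        ; u-injective = λ {a} {b} e → u-injective (punchOut-injective (i≢u a) (i≢u b) e)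
        ; u-edge = λ a b c → trans (cong₂ G (punch-u′ a) (punch-u′ b)) (u-edge a b c)
        ; closed = λ a a≢0 v e → let k , p = closed a a≢0 (punchIn i v) (trans (cong (λ w → G w (punchIn i v)) (sym (punch-u′ a))) e)
            in k , punchIn-injective i _ _ (trans p (sym (punch-u′ k))) }

      restore : Shape lollipop → Shape L
      restore S = record { T = insert T p ; vertices = bij′ ; edges = edges′ ; marks = marks′ }
        where
        open Shape S
        f : Fin m → V ⟪ T ⟫
        f = Inverse.to vertices
        f-injective : ∀ {v w} → f v ≡ f w → v ≡ w
        f-injective {v} {w} e = trans (sym (Inverse.strictlyInverseʳ vertices v)) (trans (cong (Inverse.from vertices) e) (Inverse.strictlyInverseʳ vertices w))
        p : V ⟪ T ⟫
        p = f j′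
        -- If the neighbour of i were one of u_2, ..., u_g, then `closed` would put the leaf i
        -- itself on the cycle.
        ok : OffCycle T p
        ok with offCycle? T p
        ... | inj₁ o = o
        ... | inj₂ (k , k≢0 , e) = contradiction (proj₂ back) (i≢u (proj₁ back))
          where
          j≡u : j ≡ u k
          j≡u = trans (sym (punchIn-punchOut i≢j)) (trans (cong (punchIn i) (f-injective (trans e (sym (marks k))))) (punch-u′ k))
          back : ∃ λ k′ → i ≡ u k′
          back = closed k k≢0 i (G-sym (trans (cong (G i) (sym j≡u)) (proj₂ neighbour)))
        unpunch : Maybe (Fin m) → Fin (suc m)
        unpunch nothing = i
        unpunch (just v) = punchIn i v
        punch : Fin (suc m) → Maybe (Fin m)
        punch v with i Fin.≟ v
        ... | yes _ = nothing
        ... | no ne = just (punchOut ne)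
        unpunch-punch : ∀ v → unpunch (punch v) ≡ v
        unpunch-punch v with i Fin.≟ v
        ... | yes e = e
        ... | no ne = punchIn-punchOut ne
        punch-unpunch : ∀ x → punch (unpunch x) ≡ x
        punch-unpunch nothing with i Fin.≟ i
        ... | yes _ = refl
        ... | no ne = contradiction refl ne
        punch-unpunch (just v) with i Fin.≟ punchIn i v
        ... | yes e = contradiction (sym e) (punchInᵢ≢i i v)
        ... | no ne = cong just (punchIn-injective i _ _ (punchIn-punchOut ne))
        bij′ : Fin (suc m) ↔ V ⟪ insert T p ⟫
        bij′ = RootedGraphs._≃_.bij (insert-iso T p ok) ↔-∘ (mk↔ₛ′ (Maybe.map f) (Maybe.map (Inverse.from vertices))
            (λ { nothing → refl ; (just v) → cong just (Inverse.strictlyInverseˡ vertices v) })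
            (λ { nothing → refl ; (just v) → cong just (Inverse.strictlyInverseʳ vertices v) })
          ↔-∘ mk↔ₛ′ punch unpunch punch-unpunch unpunch-punch)
        hanging : ∀ v → G i (punchIn i v) ≡ same T p (f v)
        hanging v with same T p (f v) in e
        ... | true = trans (cong (G i) (trans (cong (punchIn i) (sym (f-injective (same-true T p (f v) e)))) (punchIn-punchOut i≢j))) (proj₂ neighbour)
        ... | false with G i (punchIn i v) in e′
        ... | false = refl
        ... | true = true≢false (trans (cong (same T p) (cong f (to-j (only e′) (punchIn-punchOut i≢j)))) (same-refl T p)) e
        grown : ∀ x y → G (unpunch x) (unpunch y) ≡ E (grow ⟪ T ⟫ (same T p)) (Maybe.map f x) (Maybe.map f y)
        grown nothing nothing = proj₂ simple i
        grown nothing (just v) = hanging v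
        grown (just v) nothing = trans (proj₁ simple (punchIn i v) i) (hanging v)
        grown (just v) (just w) = edges v w
        edges′ : ∀ v w → G v w ≡ E ⟪ insert T p ⟫ (Inverse.to bij′ v) (Inverse.to bij′ w)
        edges′ v w = trans (sym (cong₂ G (unpunch-punch v) (unpunch-punch w)))
          (trans (grown (punch v) (punch w)) (E-pres (insert-iso T p ok) (Maybe.map f (punch v)) (Maybe.map f (punch w))))
        marks′ : ∀ k → Inverse.to bij′ (u k) ≡ cyclePos (insert T p) k
        marks′ k = trans (cong (to (insert-iso T p ok) ∘ Maybe.map f)
            (trans (cong punch (sym (punch-u′ k))) (punch-unpunch (just (u′ k)))))
          (trans (cong (to (insert-iso T p ok) ∘ just) (marks k)) (insert-cyclePos T p ok k))

    shapeOf : ∀ {m} {G : Graph m} (L : Lollipop G) → Shape L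
    shapeOf {zero} L with Lollipop.u L fzero
    ... | ()
    shapeOf {suc m} {G} L with any? (λ i → degree G i ℕ.≟ 1)
    ... | yes (i , e) = Peel.restore L i e (shapeOf (Peel.lollipop L i e))
    ... | no none = Base.result L λ i e → none (i , e)

-- The class consists exactly of the graphs of trees with a cycle.

module Members where

  open import Data.Nat as ℕ using (ℕ; zero; suc; _+_; _∸_; _⊔_; _≤_; _<_; z≤n; s≤s; s≤s⁻¹; _≡ᵇ_)
  open import Data.Nat.Properties as ℕₚ using (≤-refl; ≤-trans; +-comm; +-identityʳ; +-suc; <-≤-trans; ≤-<-trans; n<1+n)
  open import Data.Nat.Induction using (<-wellFounded)
  open import Data.Nat.Tactic.RingSolver using (solve-∀)
  open import Induction.WellFounded using (Acc; acc)
  open import Data.Bool using (Bool; true; false; _∧_; _∨_)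
  open import Data.Fin using (Fin; toℕ; fromℕ<; inject≤) renaming (zero to fzero; suc to fsuc)
  open import Data.Fin.Properties using (toℕ<n; toℕ-injective; toℕ-fromℕ<; toℕ-inject≤; injective⇒≤)
  open import Data.Fin.Permutation using (↔⇒≡)
  open import Data.Product using (Σ; ∃; _×_; _,_; proj₁; proj₂)
  open import Data.Sum using (_⊎_; inj₁; inj₂; [_,_]′)
  open import Function using (_∘_; _↔_; Inverse)
  open import Function.Construct.Composition using (_↔-∘_)
  open import Relation.Binary.PropositionalEquality
  open import Relation.Nullary using (¬_; yes; no; contradiction)
  open import Defs
  open Trees
  open Adjacency
  open Laplacian
  open RootedGraphs
  open Extraction

  data Side (a : ℕ) : ℕ → Set where
    left  : ∀ {i} → i < a → Side a i
    right : ∀ i → Side a (a + i)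

  side : ∀ a i → Side a i
  side a i with i ℕ.<? a
  ... | yes h = left h
  ... | no h = subst (Side a) (ℕₚ.m+[n∸m]≡n (ℕₚ.≮⇒≥ h)) (right (i ∸ a))

  ∧-true : ∀ {a b} → a ∧ b ≡ true → a ≡ true × b ≡ true
  ∧-true {true} {true} _ = refl , refl

  module Member (h : ℕ) where
    open Sizes h
    open Adjacent h
    open RootedTrees h
    open Extract h
    open Realize h

    -- Following smaller neighbours ends at vertex 0, which gives connectedness.
    parent : ∀ {b} (T : Tree b) i → 0 < i → i < size T → ∃ λ j → j < i × adj T i j ≡ true
    parent leaf (suc i) _ (s≤s ())
    parent cyc (suc i) _ hi = i , ≤-refl , trans (cong ((i ≡ᵇ next (suc i)) ∨_) back) (∨-true _)
      where
      back : (suc i ≡ᵇ next i) ≡ true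
      back = trans (cong (suc i ≡ᵇ_) (next-prev hi)) (≡ᵇ-refl i)
      ∨-true : ∀ b → b ∨ true ≡ true
      ∨-true true = refl
      ∨-true false = refl
    parent (S ◁ T) i 0<i hi with side (size S) i
    ... | left hl with parent S i 0<i hl
    ... | j , j<i , e = j , j<i , trans (adj-ll S T hl (ℕₚ.<-trans j<i hl)) e
    parent (S ◁ T) _ 0<i hi | right zero = 0 , s≤s z≤n , adj-rl S T 0 (s≤s z≤n)
    parent (S ◁ T) _ 0<i hi | right (suc k) with parent T (suc k) (s≤s z≤n) (ℕₚ.+-cancelˡ-< (size S) _ _ hi)
    ... | j , j<k , e = size S + j , ℕₚ.+-monoʳ-< (size S) j<k , trans (adj-rr S T (suc k) j) e

    coreSize : Bool → ℕ
    coreSize true = g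
    coreSize false = 0

    core≤size : ∀ {b} (T : Tree b) → coreSize b ≤ size T
    core≤size leaf = z≤n
    core≤size cyc = ≤-refl
    core≤size (S ◁ T) = ≤-trans (core≤size S) (ℕₚ.m≤m+n (size S) (size T))

    -- Outside the numbers 0, ..., g - 1 of the cycle there is only one smaller neighbour, so no
    -- such vertex can be the largest on a cycle.
    parent-unique : ∀ {b} (T : Tree b) {i j k} → coreSize b ≤ i → i < size T → j < i → k < i →
      adj T i j ≡ true → adj T i k ≡ true → j ≡ k
    parent-unique leaf _ _ _ _ () _
    parent-unique cyc g≤i i<g _ _ _ _ = contradiction (ℕₚ.<-≤-trans i<g g≤i) (ℕₚ.<-irrefl refl)
    parent-unique (S ◁ T) {i} {j} {k} c hi hj hk e e′ with side (size S) i
    ... | left hl = parent-unique S c hl hj hk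
          (trans (sym (adj-ll S T hl (ℕₚ.<-trans hj hl))) e) (trans (sym (adj-ll S T hl (ℕₚ.<-trans hk hl))) e′)
    ... | right i′ with side (size S) j | side (size S) k
    ... | left jl | left kl = trans (≡ᵇ-true (proj₁ (∧-true (trans (sym (adj-rl S T i′ jl)) e))))
          (sym (≡ᵇ-true (proj₁ (∧-true (trans (sym (adj-rl S T i′ kl)) e′)))))
    ... | right j′ | right k′ = cong (size S +_) (parent-unique T z≤n (ℕₚ.+-cancelˡ-< (size S) _ _ hi)
          (ℕₚ.+-cancelˡ-< (size S) _ _ hj) (ℕₚ.+-cancelˡ-< (size S) _ _ hk) (trans (sym (adj-rr S T i′ j′)) e) (trans (sym (adj-rr S T i′ k′)) e′))
    ... | left jl | right k′ = contradiction (subst (k′ <_) (≡ᵇ-true {i′} (proj₂ (∧-true {j ≡ᵇ 0} (trans (sym (adj-rl S T i′ jl)) e)))) (ℕₚ.+-cancelˡ-< (size S) _ _ hk)) λ ()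
    ... | right j′ | left kl = contradiction (subst (j′ <_) (≡ᵇ-true {i′} (proj₂ (∧-true {k ≡ᵇ 0} (trans (sym (adj-rl S T i′ kl)) e′)))) (ℕₚ.+-cancelˡ-< (size S) _ _ hj)) λ ()

    adj-core : (T : Tree true) → ∀ {i j} → i < g → j < g → adj T i j ≡ adj cyc i j
    adj-core cyc _ _ = refl
    adj-core (S ◁ T) hi hj = trans (adj-ll S T (<-≤-trans hi (core≤size S)) (<-≤-trans hj (core≤size S))) (adj-core S hi hj)

    deg-core : (T : Tree true) → ∀ {i} → 0 < i → i < g → deg T i ≡ 2
    deg-core cyc _ hi = deg-cyc hi
    deg-core (S ◁ T) {suc i} _ hi = trans (deg-l S T (<-≤-trans hi (core≤size S))) (trans (+-identityʳ _) (deg-core S (s≤s z≤n) hi))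

    deg-root : (T : Tree true) → 2 ≤ deg T 0
    deg-root cyc = ℕₚ.≤-reflexive (sym (deg-cyc (s≤s z≤n)))
    deg-root (S ◁ T) = subst (2 ≤_) (sym (deg-l S T (s≤s z≤n))) (≤-trans (deg-root S) (ℕₚ.m≤m+n _ _))

    private
      bump : ∀ n f → sum< (suc n) (λ i → f i + bool (i ≡ᵇ 0)) ≡ suc (sum< (suc n) f)
      bump n f = trans (sum<-+ (suc n) f (λ i → bool (i ≡ᵇ 0))) (trans (cong (sum< (suc n) f +_) (count<-point {suc n} 0 (s≤s z≤n))) (+-comm _ 1))

      degreeSum-◁ : ∀ {b} (S : Tree b) T → sum< (size (S ◁ T)) (deg (S ◁ T)) ≡ suc (sum< (size S) (deg S)) + suc (sum< (size T) (deg T))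
      degreeSum-◁ S T = trans (sum<-split (size S) (size T) (deg (S ◁ T)))
        (cong₂ _+_ (trans (sum<-cong (size S) λ i hi → deg-l S T hi) (bump (extra S) (deg S)))
                   (trans (sum<-cong (size T) λ i _ → deg-r S T i) (bump (extra T) (deg T))))

    degreeSum-tree : (T : Tree false) → 2 + sum< (size T) (deg T) ≡ size T + size T
    degreeSum-tree leaf = refl
    degreeSum-tree (S ◁ T) = trans (cong (2 +_) (degreeSum-◁ S T))
      (trans (lemma (sum< (size S) (deg S)) (sum< (size T) (deg T)))
        (trans (cong₂ _+_ (degreeSum-tree S) (degreeSum-tree T)) (lemma′ (size S) (size T))))
      where
      lemma : ∀ a b → 2 + (suc a + suc b) ≡ (2 + a) + (2 + b)
      lemma = solve-∀
      lemma′ : ∀ a b → (a + a) + (b + b) ≡ (a + b) + (a + b)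
      lemma′ = solve-∀

    degreeSum : (T : Tree true) → sum< (size T) (deg T) ≡ size T + size T
    degreeSum cyc = trans (sum<-cong g λ i hi → deg-cyc hi) (twos g)
      where
      twos : ∀ n → sum< n (λ _ → 2) ≡ n + n
      twos zero = refl
      twos (suc n) = trans (cong (2 +_) (twos n)) (cong suc (sym (+-suc n n)))
    degreeSum (S ◁ T) = trans (degreeSum-◁ S T) (trans (lemma (sum< (size S) (deg S)) (sum< (size T) (deg T)))
      (trans (cong₂ _+_ (degreeSum S) (degreeSum-tree T)) (lemma′ (size S) (size T))))
      where
      lemma : ∀ a b → suc a + suc b ≡ a + (2 + b)
      lemma = solve-∀
      lemma′ : ∀ a b → (a + a) + (b + b) ≡ (a + b) + (a + b)
      lemma′ = solve-∀

    hanging : ∀ {b} → Tree b → ℕ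
    hanging T = count< (extra T) (λ i → deg T (suc i) ≡ᵇ 1)

    private
      hanging-◁ : ∀ {b} (S : Tree b) T → hanging (S ◁ T) ≡ hanging S + (bool (deg T 0 ≡ᵇ 0) + hanging T)
      hanging-◁ S T = trans (sum<-split (extra S) (size T) _)
        (cong₂ _+_ (sum<-cong (extra S) λ i hi → cong (λ d → bool (d ≡ᵇ 1)) (trans (deg-l S T (s≤s hi)) (+-identityʳ _)))
          (cong₂ _+_ (cong (λ d → bool (d ≡ᵇ 1)) (trans (deg-r S T 0) (+-comm _ 1)))
            (sum<-cong (extra T) λ i _ → cong (λ d → bool (d ≡ᵇ 1)) (trans (deg-r S T (suc i)) (+-identityʳ _)))))

    hanging≡leaves : ∀ {b} (T : Tree b) → hanging T ≡ leaves T
    -- Hanging T from a parent gives its root one more edge, so the root becomes a leaf exactly when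
    -- it was isolated. This is the reason for `⊔ 1` in `leaves`.
    hanging-child : (T : Tree false) → bool (deg T 0 ≡ᵇ 0) + hanging T ≡ leaves T ⊔ 1
    hanging≡leaves leaf = refl
    hanging≡leaves cyc = sum<-zero (extra cyc) λ i hi → cong (λ d → bool (d ≡ᵇ 1)) (deg-cyc (s≤s hi))
    hanging≡leaves (S ◁ T) = trans (hanging-◁ S T) (cong₂ _+_ (hanging≡leaves S) (hanging-child T))
    hanging-child leaf = refl
    hanging-child (S ◁ T) = trans (cong (λ d → bool (d ≡ᵇ 0) + hanging (S ◁ T)) (trans (deg-l S T (s≤s z≤n)) (+-comm _ 1)))
      (trans (hanging≡leaves (S ◁ T)) (sym (ℕₚ.m≥n⇒m⊔n≡m (≤-trans (ℕₚ.m≤n⊔m (leaves T) 1) (ℕₚ.m≤n+m _ (leaves S))))))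

    leafCount-Γ : ∀ {n} (T : Tree true) → n ≡ size T → leafCount (Γ n T) ≡ leaves T
    leafCount-Γ T refl = trans (countFin-cong λ i → cong (_≡ᵇ 1) (degree-Γ T refl i))
      (trans (sumFin-toℕ (size T) (λ i → bool (deg T i ≡ᵇ 1)))
        (cong₂ _+_ (cong bool (≡ᵇ-false {deg T 0} {1} λ e → contradiction (subst (2 ≤_) e (deg-root T)) λ { (s≤s ()) })) (hanging≡leaves T)))

    module _ {n} (T : Tree true) (n≡ : n ≡ size T) where

      Γ-simple : IsSimple (Γ n T)
      Γ-simple = (λ i j → adj-sym T (toℕ i) (toℕ j)) , λ i → adj-irrefl T (toℕ i)

      private
        bound : ∀ (i : Fin n) → toℕ i < size T
        bound i = subst (toℕ i <_) n≡ (toℕ<n i)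

        0<n : 0 < n
        0<n = subst (0 <_) (sym n≡) (s≤s z≤n)

        origin : Fin n
        origin = fromℕ< 0<n

        g≤n : g ≤ n
        g≤n = subst (g ≤_) (sym n≡) (core≤size T)

        append : ∀ {u v w} → Reachable (Γ n T) u v → Γ n T v w ≡ true → Reachable (Γ n T) u w
        append here e = step e here
        append (step e r) e′ = step e (append r e′)

        reverse : ∀ {u v} → Reachable (Γ n T) u v → Reachable (Γ n T) v u
        reverse here = here
        reverse (step {u} {v} e r) = append (reverse r) (trans (proj₁ Γ-simple v u) e)

        concat : ∀ {u v w} → Reachable (Γ n T) u v → Reachable (Γ n T) v w → Reachable (Γ n T) u w
        concat here r = r
        concat (step e r) r′ = step e (concat r r′)

        toOrigin : ∀ m → Acc _<_ m → ∀ i → toℕ i ≡ m → Reachable (Γ n T) i origin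
        toOrigin zero _ i eq = subst (Reachable (Γ n T) i) (toℕ-injective (trans eq (sym (toℕ-fromℕ< 0<n)))) here
        toOrigin (suc k) (acc rec) i eq with parent T (suc k) (s≤s z≤n) (subst (_< size T) eq (bound i))
        ... | j , j<i , e = step (trans (cong₂ (adj T) eq (toℕ-fromℕ< j<n)) e)
              (toOrigin j (rec j<i) (fromℕ< j<n) (toℕ-fromℕ< j<n))
          where
          j<n : j < n
          j<n = ℕₚ.<-trans j<i (subst (_< n) eq (toℕ<n i))

      Γ-connected : Connected (Γ n T)
      Γ-connected i j = concat (toOrigin _ (<-wellFounded _) i refl) (reverse (toOrigin _ (<-wellFounded _) j refl))

      Γ-edgeCount : edgeCount (Γ n T) ≡ n
      Γ-edgeCount = halve (trans (sym (handshake (Γ n T) Γ-simple)) (degrees n≡))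
        where
        halve : ∀ {a b} → a + a ≡ b + b → a ≡ b
        halve {a} {b} e = ℕₚ.*-cancelˡ-≡ a b 2 (trans (cong (a +_) (+-identityʳ a)) (trans e (cong (b +_) (sym (+-identityʳ b)))))
        degrees : n ≡ size T → sumFin (degree (Γ n T)) ≡ n + n
        degrees refl = trans (sumFin-cong (degree-Γ T refl)) (trans (sumFin-toℕ (size T) (deg T)) (degreeSum T))

      ring : Fin g → Fin n
      ring i = inject≤ i g≤n

      ring-isCycle : IsCycle (Γ n T) g ring
      ring-isCycle = s≤s (s≤s (s≤s z≤n)) ,
        (λ {i} {j} e → toℕ-injective (trans (sym (toℕ-inject≤ i g≤n)) (trans (cong toℕ e) (toℕ-inject≤ j g≤n)))) ,
        λ i j c → trans (cong₂ (adj T) (toℕ-inject≤ i g≤n) (toℕ-inject≤ j g≤n))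
          (trans (adj-core T (toℕ<n i) (toℕ<n j)) (cong (_∨ (toℕ i ≡ᵇ next (toℕ j)))
            (trans (cong (toℕ j ≡ᵇ_) (sym (consecutive⇒next (toℕ<n j) c))) (≡ᵇ-refl (toℕ j)))))

      ring-degree : ∀ i → toℕ i ≢ 0 → degree (Γ n T) (ring i) ≡ 2
      ring-degree i i≢0 = trans (degree-Γ T n≡ (ring i)) (trans (cong (deg T) (toℕ-inject≤ i g≤n)) (deg-core T (ℕₚ.n≢0⇒n>0 i≢0) (toℕ<n i)))

      private
        argmax : ∀ {k} (f : Fin (suc k) → ℕ) → ∃ λ i → ∀ j → f j ≤ f i
        argmax {zero} f = fzero , λ { fzero → ≤-refl }
        argmax {suc k} f with argmax (f ∘ fsuc)
        ... | i , max with ℕₚ.≤-total (f fzero) (f (fsuc i))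
        ... | inj₁ le = fsuc i , λ { fzero → le ; (fsuc j) → max j }
        ... | inj₂ ge = fzero , λ { fzero → ≤-refl ; (fsuc j) → ≤-trans (max j) ge }

      -- The largest vertex of a cycle has two smaller neighbours, so it lies on the core, where a cycle must go all the way round.
      noShorter : ∀ k → k < g → ¬ HasCycleOfLength (Γ n T) k
      noShorter (suc (suc (suc h′))) k<g (f , _ , f-inj , f-edge) = contradiction (<-≤-trans k<g (injective⇒≤ {f = covering} covering-inj)) (ℕₚ.<-irrefl refl)
        where
        module O = Extract h′
        K : Set
        K = Fin (suc (suc (suc h′)))
        val : K → ℕ
        val i = toℕ (f i)
        val-inj : ∀ {i j} → val i ≡ val j → i ≡ j
        val-inj e = f-inj (toℕ-injective e)
        toSucc : ∀ i → adj T (val i) (val (O.succ i)) ≡ true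
        toSucc i = f-edge i (O.succ i) (O.consecutive-succ i)
        toPred : ∀ i → adj T (val i) (val (O.pred i)) ≡ true
        toPred i = trans (adj-sym T (val i) (val (O.pred i))) (f-edge (O.pred i) i (O.consecutive-pred i))
        distinct : ∀ {v w} → adj T v w ≡ true → w ≢ v
        distinct {v} e refl = true≢false e (adj-irrefl T v)
        top : K
        top = proj₁ (argmax val)
        below-top : ∀ j → val j ≤ val top
        below-top = proj₂ (argmax val)
        top<g : val top < g
        top<g with val top ℕ.<? g
        ... | yes lt = lt
        ... | no nlt = contradiction
              (val-inj (parent-unique T (ℕₚ.≮⇒≥ nlt) (bound (f top))
                (ℕₚ.≤∧≢⇒< (below-top _) (distinct (toSucc top))) (ℕₚ.≤∧≢⇒< (below-top _) (distinct (toPred top))) (toSucc top) (toPred top)))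
              (O.succ≢pred top)
        val<g : ∀ i → val i < g
        val<g i = ≤-<-trans (below-top i) top<g
        options : ∀ i j → adj T (val i) (val j) ≡ true → val j ≡ next (val i) ⊎ val j ≡ prev (val i)
        options i j e with val j ≡ᵇ next (val i) in e₁ | val i ≡ᵇ next (val j) in e₂ | trans (sym (adj-core T (val<g i) (val<g j))) e
        ... | true | _ | _ = inj₁ (≡ᵇ-true e₁)
        ... | false | true | _ = inj₂ (trans (sym (prev-next (val j))) (cong prev (sym (≡ᵇ-true {val i} e₂))))
        ... | false | false | ()
        onward : ∀ i → ∃ λ j → val j ≡ next (val i)
        onward i with options i (O.succ i) (toSucc i) | options i (O.pred i) (toPred i)
        ... | inj₁ e | _ = O.succ i , e
        ... | inj₂ _ | inj₁ e = O.pred i , e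
        ... | inj₂ e | inj₂ e′ = contradiction (val-inj (trans e (sym e′))) (O.succ≢pred i)
        upward : ∀ d i {w} → d + val i ≡ w → w < g → ∃ λ j → val j ≡ w
        upward zero i e _ = i , e
        upward (suc d) i refl w<g with upward d i refl (ℕₚ.<⇒≤ w<g)
        ... | j , e with onward j
        ... | j′ , e′ = j′ , trans e′ (trans (cong next e) (next-suc (s≤s⁻¹ w<g)))
          where
          next-suc : ∀ {v} → v < last → next v ≡ suc v
          next-suc v<last rewrite ≡ᵇ-false (ℕₚ.<⇒≢ v<last) = refl
        atLast : ∃ λ j → val j ≡ last
        atLast = upward (last ∸ val fzero) fzero (ℕₚ.m∸n+n≡m (s≤s⁻¹ (val<g fzero))) (n<1+n last)
        atZero : ∃ λ j → val j ≡ 0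
        atZero with atLast
        ... | j , e with onward j
        ... | j′ , e′ = j′ , trans e′ (trans (cong next e) wrap)
          where
          wrap : next last ≡ 0
          wrap rewrite ≡ᵇ-refl last = refl
        covering : Fin g → K
        covering w = proj₁ (upward (toℕ w) (proj₁ atZero) (trans (cong (toℕ w +_) (proj₂ atZero)) (+-identityʳ _)) (toℕ<n w))
        val-covering : ∀ w → val (covering w) ≡ toℕ w
        val-covering w = proj₂ (upward (toℕ w) (proj₁ atZero) (trans (cong (toℕ w +_) (proj₂ atZero)) (+-identityʳ _)) (toℕ<n w))
        covering-inj : ∀ {v w} → covering v ≡ covering w → v ≡ w
        covering-inj {v} {w} e = toℕ-injective (trans (sym (val-covering v)) (trans (cong val e) (val-covering w)))
      noShorter (suc (suc zero)) _ (_ , s≤s (s≤s ()) , _)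
      noShorter (suc zero) _ (_ , s≤s () , _)
      noShorter zero _ (_ , () , _)

      Γ-member : InU1 n (leaves T) g (Γ n T)
      Γ-member = (((Γ-simple , Γ-connected , Γ-edgeCount) , leafCount-Γ T n≡ , (ring , ring-isCycle) , noShorter)) , ring , ring-isCycle , ring-degree

    member-shape : ∀ {n l} {G : Graph n} → InU1 n l g G → Σ (Tree true) λ T → n ≡ size T × leaves T ≡ l × G ≅ Γ n T
    member-shape {n} {l} {G} (((simple , connected , edges) , leaf# , _) , u , (_ , u-inj , u-edge) , degree2) =
      T , n≡ , trans (sym (leafCount-Γ T n≡)) (trans (sym (leafCount-iso {G = G} {Γ n T} iso)) leaf#) , iso
      where
      -- Degree 2 is used up by the two cycle neighbours.
      closed : ∀ i → toℕ i ≢ 0 → ∀ v → G (u i) v ≡ true → ∃ λ k → v ≡ u k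
      closed i i≢0 v e = [ (succ i ,_) , (pred i ,_) ]′ (count-pair (G (u i)) (degree2 i i≢0) (succ≢pred i ∘ u-inj)
        (u-edge i (succ i) (consecutive-succ i))
        (trans (proj₁ simple (u i) (u (pred i))) (u-edge (pred i) i (consecutive-pred i))) e)
      shape : Shape _
      shape = shapeOf (record { simple = simple ; connected = connected
        ; degrees = trans (handshake G simple) (cong₂ _+_ edges edges)
        ; u = u ; u-injective = u-inj ; u-edge = u-edge ; closed = closed })
      T : Tree true
      T = Shape.T shape
      σ : Fin n ↔ Fin (size T)
      σ = _≃_.bij (number T) ↔-∘ Shape.vertices shape
      n≡ : n ≡ size T
      n≡ = ↔⇒≡ σ
      iso : G ≅ Γ n T
      iso = renumber n≡ σ λ v w → trans (Shape.edges shape v w) (E-pres (number T) _ _)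
        where
        renumber : ∀ {m} → n ≡ m → (σ : Fin n ↔ Fin m) →
          (∀ v w → G v w ≡ adj T (toℕ (Inverse.to σ v)) (toℕ (Inverse.to σ w))) → G ≅ Γ n T
        renumber refl σ e = σ , e

    Γ-~ : ∀ {n} {S T : Tree true} → n ≡ size S → n ≡ size T → S ~ T → Γ n S ≅ Γ n T
    Γ-~ {n} {S} {T} n≡S n≡T e = transport n≡S n≡T (≃-trans (≃-sym (number S)) (≃-trans (⟪⟫-~ e) (number T)))
      where
      renumber : ∀ {n a b} → n ≡ a → n ≡ b → (σ : Fin a ↔ Fin b) →
        (∀ v w → adj S (toℕ v) (toℕ w) ≡ adj T (toℕ (Inverse.to σ v)) (toℕ (Inverse.to σ w))) → Γ n S ≅ Γ n T
      renumber refl refl σ e = σ , e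
      transport : n ≡ size S → n ≡ size T → numbered S ≃ numbered T → Γ n S ≅ Γ n T
      transport n≡S n≡T f = renumber n≡S n≡T (_≃_.bij f) (E-pres f)

-- The edge lists of U^{g,q} draw the kites.

module EdgeLists where

  open import Data.Nat using (ℕ; zero; suc; _+_; _∸_; _≤_; _<_; z≤n; s≤s; s≤s⁻¹; _≡ᵇ_; _<ᵇ_)
  open import Data.Nat.Properties as ℕₚ using (≤-trans; +-comm; +-assoc; +-identityʳ; +-suc; <⇒≢; m≤m+n)
  open import Data.Bool using (Bool; true; false; _∧_; _∨_)
  open import Data.Bool.Properties using (∧-zeroʳ; ∨-comm; ∨-assoc; ∨-identityʳ)
  open import Data.Fin using (toℕ)
  open import Data.Fin.Properties using (toℕ<n)
  open import Data.List using (List; []; _∷_; _++_; map; upTo)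
  open import Data.List.Properties using (map-applyUpTo)
  open import Data.Product using (_×_; _,_)
  open import Data.Sum using (_⊎_; inj₁; inj₂)
  open import Function using (id)
  open import Relation.Binary.PropositionalEquality
  open import Relation.Nullary using (contradiction)
  open import Defs
  open Trees
  open Balanced
  open Adjacency
  open Laplacian
  open Members using (side; left; right)
  open Reduction using (extra-path)

  joins : ℕ → ℕ → ℕ → ℕ → Bool
  joins x y a b = ((x ≡ᵇ a) ∧ (y ≡ᵇ b)) ∨ ((x ≡ᵇ b) ∧ (y ≡ᵇ a))

  hasEdge-++ : ∀ es es′ a b → hasEdge (es ++ es′) a b ≡ hasEdge es a b ∨ hasEdge es′ a b
  hasEdge-++ [] es′ a b = refl
  hasEdge-++ ((x , y) ∷ es) es′ a b = trans (cong (joins x y a b ∨_) (hasEdge-++ es es′ a b)) (sym (∨-assoc (joins x y a b) _ _))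

  hasEdge-sym : ∀ es a b → hasEdge es a b ≡ hasEdge es b a
  hasEdge-sym [] a b = refl
  hasEdge-sym ((x , y) ∷ es) a b = cong₂ _∨_ (∨-comm ((x ≡ᵇ a) ∧ (y ≡ᵇ b)) _) (hasEdge-sym es a b)

  joins-miss : ∀ {x y a} b → x ≢ a → y ≢ a → joins x y a b ≡ false
  joins-miss {x} {y} {a} b ne ne′ rewrite ≡ᵇ-false ne | ≡ᵇ-false ne′ = ∧-zeroʳ (x ≡ᵇ b)

  module Drawing (h : ℕ) where
    open Sizes h
    open Adjacent h
    open Realize h

    -- The edge list es is the tree T with its vertices numbered s, s + 1, ….
    record Draws {b} (es : List (ℕ × ℕ)) (s : ℕ) (T : Tree b) : Set where
      field
        inside : ∀ i j → i < size T → j < size T → hasEdge es (s + i) (s + j) ≡ adj T i j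
        outside : ∀ a b → a < s ⊎ s + size T ≤ a → hasEdge es a b ≡ false
    open Draws

    draws-resp : ∀ {b es es′ s} {T : Tree b} → (∀ a b → hasEdge es a b ≡ hasEdge es′ a b) → Draws es s T → Draws es′ s T
    draws-resp e d = record { inside = λ i j hi hj → trans (sym (e _ _)) (inside d i j hi hj)
                            ; outside = λ a b o → trans (sym (e a b)) (outside d a b o) }

    draws-leaf : ∀ s → Draws [] s leaf
    draws-leaf s = record { inside = λ _ _ _ _ → refl ; outside = λ _ _ _ → refl }

    -- Two drawings on adjacent intervals of labels plus one edge between the first labels draw the
    -- composite; `outside` excludes stray edges of one list among the labels of the other.
    draws-◁ : ∀ {b es es′ s} {S : Tree b} {T} → Draws es s S → Draws es′ (s + size S) T →
      Draws ((s , s + size S) ∷ es ++ es′) s (S ◁ T)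
    draws-◁ {b} {es} {es′} {s} {S} {T} dS dT = record { inside = ins ; outside = out }
      where
      a : ℕ
      a = size S
      all : List (ℕ × ℕ)
      all = (s , s + a) ∷ es ++ es′
      expand : ∀ u v → hasEdge all u v ≡ joins s (s + a) u v ∨ (hasEdge es u v ∨ hasEdge es′ u v)
      expand u v = cong (joins s (s + a) u v ∨_) (hasEdge-++ es es′ u v)
      at-root : ∀ i → (s ≡ᵇ s + i) ≡ (i ≡ᵇ 0)
      at-root i = trans (cong (_≡ᵇ s + i) (sym (+-identityʳ s))) (trans (≡ᵇ-+ s 0 i) (≡ᵇ-sym 0 i))
      low : ∀ {j} → j < a → (s + a ≡ᵇ s + j) ≡ false
      low {j} hj = trans (≡ᵇ-+ s a j) (≡ᵇ-false (λ e → <⇒≢ hj (sym e)))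
      beyond : ∀ j → s + size S + j ≡ s + (a + j)
      beyond j = +-assoc s a j
      mixed : ∀ i j → i < a → hasEdge all (s + i) (s + (a + j)) ≡ (i ≡ᵇ 0) ∧ (j ≡ᵇ 0)
      mixed i j hi = trans (expand (s + i) (s + (a + j))) (trans
        (cong₂ _∨_ (cong₂ _∨_ (cong₂ _∧_ (at-root i) (trans (≡ᵇ-+ s a (a + j)) (trans (cong (_≡ᵇ a + j) (sym (+-identityʳ a))) (trans (≡ᵇ-+ a 0 j) (≡ᵇ-sym 0 j)))))
                                   (cong (_∧ (s + a ≡ᵇ s + i)) (at-root (a + j))))
          (cong₂ _∨_ (trans (hasEdge-sym es (s + i) _) (outside dS _ _ (inj₂ (ℕₚ.+-monoʳ-≤ s (m≤m+n a j)))))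
                     (outside dT _ _ (inj₁ (ℕₚ.+-monoʳ-< s hi)))))
        (trans (∨-identityʳ _) (∨-identityʳ _)))
      ins : ∀ i j → i < size (S ◁ T) → j < size (S ◁ T) → hasEdge all (s + i) (s + j) ≡ adj (S ◁ T) i j
      ins i j hi hj with side a i | side a j
      ... | left li | left lj = trans (expand (s + i) (s + j)) (trans
            (cong₂ _∨_ (cong₂ _∨_ (trans (cong ((s ≡ᵇ s + i) ∧_) (low lj)) (∧-zeroʳ _)) (trans (cong ((s ≡ᵇ s + j) ∧_) (low li)) (∧-zeroʳ _)))
              (cong₂ _∨_ (inside dS i j li lj) (outside dT _ _ (inj₁ (ℕₚ.+-monoʳ-< s li)))))
            (trans (∨-identityʳ _) (sym (adj-ll S T li lj))))
      ... | left li | right j′ = trans (mixed i j′ li) (sym (adj-lr S T j′ li))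
      ... | right i′ | left lj = trans (hasEdge-sym all (s + (a + i′)) (s + j)) (trans (mixed j i′ lj) (sym (adj-rl S T i′ lj)))
      ... | right i′ | right j′ = trans (expand (s + (a + i′)) (s + (a + j′))) (trans
            (cong₂ _∨_ (cong₂ _∨_ (cong (_∧ (s + a ≡ᵇ s + (a + j′))) (at-root (a + i′))) (cong (_∧ (s + a ≡ᵇ s + (a + i′))) (at-root (a + j′))))
              (cong₂ _∨_ (outside dS _ _ (inj₂ (ℕₚ.+-monoʳ-≤ s (m≤m+n a i′))))
                (trans (cong₂ (hasEdge es′) (sym (beyond i′)) (sym (beyond j′))) (inside dT i′ j′ (ℕₚ.+-cancelˡ-< a _ _ hi) (ℕₚ.+-cancelˡ-< a _ _ hj)))))
            (sym (adj-rr S T i′ j′)))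
      out : ∀ u v → u < s ⊎ s + size (S ◁ T) ≤ u → hasEdge all u v ≡ false
      out u v o = trans (expand u v) (cong₂ _∨_ (joins-miss v (≢s o) (≢sa o)) (cong₂ _∨_ (outside dS u v (forS o)) (outside dT u v (forT o))))
        where
        ≢s : u < s ⊎ s + size (S ◁ T) ≤ u → s ≢ u
        ≢s (inj₁ lt) e = <⇒≢ lt (sym e)
        ≢s (inj₂ ge) e = <⇒≢ (≤-trans (ℕₚ.m<m+n s (s≤s z≤n)) ge) e
        ≢sa : u < s ⊎ s + size (S ◁ T) ≤ u → s + a ≢ u
        ≢sa (inj₁ lt) e = <⇒≢ (≤-trans lt (m≤m+n s a)) (sym e)
        ≢sa (inj₂ ge) e = <⇒≢ (≤-trans (ℕₚ.+-monoʳ-< s (ℕₚ.m<m+n a (s≤s z≤n))) ge) e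
        forS : u < s ⊎ s + size (S ◁ T) ≤ u → u < s ⊎ s + a ≤ u
        forS (inj₁ lt) = inj₁ lt
        forS (inj₂ ge) = inj₂ (≤-trans (ℕₚ.+-monoʳ-≤ s (m≤m+n a (size T))) ge)
        forT : u < s ⊎ s + size (S ◁ T) ≤ u → u < s + a ⊎ s + a + size T ≤ u
        forT (inj₁ lt) = inj₁ (≤-trans lt (m≤m+n s a))
        forT (inj₂ ge) = inj₂ (subst (_≤ u) (sym (+-assoc s a (size T))) ge)

    draws-path : ∀ s k → Draws (chainEdges s (suc k)) s (path k)
    draws-path s zero = draws-leaf s
    draws-path s (suc k) = subst (λ t → Draws ((s , t) ∷ chainEdges t (suc k)) s (path (suc k))) (+-comm s 1)
      (draws-◁ (draws-leaf s) (draws-path (s + 1) k))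

    draws-◁◁ : ∀ {b es s} {S : Tree b} ks → Draws es s S → Draws (es ++ branchEdges s (s + size S) (map suc ks)) s (S ◁◁ ks)
    draws-◁◁ {es = es} [] d = draws-resp (λ a b → sym (trans (hasEdge-++ es [] a b) (∨-identityʳ _))) d
    draws-◁◁ {es = es} {s} {S} (k ∷ ks) d = draws-resp rearrange
      (draws-◁◁ ks (draws-◁ d (draws-path (s + size S) k)))
      where
      t : ℕ
      t = s + size S
      later : s + size (S ◁ path k) ≡ t + suc k
      later = trans (cong (λ e → s + suc (extra S + suc e)) (extra-path h k)) (sym (+-assoc s (size S) (suc k)))
      shuffle : ∀ o e c b → (o ∨ (e ∨ c)) ∨ b ≡ e ∨ ((o ∨ c) ∨ b)
      shuffle true true c b = refl
      shuffle true false c b = refl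
      shuffle false e c b = ∨-assoc e c b
      rearrange : ∀ a b → hasEdge (((s , t) ∷ es ++ chainEdges t (suc k)) ++ branchEdges s (s + size (S ◁ path k)) (map suc ks)) a b
        ≡ hasEdge (es ++ branchEdges s t (map suc (k ∷ ks))) a b
      rearrange a b = trans (hasEdge-++ ((s , t) ∷ es ++ chainEdges t (suc k)) _ a b)
        (trans (cong₂ _∨_ (cong (joins s t a b ∨_) (hasEdge-++ es (chainEdges t (suc k)) a b)) (cong (λ v → hasEdge (branchEdges s v (map suc ks)) a b) later))
        (trans (shuffle (joins s t a b) (hasEdge es a b) (hasEdge (chainEdges t (suc k)) a b) _)
        (sym (trans (hasEdge-++ es (branchEdges s t (map suc (k ∷ ks))) a b) (cong (hasEdge es a b ∨_) (hasEdge-++ ((s , t) ∷ chainEdges t (suc k)) _ a b))))))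

    draws-broom : ∀ s d ks → Draws (chainEdges s (suc d) ++ branchEdges (s + d) (s + suc d) (map suc ks)) s (broom d ks)
    draws-broom s zero ks = subst (λ c → Draws (branchEdges c (s + 1) (map suc ks)) s (leaf ◁◁ ks)) (sym (+-identityʳ s)) (draws-◁◁ ks (draws-leaf s))
    draws-broom s (suc d) ks = subst (λ es → Draws es s (broom (suc d) ks)) renumber (draws-◁ (draws-leaf s) (draws-broom (s + 1) d ks))
      where
      renumber : (s , s + 1) ∷ chainEdges (s + 1) (suc d) ++ branchEdges (s + 1 + d) (s + 1 + suc d) (map suc ks)
        ≡ (s , suc s) ∷ chainEdges (suc s) (suc d) ++ branchEdges (s + suc d) (s + suc (suc d)) (map suc ks)
      renumber rewrite +-comm s 1 | +-suc s (suc d) | +-suc s d = refl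

    private
      R : ℕ → ℕ → ℕ → Bool
      R m a b = ((a <ᵇ m) ∧ (suc a ≡ᵇ b)) ∨ ((b <ᵇ m) ∧ (suc b ≡ᵇ a))

      both-suc : ℕ × ℕ → ℕ × ℕ
      both-suc (x , y) = suc x , suc y

      both-suc-0 : ∀ es b → hasEdge (map both-suc es) 0 b ≡ false
      both-suc-0 [] b = refl
      both-suc-0 ((x , y) ∷ es) b = cong₂ _∨_ (∧-zeroʳ (suc x ≡ᵇ b)) (both-suc-0 es b)

      both-suc-suc : ∀ es a b → hasEdge (map both-suc es) (suc a) (suc b) ≡ hasEdge es a b
      both-suc-suc [] a b = refl
      both-suc-suc ((x , y) ∷ es) a b = cong (joins x y a b ∨_) (both-suc-suc es a b)

      rungs : ℕ → List (ℕ × ℕ)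
      rungs m = map (λ i → (i , suc i)) (upTo m)

      rungs-suc : ∀ m → rungs (suc m) ≡ (0 , 1) ∷ map both-suc (rungs m)
      rungs-suc m = cong ((0 , 1) ∷_) (trans (map-applyUpTo suc (λ i → (i , suc i)) m)
        (sym (trans (cong (map both-suc) (map-applyUpTo id (λ i → (i , suc i)) m)) (map-applyUpTo (λ i → (i , suc i)) both-suc m))))

      hasEdge-rungs : ∀ m a b → hasEdge (rungs m) a b ≡ R m a b
      hasEdge-rungs zero a b = refl
      hasEdge-rungs (suc m) a b = trans (cong (λ es → hasEdge es a b) (rungs-suc m)) (cases a b)
        where
        at-0 : ∀ b → hasEdge ((0 , 1) ∷ map both-suc (rungs m)) 0 (suc b) ≡ R (suc m) 0 (suc b)
        at-0 b = trans (cong (((0 ≡ᵇ b) ∨ false) ∨_) (both-suc-0 (rungs m) (suc b)))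
          (trans (∨-identityʳ _) (cong ((0 ≡ᵇ b) ∨_) (sym (∧-zeroʳ (b <ᵇ m)))))
        cases : ∀ a b → hasEdge ((0 , 1) ∷ map both-suc (rungs m)) a b ≡ R (suc m) a b
        cases zero zero = both-suc-0 (rungs m) 0
        cases zero (suc b) = at-0 b
        cases (suc a) zero = trans (hasEdge-sym ((0 , 1) ∷ map both-suc (rungs m)) (suc a) 0) (trans (at-0 a) (∨-comm (0 ≡ᵇ a) _))
        cases (suc a) (suc b) = trans (both-suc-suc (rungs m) a b) (hasEdge-rungs m a b)

    draws-cyc : Draws (cycleEdges (suc last)) 0 cyc
    draws-cyc = record { inside = ins ; outside = out }
      where
      <ᵇ-irrefl : ∀ m → (m <ᵇ m) ≡ false
      <ᵇ-irrefl zero = refl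
      <ᵇ-irrefl (suc m) = <ᵇ-irrefl m
      half : ∀ i j → i < suc last → ((last ≡ᵇ i) ∧ (0 ≡ᵇ j)) ∨ ((i <ᵇ last) ∧ (suc i ≡ᵇ j)) ≡ (j ≡ᵇ next i)
      half i j hi with i ≡ᵇ last in e
      ... | true rewrite ≡ᵇ-true {i} e | ≡ᵇ-refl last | <ᵇ-irrefl last = trans (∨-identityʳ _) (≡ᵇ-sym 0 j)
      ... | false rewrite ≡ᵇ-sym last i | e | <ᵇ-true (ℕₚ.≤∧≢⇒< (s≤s⁻¹ hi) (λ { refl → contradiction (trans (sym (≡ᵇ-refl last)) e) λ () })) = ≡ᵇ-sym (suc i) j
      shuffle : ∀ p q r s → (p ∨ q) ∨ (r ∨ s) ≡ (p ∨ r) ∨ (q ∨ s)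
      shuffle true q r s = refl
      shuffle false true true s = refl
      shuffle false true false s = refl
      shuffle false false r s = refl
      ins : ∀ i j → i < suc last → j < suc last → hasEdge (cycleEdges (suc last)) i j ≡ adj cyc i j
      ins i j hi hj = trans (cong (joins last 0 i j ∨_) (hasEdge-rungs last i j))
        (trans (shuffle ((last ≡ᵇ i) ∧ (0 ≡ᵇ j)) _ _ _) (cong₂ _∨_ (half i j hi) (half j i hj)))
      out : ∀ a b → a < 0 ⊎ suc last ≤ a → hasEdge (cycleEdges (suc last)) a b ≡ false
      out a b (inj₂ ge) = trans (cong (joins last 0 a b ∨_) (hasEdge-rungs last a b))
        (cong₂ _∨_ (joins-miss b (<⇒≢ ge) (<⇒≢ (≤-trans (s≤s z≤n) ge)))
          (cong₂ _∨_ (cong (_∧ (suc a ≡ᵇ b)) (not-below a ge)) far))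
        where
        not-below : ∀ a → suc last ≤ a → (a <ᵇ last) ≡ false
        not-below a ge = subst (λ a → (a <ᵇ last) ≡ false) (ℕₚ.m+[n∸m]≡n (ℕₚ.<⇒≤ ge)) (<ᵇ-false last (a ∸ last))
        far : (b <ᵇ last) ∧ (suc b ≡ᵇ a) ≡ false
        far with suc b ≡ᵇ a in e
        ... | false = ∧-zeroʳ _
        ... | true = cong (_∧ true) (subst (λ a → (a <ᵇ last) ≡ false) (ℕₚ.m+[n∸m]≡n last≤b) (<ᵇ-false last (b ∸ last)))
          where
          last≤b : last ≤ b
          last≤b = s≤s⁻¹ (subst (suc last ≤_) (sym (≡ᵇ-true {suc b} e)) ge)

    draws-kite : ∀ q ks → Draws (cycleEdges (suc last) ++ pathEdges (suc last) q
        ++ branchEdges (centerLabel (suc last) q) (suc last + q) (map suc ks)) 0 (kite q ks)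
    draws-kite zero ks = subst (λ t → Draws (cycleEdges (suc last) ++ branchEdges 0 t (map suc ks)) 0 (kite 0 ks)) (sym (+-identityʳ (suc last)))
      (draws-◁◁ ks draws-cyc)
    draws-kite (suc q) ks = draws-resp rearrange (draws-◁ draws-cyc (draws-broom (suc last) q ks))
      where
      C P : List (ℕ × ℕ)
      C = cycleEdges (suc last)
      P = chainEdges (suc last) (suc q) ++ branchEdges (suc last + q) (suc last + suc q) (map suc ks)
      shuffle : ∀ o e p → o ∨ (e ∨ p) ≡ e ∨ (o ∨ p)
      shuffle true true p = refl
      shuffle true false p = refl
      shuffle false e p = refl
      rearrange : ∀ a b → hasEdge ((0 , suc last) ∷ C ++ P) a b ≡ hasEdge (C ++ (0 , suc last) ∷ P) a b
      rearrange a b = trans (cong (joins 0 (suc last) a b ∨_) (hasEdge-++ C P a b))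
        (trans (shuffle (joins 0 (suc last) a b) (hasEdge C a b) (hasEdge P a b)) (sym (hasEdge-++ C ((0 , suc last) ∷ P) a b)))

    -- Labels and tree numbering coincide, so the graphs agree pointwise and not just up to
    -- isomorphism. The condition l ≤ r rules out empty branches, which the encoding of branches as
    -- k + 1 vertices cannot express.
    U-Γ : ∀ {n l q r} → n ≡ suc last + (q + r) → n ≡ size (kite q (bal r l)) → 1 ≤ l → l ≤ r →
      ∀ i j → U n l (suc last) q i j ≡ Γ n (kite q (bal r l)) i j
    U-Γ {n} {l} {q} {r} n≡ n≡size 1≤l l≤r i j with toℕ i ≡ᵇ toℕ j in e
    ... | true = sym (trans (cong (adj (kite q (bal r l)) (toℕ i)) (sym (≡ᵇ-true e))) (adj-irrefl (kite q (bal r l)) (toℕ i)))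
    ... | false = trans (cong (λ os → hasEdge (cycleEdges (suc last) ++ pathEdges (suc last) q ++ branchEdges (centerLabel (suc last) q) (suc last + q) os) (toℕ i) (toℕ j)) orders)
      (inside (draws-kite q (bal r l)) (toℕ i) (toℕ j) (subst (toℕ i <_) n≡size (toℕ<n i)) (subst (toℕ j <_) n≡size (toℕ<n j)))
      where
      orders : branchOrders (n ∸ suc last ∸ q) l ≡ map suc (bal r l)
      orders = trans (cong (λ m → branchOrders m l) (trans (cong (λ n → n ∸ suc last ∸ q) n≡)
        (trans (cong (_∸ q) (ℕₚ.m+n∸m≡n (suc last) (q + r))) (ℕₚ.m+n∸m≡n q r)))) (branchOrders-bal r l 1≤l l≤r)

-- Pairwise incomparability of the admissible kites.

module Kites where

  open import Data.Nat as ℕ using (ℕ; zero; suc; z≤n; s≤s; _∸_)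
  import Data.Nat.Properties as ℕₚ
  open import Data.Integer using (ℤ; +_; -_; _+_; _*_; _≤_; _<_; +≤+; +<+)
  open import Data.Integer.Properties
  open import Data.Integer.Tactic.RingSolver using (solve-∀)
  open import Data.List using (List; []; _∷_; length; replicate; _++_)
  open import Data.List.Properties using (++-identityʳ)
  open import Data.List.Relation.Binary.Permutation.Propositional using (_↭_; ↭-trans; ↭-sym; ↭-refl; ↭-reflexive; prep)
  open import Data.List.Relation.Binary.Permutation.Propositional.Properties using (↭-length; shift)
  open import Data.Product using (_×_; _,_; proj₁; proj₂)
  open import Relation.Binary.Definitions using (Tri; tri<; tri≈; tri>)
  open import Relation.Binary.PropositionalEquality
  open import Relation.Nullary using (contradiction)
  open import Defs
  open PolyRing using (_≈P_; at; ev; ev-+; ev-*; ev-cong; ev-nonneg; coeff-+; coeff-*; Alternating; 0<*)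
  open Balanced
  open Laplacian
  open Weights
  open Reduction

  -- One more vertex lengthens one shortest branch and nothing else. The balanced lists of U^{g,q+1}
  -- and U^{g,q} are therefore related as `Φ-compare` requires, and `smallest` bounds the length of
  -- that branch from below.
  record Promotion (r l : ℕ) : Set where
    field
      k : ℕ
      rest : List ℕ
      before : bal r l ↭ k ∷ rest
      after : bal (suc r) l ↭ suc k ∷ rest
      smallest : ∀ b → l ℕ.* b ℕ.≤ r → b ℕ.≤ suc k

  promote : ∀ r l → 1 ℕ.≤ l → l ℕ.≤ r → Promotion r l
  promote r l 1≤l l≤r with bal-is-level r l 1≤l l≤r
  ... | c , m , j , refl , refl = record
    { k = c ; rest = rest ; before = ↭-trans (↭-reflexive (bal-level c m j)) front
    ; after = ↭-sym (subst₂ (λ t l → suc c ∷ rest ↭ bal t l) (cong suc (sym (total-↭ front))) (sym (↭-length front)) (canonical j))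
    ; smallest = λ b h → ℕ.s≤s⁻¹ (ℕₚ.*-cancelˡ-< (m ℕ.+ suc j) b (suc (suc c)) (ℕₚ.≤-<-trans (subst₂ (λ l r → l ℕ.* b ℕ.≤ r) (length-level c m j) (total-level c m j) h)
        (subst (m ℕ.+ (m ℕ.+ suc j) ℕ.* suc c ℕ.<_) (sym (ℕₚ.*-suc (m ℕ.+ suc j) (suc c))) (ℕₚ.+-monoˡ-< _ (ℕₚ.m<m+n m (s≤s z≤n)))))) }
    where
    rest : List ℕ
    rest = replicate m (suc c) ++ replicate j c
    front : level c m j ↭ c ∷ rest
    front = shift c (replicate m (suc c)) (replicate j c)
    -- For j = 0 the last entry c is raised and the list becomes constant with value c + 1;
    -- otherwise c remains the minimum.
    canonical : ∀ j → let rest = replicate m (suc c) ++ replicate j c in suc c ∷ rest ↭ bal (suc (total (c ∷ rest))) (suc (length rest))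
    canonical zero = bal-unique {c = suc c} {0} {m} (prep (suc c) (↭-reflexive (++-identityʳ (replicate m (suc c)))))
    canonical (suc j) = bal-unique {c = c} {suc m} {j} ↭-refl

  module KiteOrder (h l N : ℕ) (2≤l : 2 ℕ.≤ l) where
    open WeightAlgebra polyCone using (x; s; p; t; p-t; N-s; P-s; P-p; legs; good-legs; P⇒N; N-0; N-+; N-*; P-+; P-*; P)
      renaming (B to wB; N to NN; +-comm to +P-comm)
    open WeightAlgebra.Good using (goodB)
    open WeightAlgebra.Cycle polyCone h using (G; Φ; E; Φ-compare)
    open Reduce polyCone h using (Φ-↭)
    open PolyRing using (≈trans; ≈refl; +P-cong)

    Admissible : ℕ → Set
    Admissible q = q ℕ.+ l ℕ.* (q ℕ.+ G) ℕ.≤ N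

    1≤l : 1 ℕ.≤ l
    1≤l = ℕₚ.<⇒≤ 2≤l

    admissible-≤ : ∀ {q q′} → q ℕ.≤ q′ → Admissible q′ → Admissible q
    admissible-≤ h = ℕₚ.≤-trans (ℕₚ.+-mono-≤ h (ℕₚ.*-monoʳ-≤ l (ℕₚ.+-monoˡ-≤ G h)))

    roomy : ∀ {q r} → Admissible q → q ℕ.+ r ≡ N → l ℕ.* (q ℕ.+ G) ℕ.≤ r
    roomy {q} adm refl = ℕₚ.+-cancelˡ-≤ q _ _ adm

    l≤r : ∀ {q r} → Admissible q → q ℕ.+ r ≡ N → l ℕ.≤ r
    l≤r {q} adm e = ℕₚ.≤-trans (ℕₚ.≤-trans (ℕₚ.≤-reflexive (sym (ℕₚ.*-identityʳ l))) (ℕₚ.*-monoʳ-≤ l (ℕₚ.≤-trans (s≤s z≤n) (ℕₚ.m≤n+m G q)))) (roomy {q} adm e)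

    record Compared (q r : ℕ) : Set where
      field
        i : ℕ
        i-large : suc G ℕ.≤ i
        k : ℕ
        ks : List ℕ
        difference : Φ (suc q) (bal r l) +P x *P (x *P (E (k ∷ ks) *P (s i *P s (suc G))))
          ≈P Φ q (bal (suc r) l) +P x *P (x *P (E (k ∷ ks) *P ((t G +P t G) *P p i)))

    compared : ∀ {q r} → Admissible (suc q) → suc q ℕ.+ r ≡ N → Compared q r
    compared {q} {r} adm e with promote r l 1≤l (l≤r {suc q} adm e)
    ... | record { k = k ; rest = [] ; before = b } =
          contradiction (subst (2 ℕ.≤_) (trans (sym (length-bal r l 1≤l (l≤r {suc q} adm e))) (↭-length b)) 2≤l) λ { (s≤s ()) }
    ... | record { k = k ; rest = j ∷ js ; before = b ; after = a ; smallest = sm } = record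
      { i = suc k ∸ q ; i-large = ℕₚ.+-cancelʳ-≤ q (suc G) _ (subst (suc G ℕ.+ q ℕ.≤_) (sym k-split) large)
      ; k = j ; ks = js
      ; difference = ≈trans (+P-cong (Φ-↭ (suc q) b) ≈refl)
          (≈trans (Φ-compare q (suc k ∸ q) k (j ∷ js) (sym k-split)) (+P-cong (Φ-↭ q (↭-sym a)) ≈refl)) }
      where
      -- Admissibility of q + 1 gives the shortest branch k + 1 ≥ q + 1 + G vertices, hence i = k +
      -- 1 - q exceeds G.
      large : suc G ℕ.+ q ℕ.≤ suc k
      large = subst (ℕ._≤ suc k) (cong suc (ℕₚ.+-comm q G)) (sm (suc q ℕ.+ G) (roomy {suc q} adm e))
      k-split : suc k ∸ q ℕ.+ q ≡ suc k
      k-split = ℕₚ.m∸n+n≡m (ℕₚ.≤-trans (ℕₚ.m≤n+m q (suc G)) large)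

    N-E : ∀ ks → NN (E ks)
    N-E [] = N-0
    N-E (k ∷ ks) = N-+ {s (suc k) *P wB (legs ks)} {p (suc k) *P E ks} (N-* {s (suc k)} {wB (legs ks)} (N-s (suc k)) (P⇒N {wB (legs ks)} (goodB (good-legs ks)))) (N-* {p (suc k)} {E ks} (P⇒N {p (suc k)} (P-p (suc k))) (N-E ks))

    P-E : ∀ k ks → P (E (k ∷ ks))
    P-E k ks = P-+ {s (suc k) *P wB (legs ks)} {p (suc k) *P E ks} (P-* {s (suc k)} {wB (legs ks)} (P-s k) (goodB (good-legs ks))) (N-* {p (suc k)} {E ks} (P⇒N {p (suc k)} (P-p (suc k))) (N-E ks))

    private
      undo : ∀ a c → a + c + - c ≡ a
      undo = solve-∀

      trade-< : ∀ {a b c d} → a + c ≡ b + d → c < d → b < a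
      trade-< {a} {b} {c} {d} eq c<d = subst₂ _<_ (undo b c) (undo a c) (+-monoˡ-< (- c) (subst (b + c <_) (sym eq) (+-monoʳ-< b c<d)))

      scaled : ∀ {e a b} → + 0 < e → a < b → e * a < e * b
      scaled {+ suc e} _ lt = *-monoˡ-<-pos (+ suc e) lt
      scaled {+ zero} (+<+ ()) _

      <-from : ∀ {i j} d → + 0 < d → j ≡ i + d → i < j
      <-from {i} d pos e = subst₂ _<_ (+-identityʳ i) (sym e) (+-monoʳ-< i pos)

      -- The letters are the values at 4 of p(i-1), s(i), p(G-1), s(G) and t(G), the equation is
      -- p(G) = 1 + x t(G), and the claim is s(i) s(G+1) < 2 t(G) p(i). Both products have the same
      -- degree in x with leading coefficients 1 and 2, so a large x decides. Multiplying by 4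
      -- eliminates τ; with b and σ written as successors the difference is the visibly positive
      -- `D`.
      cross< : ∀ {a s b σ τ} → + 0 < a → + 0 ≤ s → + 0 < b → + 0 < σ → b + + 4 * σ ≡ + 1 + + 4 * τ →
        s * (σ + (b + + 4 * σ)) < (τ + τ) * (a + + 4 * s)
      cross< {+ suc a} {+ s} {+ suc b} {+ suc σ} {τ} _ _ _ _ eq = *-cancelˡ-<-nonNeg (+ 4)
        (<-from D D-pos (trans (twist τ (+ suc a) (+ s)) (trans (cong (λ z → (z + z) * (+ suc a + + 4 * + s)) four-τ) (expand (+ suc a) (+ s) (+ b) (+ σ)))))
        where
        D : ℤ
        D = + 2 * + suc a * (+ b + + 4 * + σ + + 4) + + s * (+ 4 * + b + + 12 * + σ + + 8)
        D-pos : + 0 < D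
        D-pos = +-mono-<-≤ (0<* {+ 2 * + suc a} (0<* {+ 2} {+ suc a} (+<+ (s≤s z≤n)) (+<+ (s≤s z≤n)))
            (+-mono-≤-< (+-mono-≤ (+≤+ z≤n) (0≤4* σ)) (+<+ (s≤s z≤n))))
          (0≤s* s (+-mono-≤ (+-mono-≤ (0≤4* b) (0≤12* σ)) (+≤+ z≤n)))
          where
          0≤4* : ∀ n → + 0 ≤ + 4 * + n
          0≤4* n = subst (+ 0 ≤_) (pos-* 4 n) (+≤+ z≤n)
          0≤12* : ∀ n → + 0 ≤ + 12 * + n
          0≤12* n = subst (+ 0 ≤_) (pos-* 12 n) (+≤+ z≤n)
          0≤s* : ∀ s {y} → + 0 ≤ y → + 0 ≤ + s * y
          0≤s* s {+ y} _ = subst (+ 0 ≤_) (pos-* s y) (+≤+ z≤n)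
        four-τ : + 4 * τ ≡ + b + + 4 * + σ + + 4
        four-τ = trans (sym (drop-one (+ 4 * τ))) (trans (cong (λ z → z + - + 1) (trans (sym eq) (shift-one (+ b) (+ σ)))) (drop-one (+ b + + 4 * + σ + + 4)))
          where
          drop-one : ∀ i → + 1 + i + - + 1 ≡ i
          drop-one = solve-∀
          shift-one : ∀ b σ → (+ 1 + b) + + 4 * (+ 1 + σ) ≡ + 1 + (b + + 4 * σ + + 4)
          shift-one = solve-∀
        twist : ∀ τ a s → + 4 * ((τ + τ) * (a + + 4 * s)) ≡ (+ 4 * τ + + 4 * τ) * (a + + 4 * s)
        twist = solve-∀
        expand : ∀ a s b σ → ((b + + 4 * σ + + 4) + (b + + 4 * σ + + 4)) * (a + + 4 * s)
          ≡ + 4 * (s * ((+ 1 + σ) + ((+ 1 + b) + + 4 * (+ 1 + σ)))) + (+ 2 * a * (b + + 4 * σ + + 4) + s * (+ 4 * b + + 12 * σ + + 8))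
        expand = solve-∀
      cross< {+ zero} (+<+ ()) _ _ _ _
      cross< {+ suc a} {+ s} {+ zero} _ _ (+<+ ()) _ _
      cross< {+ suc a} {+ s} {+ suc b} {+ zero} _ _ _ (+<+ ()) _

      ev-p-suc : ∀ n → ev (p (suc n)) ≡ ev (p n) + + 4 * ev (s (suc n))
      ev-p-suc n = trans (ev-+ (p n) (x *P s (suc n))) (cong (λ z → ev (p n) + z) (ev-* x (s (suc n))))

      ev-pos : ∀ {q} → P q → + 0 < ev q
      ev-pos = proj₂

      ev-nn : ∀ {q} → NN q → + 0 ≤ ev q
      ev-nn {q} nq = subst (+ 0 ≤_) (*-identityˡ (ev q)) (ev-nonneg 0 q nq)

    ev-increases : ∀ {q r} → Compared q r → ev (Φ q (bal (suc r) l)) < ev (Φ (suc q) (bal r l))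
    ev-increases {q} {r} c = go i i-large difference
      where
      open Compared c
      e : Poly
      e = E (k ∷ ks)
      expand : ∀ f y → ev (f +P x *P (x *P (e *P y))) ≡ ev f + + 4 * (+ 4 * (ev e * ev y))
      expand f y = trans (ev-+ f (x *P (x *P (e *P y)))) (cong (λ z → ev f + z) (trans (ev-* x (x *P (e *P y)))
        (cong (λ z → + 4 * z) (trans (ev-* x (e *P y)) (cong (λ z → + 4 * z) (ev-* e y))))))
      lower-half : ∀ i → suc G ℕ.≤ i → ev (s i *P s (suc G)) < ev ((t G +P t G) *P p i)
      lower-half (suc i) _ = subst₂ _<_
        (sym (trans (ev-* (s (suc i)) (s (suc G))) (cong (λ z → ev (s (suc i)) * z) (trans (ev-+ (s G) (p G)) (cong (λ z → ev (s G) + z) (ev-p-suc (suc h)))))))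
        (sym (trans (ev-* (t G +P t G) (p (suc i))) (cong₂ _*_ (ev-+ (t G) (t G)) (ev-p-suc i))))
        (cross< {ev (p i)} {ev (s (suc i))} {ev (p (suc h))} {ev (s G)} {ev (t G)} (ev-pos {p i} (P-p i)) (ev-nn {s (suc i)} (N-s (suc i))) (ev-pos {p (suc h)} (P-p (suc h))) (ev-pos {s G} (P-s (suc h)))
          (trans (sym (ev-p-suc (suc h))) (trans (ev-cong (p-t G)) (trans (ev-+ (constP (+ 1)) (x *P t G)) (cong (λ z → + 1 + z) (ev-* x (t G)))))))
      go : ∀ i → suc G ℕ.≤ i → Φ (suc q) (bal r l) +P x *P (x *P (e *P (s i *P s (suc G))))
          ≈P Φ q (bal (suc r) l) +P x *P (x *P (e *P ((t G +P t G) *P p i))) → ev (Φ q (bal (suc r) l)) < ev (Φ (suc q) (bal r l))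
      go i large d = trade-< (trans (sym (expand (Φ (suc q) (bal r l)) (s i *P s (suc G)))) (trans (ev-cong d) (expand (Φ q (bal (suc r) l)) ((t G +P t G) *P p i))))
        (*-monoˡ-<-pos (+ 4) (*-monoˡ-<-pos (+ 4) (scaled (ev-pos {e} (P-E k ks)) (lower-half i large))))

    private
      c₀ c₂ : Poly → ℤ
      c₀ q = coeff q 0
      c₂ q = coeff q 2

      c₀-* : ∀ q r → c₀ (q *P r) ≡ c₀ q * c₀ r
      c₀-* [] r = refl
      c₀-* (a ∷ q) r = trans (coeff-* a q r 0) (+-identityʳ _)

      coeff-x : ∀ q k → coeff (x *P q) (suc k) ≡ - coeff q k
      coeff-x q k = trans (coeff-* (+ 0) (- + 1 ∷ []) q (suc k)) (trans (+-identityˡ _) (trans (coeff-* (- + 1) [] q k) (trans (cong (λ z → - + 1 * coeff q k + z) (zeros k)) (negate (coeff q k)))))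
        where
        zeros : ∀ k → coeff (+ 0 ∷ []) k ≡ + 0
        zeros zero = refl
        zeros (suc k) = refl
        negate : ∀ c → - + 1 * c + + 0 ≡ - c
        negate = solve-∀

      c₀-x : ∀ q → c₀ (x *P q) ≡ + 0
      c₀-x q = c₀-* x q

      c₂-xx : ∀ q → c₂ (x *P (x *P q)) ≡ c₀ q
      c₂-xx q = trans (coeff-x (x *P q) 1) (trans (cong -_ (coeff-x q 0)) (neg-involutive (c₀ q)))

      c₀-p : ∀ n → c₀ (p n) ≡ + 1
      c₀-p zero = refl
      c₀-p (suc n) = trans (coeff-+ (p n) (x *P s (suc n)) 0) (cong₂ _+_ (c₀-p n) (c₀-x (s (suc n))))

      c₀-s : ∀ n → c₀ (s n) ≡ + n
      c₀-s zero = refl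
      c₀-s (suc n) = trans (coeff-+ (s n) (p n) 0) (trans (cong₂ _+_ (c₀-s n) (c₀-p n)) (cong +_ (ℕₚ.+-comm n 1)))

      -- The constant term of `t n` is 1 + ... + n.
      c₀-tt : ∀ n → c₀ (t n +P t n) ≡ + n * + suc n
      c₀-tt zero = refl
      c₀-tt (suc n) = trans (coeff-+ (t (suc n)) (t (suc n)) 0) (trans (cong (λ z → z + z) (trans (coeff-+ (t n) (s (suc n)) 0) (cong (λ z → c₀ (t n) + z) (c₀-s (suc n)))))
        (trans (regroup (c₀ (t n)) (+ suc n)) (trans (cong (λ z → z + (+ suc n + + suc n)) (trans (sym (coeff-+ (t n) (t n) 0)) (c₀-tt n))) (finish (+ n)))))
        where
        regroup : ∀ a b → (a + b) + (a + b) ≡ (a + a) + (b + b)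
        regroup = solve-∀
        finish : ∀ n → n * (+ 1 + n) + ((+ 1 + n) + (+ 1 + n)) ≡ (+ 1 + n) * (+ 1 + (+ 1 + n))
        finish = solve-∀

      c₀-legs : ∀ ks → c₀ (wB (legs ks)) ≡ + 1
      c₀-legs [] = refl
      c₀-legs (k ∷ ks) = trans (c₀-* (p (suc k)) (wB (legs ks))) (cong₂ _*_ (c₀-p (suc k)) (c₀-legs ks))

      c₀-E : ∀ k ks → c₀ (E (k ∷ ks)) ≡ + suc k + c₀ (E ks)
      c₀-E k ks = trans (coeff-+ (s (suc k) *P wB (legs ks)) (p (suc k) *P E ks) 0)
        (cong₂ _+_ (trans (c₀-* (s (suc k)) (wB (legs ks))) (trans (cong₂ _*_ (c₀-s (suc k)) (c₀-legs ks)) (*-identityʳ (+ suc k))))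
                   (trans (c₀-* (p (suc k)) (E ks)) (trans (cong (_* c₀ (E ks)) (c₀-p (suc k))) (*-identityˡ _))))

      c₀-E-nonneg : ∀ ks → + 0 ≤ c₀ (E ks)
      c₀-E-nonneg [] = ≤-refl
      c₀-E-nonneg (k ∷ ks) = subst (+ 0 ≤_) (sym (c₀-E k ks)) (+-mono-≤ (+≤+ z≤n) (c₀-E-nonneg ks))

      c₀-E-pos : ∀ k ks → + 0 < c₀ (E (k ∷ ks))
      c₀-E-pos k ks = subst (+ 0 <_) (sym (c₀-E k ks)) (+-mono-<-≤ (+<+ (s≤s z≤n)) (c₀-E-nonneg ks))

    -- Only the factor x² precedes the differing terms, and it equals λ². Their constant terms are i
    -- (G + 1) and G (G + 1), with i > G, both times the positive constant term of `E`.
    c₂-decreases : ∀ {q r} → Compared q r → coeff (Φ (suc q) (bal r l)) 2 < coeff (Φ q (bal (suc r) l)) 2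
    c₂-decreases {q} {r} c = trade-< (sym (trans (sym (expand (Φ (suc q) (bal r l)) (s i *P s (suc G)))) (trans (at difference 2) (expand (Φ q (bal (suc r) l)) ((t G +P t G) *P p i)))))
        (scaled (c₀-E-pos k ks) (subst₂ _<_ (sym right) (sym left) (*-monoʳ-<-pos (+ suc G) (+<+ i-large))))
      where
      open Compared c
      e : Poly
      e = E (k ∷ ks)
      expand : ∀ f y → c₂ (f +P x *P (x *P (e *P y))) ≡ c₂ f + c₀ e * c₀ y
      expand f y = trans (coeff-+ f (x *P (x *P (e *P y))) 2) (cong (λ z → c₂ f + z) (trans (c₂-xx (e *P y)) (c₀-* e y)))
      right : c₀ ((t G +P t G) *P p i) ≡ + G * + suc G
      right = trans (c₀-* (t G +P t G) (p i)) (trans (cong₂ _*_ (c₀-tt G) (c₀-p i)) (*-identityʳ _))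
      left : c₀ (s i *P s (suc G)) ≡ + i * + suc G
      left = trans (c₀-* (s i) (s (suc G))) (cong₂ _*_ (c₀-s i) (c₀-s (suc G)))

    value : ℕ → Poly
    value q = Φ q (bal (N ∸ q) l)

    private
      -- Two linear functionals order the kites in opposite directions. Both orders are transitive,
      -- so neighbouring values of q suffice, although the differences are computed only for these.
      Separated : ℕ → ℕ → Set
      Separated q q′ = ev (value q) < ev (value q′) × coeff (value q′) 2 < coeff (value q) 2

      one-step : ∀ {q} → Admissible (suc q) → Separated q (suc q)
      one-step {q} adm = subst (λ m → ev (Φ q (bal m l)) < ev (value (suc q)) × coeff (value (suc q)) 2 < coeff (Φ q (bal m l)) 2) r-suc
          (ev-increases cmp , c₂-decreases cmp)
        where
        q<N : suc q ℕ.≤ N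
        q<N = ℕₚ.≤-trans (ℕₚ.m≤m+n (suc q) _) adm
        r-suc : suc (N ∸ suc q) ≡ N ∸ q
        r-suc = sym (ℕₚ.+-∸-assoc 1 q<N)
        cmp : Compared q (N ∸ suc q)
        cmp = compared adm (ℕₚ.m+[n∸m]≡n q<N)

      Separated-trans : ∀ {a b c} → Separated a b → Separated b c → Separated a c
      Separated-trans (e , f) (e′ , f′) = <-trans e e′ , <-trans f′ f

      steps : ∀ d {q} → Admissible (suc d ℕ.+ q) → Separated q (suc d ℕ.+ q)
      steps zero {q} adm = one-step {q} adm
      steps (suc d) {q} adm = Separated-trans {q} {suc d ℕ.+ q} {suc (suc d) ℕ.+ q} (steps d (admissible-≤ (ℕₚ.n≤1+n (suc d ℕ.+ q)) adm)) (one-step {suc d ℕ.+ q} adm)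

      ordered : ∀ {q q′} → q ℕ.< q′ → Admissible q′ → Separated q q′
      ordered {q} {q′} lt adm = subst (λ m → Admissible m → Separated q m) split (steps (q′ ∸ suc q)) adm
        where
        split : suc (q′ ∸ suc q) ℕ.+ q ≡ q′
        split = trans (sym (ℕₚ.+-suc (q′ ∸ suc q) q)) (ℕₚ.m∸n+n≡m lt)

    -- A nonnegative difference makes both functionals weakly increase; for q < q′ the coefficient
    -- of λ² forbids this, for q > q′ the value at 4 does.
    incomparable : ∀ {q q′ δ} → Admissible q → Admissible q′ → Alternating 0 δ → value q′ ≈P value q +P δ → q ≡ q′
    incomparable {q} {q′} {δ} adm adm′ nδ e = decide (ℕₚ.<-cmp q q′)
      where
      c₂-≤ : coeff (value q) 2 ≤ coeff (value q′) 2
      c₂-≤ = subst₂ _≤_ (+-identityʳ _) (sym (trans (at e 2) (coeff-+ (value q) δ 2)))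
        (+-monoʳ-≤ (coeff (value q) 2) (subst (+ 0 ≤_) (*-identityˡ (coeff δ 2)) (nδ 2)))
      ev-≤ : ev (value q) ≤ ev (value q′)
      ev-≤ = subst₂ _≤_ (+-identityʳ _) (sym (trans (ev-cong e) (ev-+ (value q) δ))) (+-monoʳ-≤ (ev (value q)) (ev-nn {δ} nδ))
      decide : Tri (q ℕ.< q′) (q ≡ q′) (q′ ℕ.< q) → q ≡ q′
      decide (tri≈ _ eq _) = eq
      decide (tri< lt _ _) = contradiction (<-≤-trans (proj₂ (ordered lt adm′)) c₂-≤) (<-irrefl refl)
      decide (tri> _ _ gt) = contradiction (<-≤-trans (proj₁ (ordered gt adm)) ev-≤) (<-irrefl refl)

-- Determination of the minimal elements.

module Minimality where

  open import Data.Nat using (ℕ; suc; _+_; _*_; _∸_; _≤_; z≤n; s≤s)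
  open import Data.Nat.Properties
  open import Data.Nat.DivMod using (_/_; m*n/n≡m; /-monoˡ-≤; m/n*n≤m)
  open import Data.Nat.Tactic.RingSolver using (solve-∀)
  open import Data.Bool using (true; _∧_)
  import Data.Integer.Properties as ℤₚ
  open import Data.List using ([]; _∷_; length)
  open import Data.Product using (Σ; ∃; _×_; _,_; proj₁; proj₂)
  open import Data.Sum using (_⊎_; inj₁; inj₂)
  open import Function using (Inverse)
  open import Function.Construct.Identity using (↔-id)
  open import Function.Construct.Composition using (_↔-∘_)
  open import Relation.Binary.PropositionalEquality
  open import Relation.Nullary using (¬_; contradiction)
  open import Defs
  open PolyRing
  open Balanced
  open Laplacian
  open Trees
  open Weights
  open Reduction
  open Members
  open EdgeLists
  open Kites

  ≅-trans : ∀ {n} {F G H : Graph n} → F ≅ G → G ≅ H → F ≅ H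
  ≅-trans (σ , e) (τ , f) = τ ↔-∘ σ , λ i j → trans (e i j) (f (Inverse.to σ i) (Inverse.to σ j))

  pointwise⇒≅ : ∀ {n} {G H : Graph n} → (∀ i j → G i j ≡ H i j) → G ≅ H
  pointwise⇒≅ e = ↔-id _ , e

  InU1-resp : ∀ {n l g} {G H : Graph n} → (∀ i j → G i j ≡ H i j) → InU1 n l g G → InU1 n l g H
  InU1-resp {n} {l} {g} {G} {H} e (((simple , connected , edges) , leaf# , cycle , short) , u , uc , two) =
    ((((λ i j → trans (sym (e i j)) (trans (proj₁ simple i j) (e j i))) , λ i → trans (sym (e i i)) (proj₂ simple i)) ,
      (λ v w → reach (connected v w)) , trans (sumFin-cong (λ i → countFin-cong λ j → cong (_ ∧_) (sym (e i j)))) edges) ,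
     trans (leafCount-iso {G = H} {G} (pointwise⇒≅ λ i j → sym (e i j))) leaf# ,
     (proj₁ cycle , forth (proj₂ cycle)) , λ k k<g (f , c) → short k k<g (f , back c)) ,
    u , forth uc , λ i i≢0 → trans (countFin-cong (λ j → sym (e (u i) j))) (two i i≢0)
    where
    reach : ∀ {v w} → Reachable G v w → Reachable H v w
    reach here = here
    reach (step p r) = step (trans (sym (e _ _)) p) (reach r)
    forth : ∀ {k f} → IsCycle G k f → IsCycle H k f
    forth {f = f} (a , b , c) = a , b , λ i j h → trans (sym (e (f i) (f j))) (c i j h)
    back : ∀ {k f} → IsCycle H k f → IsCycle G k f
    back {f = f} (a , b , c) = a , b , λ i j h → trans (e (f i) (f j)) (c i j h)

  module Main (h l N : ℕ) (2≤l : 2 ≤ l) (enough : l * suc (suc h) ≤ N) where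
    g n : ℕ
    g = suc (suc (suc h))
    n = g + N

    open Sizes h
    open Realize h
    open Member h
    open Drawing h using (U-Γ)
    open KiteOrder h l N 2≤l
    open WeightAlgebra polyCone using (A)
    open WeightAlgebra.Cycle polyCone h using (⟦_⟧; A-kite; Φ)
    open Reduce polyCone h using (extra-kite; leaves-kite; _⊏_; below; optimal)

    Kite : ℕ → Tree true
    Kite q = kite q (bal (N ∸ q) l)

    module _ {q} (adm : Admissible q) where
      private
        q+r : q + (N ∸ q) ≡ N
        q+r = m+[n∸m]≡n (≤-trans (m≤m+n q _) adm)

        room : l ≤ N ∸ q
        room = l≤r {q} adm q+r

      size-Kite : n ≡ size (Kite q)
      size-Kite = sym (trans (cong suc (extra-kite q (bal (N ∸ q) l)))
        (cong (g +_) (trans (cong (q +_) (total-bal (N ∸ q) l 1≤l room)) q+r)))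

      leaves-Kite : leaves (Kite q) ≡ l
      leaves-Kite = count (bal (N ∸ q) l) (length-bal (N ∸ q) l 1≤l room)
        where
        count : ∀ ks → length ks ≡ l → leaves (kite q ks) ≡ l
        count [] e = contradiction (subst (1 ≤_) (sym e) 1≤l) λ ()
        count (k ∷ ks) e = trans (leaves-kite q k ks) e

      U≗Γ : ∀ i j → U n l g q i j ≡ Γ n (Kite q) i j
      U≗Γ = U-Γ (cong (g +_) (sym q+r)) size-Kite 1≤l room

      U-member : InU1 n l g (U n l g q)
      U-member = InU1-resp (λ i j → sym (U≗Γ i j)) (subst (λ l → InU1 n l g (Γ n (Kite q))) leaves-Kite (Γ-member (Kite q) size-Kite))

      Phi-U : Phi (U n l g q) ≈P value q
      Phi-U = ≈trans (Phi-iso {G = U n l g q} {Γ n (Kite q)} (pointwise⇒≅ U≗Γ))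
        (≈trans (Phi-Γ (Kite q) size-Kite) (A-kite q (bal (N ∸ q) l)))

    infix 4 _≼_
    record _≼_ (p q : Poly) : Set where
      constructor lies-below
      field
        gap : Poly
        alternating : Alternating 0 gap
        gap-diff : q ≈P p +P gap

    ≼-trans : ∀ {p q r} → p ≼ q → q ≼ r → p ≼ r
    ≼-trans {p} (lies-below d nd e) (lies-below d′ nd′ e′) = lies-below (d +P d′) (alternating-+ {0} {d} {d′} nd nd′)
      (≈trans e′ (≈trans (+P-cong e (≈refl {d′})) (+P-assoc p d d′)))

    ≈⇒≼ : ∀ {p q} → p ≈P q → p ≼ q
    ≈⇒≼ {p} e = lies-below [] (λ k → ℤₚ.≤-reflexive (sym (ℤₚ.*-zeroʳ (signℤ k)))) (≈trans (≈sym e) (≈sym (+P-identityʳ p)))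

    ⪯⇒≼ : ∀ {G H : Graph n} → G ⪯ H → Phi G ≼ Phi H
    ⪯⇒≼ {G} {H} le = lies-below (Phi H +P negP (Phi G)) (⪯⇒alternating {G = G} {H} le)
      (≈sym (≈trans (≈sym (+P-assoc (Phi G) (Phi H) (negP (Phi G))))
        (≈trans (+P-cong (+P-comm (Phi G) (Phi H)) (≈refl {negP (Phi G)})) (≈trans (+P-assoc (Phi H) (Phi G) (negP (Phi G)))
          (≈trans (+P-cong (≈refl {Phi H}) (+P-inverseʳ (Phi G))) (+P-identityʳ (Phi H)))))))

    ≼⇒⪯ : ∀ {G H : Graph n} → Phi G ≼ Phi H → G ⪯ H
    ≼⇒⪯ {G} {H} (lies-below d nd e) = alternating⇒⪯ {G = G} {H} nd e

    ≼-antisym : ∀ {q q′} → Admissible q → Admissible q′ → value q ≼ value q′ → q ≡ q′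
    ≼-antisym adm adm′ (lies-below d nd e) = incomparable adm adm′ nd e

    -- Each member is some U^{g,q} up to isomorphism or lies strictly above one. Together with
    -- `incomparable` this settles minimality, completeness and distinctness.
    record Reached (G : Graph n) : Set where
      field
        q : ℕ
        adm : Admissible q
        outcome : G ≅ U n l g q ⊎ value q ⊏ Phi G

    reach : ∀ (G : Graph n) → InU1 n l g G → Reached G
    reach G member = go (member-shape member)
      where
      go : (Σ (Tree true) λ T → n ≡ size T × leaves T ≡ l × G ≅ Γ n T) → Reached G
      go (T , n≡ , lv , iso) = finish (optimal l N 2≤l enough T lv (+-cancelˡ-≡ 1 _ _ (sym n≡)))
        where
        finish : _ → Reached G
        finish (q , r , adm , tot , _ , out) = record { q = q ; adm = adm ; outcome = convert out }
          where
          r≡ : r ≡ N ∸ q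
          r≡ = trans (sym (m+n∸m≡n q r)) (cong (_∸ q) tot)
          convert : kite q (bal r l) ~ T ⊎ Φ q (bal r l) ⊏ A ⟦ T ⟧ → G ≅ U n l g q ⊎ value q ⊏ Phi G
          convert (inj₁ e) = inj₁ (≅-trans {F = G} {Γ n T} {U n l g q} iso (≅-trans {F = Γ n T} {Γ n (Kite q)} {U n l g q}
            (Γ-~ n≡ (size-Kite adm) (~sym (subst (λ r → kite q (bal r l) ~ T) r≡ e))) (pointwise⇒≅ λ i j → sym (U≗Γ adm i j))))
          convert (inj₂ (below d pd e)) = inj₂ (below d pd (≈trans (Phi-iso {G = G} {Γ n T} iso)
            (≈trans (Phi-Γ T n≡) (subst (λ r → A ⟦ T ⟧ ≈P Φ q (bal r l) +P d) r≡ e))))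

    reached-≼ : ∀ {G} (R : Reached G) → value (Reached.q R) ≼ Phi G
    reached-≼ {G} record { q = q ; adm = adm ; outcome = inj₁ iso } = ≈⇒≼ (≈sym (≈trans (Phi-iso {G = G} {U n l g q} iso) (Phi-U adm)))
    reached-≼ record { outcome = inj₂ (below d (nd , _) e) } = lies-below d nd e

    -- If H lies below U^{g,q}, some `value q′` lies below `Phi H` and so below `value q`.
    -- Incomparability gives q′ = q, hence H also lies above U^{g,q}, and no coefficient can be
    -- strictly smaller.
    minimal : ∀ q → Admissible q → IsMinimal (InU1 n l g) (U n l g q)
    minimal q adm = U-member adm , λ H member → contradict H (reach H member)
      where
      contradict : ∀ H → Reached H → ¬ (H ≺ U n l g q)
      contradict H R (le , k , k≤n , lt) = ℤₚ.<⇒≱ lt (≼⇒⪯ {U n l g q} {H} (≼-trans (≈⇒≼ (Phi-U adm)) (subst (λ q → value q ≼ Phi H) q′≡q (reached-≼ R))) k k≤n)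
        where
        q′≡q : Reached.q R ≡ q
        q′≡q = ≼-antisym (Reached.adm R) adm (≼-trans (reached-≼ R) (≼-trans (⪯⇒≼ {H} {U n l g q} le) (≈⇒≼ (Phi-U adm))))

    classified : ∀ G → IsMinimal (InU1 n l g) G → ∃ λ q → Admissible q × G ≅ U n l g q
    classified G (member , least) = conclude (reach G member)
      where
      conclude : Reached G → ∃ λ q → Admissible q × G ≅ U n l g q
      conclude record { q = q ; adm = adm ; outcome = inj₁ iso } = q , adm , iso
      conclude record { q = q ; adm = adm ; outcome = inj₂ (below d (nd , pd) e) } = contradiction
        (positive⇒≺ {G = U n l g q} {G} nd pd (≈trans e (+P-cong (≈sym (Phi-U adm)) (≈refl {d})))) (least (U n l g q) (U-member adm))

    distinct : ∀ q q′ → Admissible q → Admissible q′ → U n l g q ≅ U n l g q′ → q ≡ q′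
    distinct q q′ adm adm′ iso = ≼-antisym adm adm′ (≈⇒≼ (≈trans (≈sym (Phi-U adm)) (≈trans (Phi-iso {G = U n l g q} {U n l g q′} iso) (Phi-U adm′))))

  -- Stated for arbitrary n so that the result for g + N can be transported along g + N = n.
  Conclusion : (n l g p : ℕ) → Set
  Conclusion n l g p =
      ((q : ℕ) → q ≤ p → IsMinimal (InU1 n l g) (U n l g q))
      × ((G : Graph n) → IsMinimal (InU1 n l g) G → Σ ℕ λ q → q ≤ p × G ≅ U n l g q)
      × ((q q′ : ℕ) → q ≤ p → q′ ≤ p → U n l g q ≅ U n l g q′ → q ≡ q′)

-- Admissibility expressed by the bound p.

open import Defs
open import Data.Nat using (ℕ; suc; s≤s; z≤n; _+_; _*_; _∸_; _≤_)
open import Data.Nat.DivMod using (_/_; m*n/n≡m; /-monoˡ-≤; m/n*n≤m)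
open import Data.Nat.Properties
open import Data.Nat.Tactic.RingSolver using (solve-∀)
open import Data.Product using (Σ; _×_; _,_)
open import Relation.Binary.PropositionalEquality using (_≡_; refl; sym; trans; cong; cong₂; subst; subst₂)
open Kites
open Minimality

theorem3p3 : ∀ (n l g : ℕ) → 3 ≤ g → 2 ≤ l → g + g * l ≤ n + l →
    ((q : ℕ) → q ≤ (n + l ∸ (g + g * l)) / suc l →
    IsMinimal (InU1 n l g) (U n l g q))
    × ((G : Graph n) → IsMinimal (InU1 n l g) G →
    Σ ℕ λ q → q ≤ (n + l ∸ (g + g * l)) / suc l × G ≅ U n l g q)
    × ((q q′ : ℕ) → q ≤ (n + l ∸ (g + g * l)) / suc l →
    q′ ≤ (n + l ∸ (g + g * l)) / suc l → U n l g q ≅ U n l g q′ → q ≡ q′)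
theorem3p3 n l g@(suc (suc (suc h))) (s≤s (s≤s (s≤s z≤n))) 2≤l bound =
  subst (λ m → Conclusion m l g ((n + l ∸ (g + g * l)) / suc l)) n≡
    ((λ q q≤ → M.minimal q (admissible q≤))
    , (λ H least → let q , adm , iso = M.classified H least in q , bounded adm , iso)
    , λ q q′ q≤ q′≤ iso → M.distinct q q′ (admissible q≤) (admissible q′≤) iso)
  where
  N : ℕ
  N = n ∸ g
  g≤n : g ≤ n
  g≤n = +-cancelʳ-≤ l g n (≤-trans (+-monoʳ-≤ g (m≤m+n l _)) bound)
  n≡ : g + N ≡ n
  n≡ = m+[n∸m]≡n g≤n
  G : ℕ
  G = suc (suc h)
  regroup : (g l N G : ℕ) → suc G ≡ g → g + g * l ≡ g + l + l * G
  regroup .(suc G) l N G refl = lemma G l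
    where
    lemma : ∀ G l → suc G + suc G * l ≡ suc G + l + l * G
    lemma = solve-∀
  total≡ : n + l ≡ g + l + N
  total≡ = trans (cong (_+ l) (sym n≡)) (lemma g N l)
    where
    lemma : ∀ g N l → g + N + l ≡ g + l + N
    lemma = solve-∀
  -- After cancelling g + l the hypothesis on n says exactly that q = 0 is admissible.
  enough : l * G ≤ N
  enough = +-cancelˡ-≤ (g + l) _ _ (subst₂ _≤_ (regroup g l N G refl) total≡ bound)
  slack : n + l ∸ (g + g * l) ≡ N ∸ l * G
  slack = trans (cong₂ _∸_ total≡ (regroup g l N G refl)) ([m+n]∸[m+o]≡n∸o (g + l) N (l * G))
  module M = Main h l N 2≤l enough
  open KiteOrder h l N 2≤l using (Admissible)
  -- In this form admissibility reads q (l + 1) ≤ N - l G, and N - l (g - 1) = n - g - g l + l is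
  -- the numerator of p; division by l + 1 then gives q ≤ p in both directions.
  split : (q : ℕ) → q + l * (q + G) ≡ q * suc l + l * G
  split q = lemma q l G
    where
    lemma : (q l G : ℕ) → q + l * (q + G) ≡ q * suc l + l * G
    lemma = solve-∀
  admissible : ∀ {q : ℕ} → q ≤ (n + l ∸ (g + g * l)) / suc l → Admissible q
  admissible {q} q≤ = subst (_≤ N) (sym (split q)) (subst (q * suc l + l * G ≤_) (m∸n+n≡m enough)
    (+-monoˡ-≤ (l * G) (≤-trans (*-monoˡ-≤ (suc l) q≤) (subst (λ X → X / suc l * suc l ≤ N ∸ l * G) (sym slack) (m/n*n≤m (N ∸ l * G) (suc l))))))
  bounded : ∀ {q : ℕ} → Admissible q → q ≤ (n + l ∸ (g + g * l)) / suc l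
  bounded {q} adm = subst (λ X → q ≤ X / suc l) (sym slack) (subst (_≤ (N ∸ l * G) / suc l) (m*n/n≡m q (suc l))
    (/-monoˡ-≤ (suc l) (subst (_≤ N ∸ l * G) (m+n∸n≡m (q * suc l) (l * G)) (∸-monoˡ-≤ (l * G) (subst (_≤ N) (split q) adm)))))
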